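{- Let $n\ge2$ and let a path on vertices $1,\ldots,n+1$ have positive edge weights $a_1,\ldots,a_n$, where $a_i$ is the weight of the edge joining $i$ and $i+1$. For $1\le i\le j\le n+1$ let $\rho_{i,j}$ denote the spectral radius of the weighted adjacency matrix induced by the interval of vertices $[i,j]$, with $\rho_{i,i}=0$. Then $$\rho_{1,n}\,\rho_{2,n+1}\ \ge\ \rho_{2,n}\,\rho_{1,n+1}.$$
   Context: The weighted adjacency matrix induced by $[i,j]$ is the $(j-i+1)\times(j-i+1)$ symmetric tridiagonal matrix indexed by $i,i+1,\dots,j$ with zero diagonal and with $(m,m+1)$ and $(m+1,m)$ entries equal to $a_m$ for $i\le m\le j-1$. -}

module Defs where

open import Data.Bool.Base using (if_then_else_)
open import Data.Fin.Base using (Fin; toℕ)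
open import Data.Nat.Base as ℕ using (ℕ; suc; _∸_; _≡ᵇ_)
import Data.Nat.Properties as ℕ
open import Data.Product.Base using (Σ-syntax; ∃-syntax; _×_; _,_)
open import Data.Rational.Base as ℚ using (ℚ; 0ℚ; 1ℚ; ∣_∣)
import Data.Rational.Properties as ℚ
open import Data.Rational.Solver using (module +-*-Solver)
open import Data.Vec.Functional using (Vector; foldr)
open import Relation.Binary.PropositionalEquality using (_≡_; refl; sym; cong; cong₂; subst)
open import Relation.Nullary.Negation using (¬_)

-- Real numbers are Cauchy sequences of rationals (each with a modulus of
-- convergence), compared by the setoid equality _≈_ below.

Eventually : (ℕ → Set) → Set
Eventually P = ∃[ N ] (∀ n → N ℕ.≤ n → P n)

Cauchy : (ℕ → ℚ) → Set
Cauchy x = ∀ ε → 0ℚ ℚ.< ε →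
  ∃[ N ] (∀ m n → N ℕ.≤ m → N ℕ.≤ n → ∣ x m ℚ.- x n ∣ ℚ.≤ ε)

record ℝ : Set where
  constructor mkℝ
  field
    seq    : ℕ → ℚ
    cauchy : Cauchy seq

open ℝ public

private
  neg-sub : ∀ p q → (ℚ.- p) ℚ.- (ℚ.- q) ≡ q ℚ.- p
  neg-sub = solve 2 (λ p q → (:- p) :- (:- q) := q :- p) refl
    where open +-*-Solver

  sub-add : ∀ p q → p ≡ (p ℚ.- q) ℚ.+ q
  sub-add = solve 2 (λ p q → p := (p :- q) :+ q) refl
    where open +-*-Solver

  add-sub-add : ∀ a b c d → (a ℚ.+ b) ℚ.- (c ℚ.+ d) ≡ (a ℚ.- c) ℚ.+ (b ℚ.- d)
  add-sub-add = solve 4 (λ a b c d → (a :+ b) :- (c :+ d) := (a :- c) :+ (b :- d)) refl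
    where open +-*-Solver

  mul-sub-mul : ∀ a b c d → a ℚ.* b ℚ.- c ℚ.* d ≡ a ℚ.* (b ℚ.- d) ℚ.+ d ℚ.* (a ℚ.- c)
  mul-sub-mul = solve 4 (λ a b c d → a :* b :- c :* d := a :* (b :- d) :+ d :* (a :- c)) refl
    where open +-*-Solver

  split : ∀ B {ε} → 0ℚ ℚ.< B → 0ℚ ℚ.< ε → ∃[ δ ] (0ℚ ℚ.< δ × B ℚ.* δ ≡ ε)
  split B {ε} 0<B 0<ε = r ℚ.* ε , 0<δ , B*δ≡ε
    where
    open ℚ.≤-Reasoning
    instance
      B>0 : ℚ.Positive B
      B>0 = ℚ.positive 0<B
      B≢0 : ℚ.NonZero B
      B≢0 = ℚ.pos⇒nonZero B
    r : ℚ
    r = ℚ.1/ B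
    0<δ : 0ℚ ℚ.< r ℚ.* ε
    0<δ = subst (ℚ._< r ℚ.* ε) (ℚ.*-zeroʳ r) (ℚ.*-monoʳ-<-pos r {{ℚ.1/pos⇒pos B}} 0<ε)
    B*δ≡ε : B ℚ.* (r ℚ.* ε) ≡ ε
    B*δ≡ε = begin-equality
      B ℚ.* (r ℚ.* ε)   ≡⟨ ℚ.*-assoc B r ε ⟨
      (B ℚ.* r) ℚ.* ε   ≡⟨ cong (ℚ._* ε) (ℚ.*-inverseʳ B) ⟩
      1ℚ ℚ.* ε          ≡⟨ ℚ.*-identityˡ ε ⟩
      ε                 ∎

  0<sum : ∀ p q → 0ℚ ℚ.< p → 0ℚ ℚ.< q → 0ℚ ℚ.< p ℚ.+ q
  0<sum p q = ℚ.+-mono-< {0ℚ} {p} {0ℚ} {q}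

  ∣*∣≤ : ∀ p q D {d} → 0ℚ ℚ.< D → ∣ p ∣ ℚ.≤ D → ∣ q ∣ ℚ.≤ d → ∣ p ℚ.* q ∣ ℚ.≤ D ℚ.* d
  ∣*∣≤ p q D {d} 0<D p≤D q≤d = begin
    ∣ p ℚ.* q ∣      ≡⟨ ℚ.∣p*q∣≡∣p∣*∣q∣ p q ⟩
    ∣ p ∣ ℚ.* ∣ q ∣  ≤⟨ ℚ.*-monoʳ-≤-nonNeg ∣ q ∣ {{ℚ.nonNegative (ℚ.0≤∣p∣ q)}} p≤D ⟩
    D ℚ.* ∣ q ∣      ≤⟨ ℚ.*-monoˡ-≤-nonNeg D {{ℚ.nonNegative (ℚ.<⇒≤ 0<D)}} q≤d ⟩
    D ℚ.* d          ∎
    where open ℚ.≤-Reasoning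

  cauchy-*-from-bounds : ∀ (x y : ℕ → ℚ) B C δ ε K L M N →
    0ℚ ℚ.< B → (∀ n → K ℕ.≤ n → ∣ x n ∣ ℚ.≤ B) →
    0ℚ ℚ.< C → (∀ n → L ℕ.≤ n → ∣ y n ∣ ℚ.≤ C) →
    (∀ m n → M ℕ.≤ m → M ℕ.≤ n → ∣ x m ℚ.- x n ∣ ℚ.≤ δ) →
    (∀ m n → N ℕ.≤ m → N ℕ.≤ n → ∣ y m ℚ.- y n ∣ ℚ.≤ δ) →
    (B ℚ.+ C) ℚ.* δ ≡ ε →
    ∀ m n → (K ℕ.⊔ L) ℕ.⊔ (M ℕ.⊔ N) ℕ.≤ m → (K ℕ.⊔ L) ℕ.⊔ (M ℕ.⊔ N) ℕ.≤ n →
    ∣ x m ℚ.* y m ℚ.- x n ℚ.* y n ∣ ℚ.≤ ε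
  cauchy-*-from-bounds x y B C δ ε K L M N 0<B bx 0<C by hx hy eq m n m≥ n≥ = begin
    ∣ x m ℚ.* y m ℚ.- x n ℚ.* y n ∣
      ≡⟨ cong ∣_∣ (mul-sub-mul (x m) (y m) (x n) (y n)) ⟩
    ∣ x m ℚ.* (y m ℚ.- y n) ℚ.+ y n ℚ.* (x m ℚ.- x n) ∣
      ≤⟨ ℚ.∣p+q∣≤∣p∣+∣q∣ (x m ℚ.* (y m ℚ.- y n)) (y n ℚ.* (x m ℚ.- x n)) ⟩
    ∣ x m ℚ.* (y m ℚ.- y n) ∣ ℚ.+ ∣ y n ℚ.* (x m ℚ.- x n) ∣
      ≤⟨ ℚ.+-mono-≤
           (∣*∣≤ (x m) (y m ℚ.- y n) B 0<B (bx m (ℕ.m⊔n≤o⇒m≤o K L m≥KL))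
             (hy m n (ℕ.m⊔n≤o⇒n≤o M N m≥MN) (ℕ.m⊔n≤o⇒n≤o M N n≥MN)))
           (∣*∣≤ (y n) (x m ℚ.- x n) C 0<C (by n (ℕ.m⊔n≤o⇒n≤o K L n≥KL))
             (hx m n (ℕ.m⊔n≤o⇒m≤o M N m≥MN) (ℕ.m⊔n≤o⇒m≤o M N n≥MN))) ⟩
    B ℚ.* δ ℚ.+ C ℚ.* δ
      ≡⟨ ℚ.*-distribʳ-+ δ B C ⟨
    (B ℚ.+ C) ℚ.* δ
      ≡⟨ eq ⟩
    ε ∎
    where
    open ℚ.≤-Reasoning
    m≥KL = ℕ.m⊔n≤o⇒m≤o (K ℕ.⊔ L) (M ℕ.⊔ N) m≥
    n≥KL = ℕ.m⊔n≤o⇒m≤o (K ℕ.⊔ L) (M ℕ.⊔ N) n≥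
    m≥MN = ℕ.m⊔n≤o⇒n≤o (K ℕ.⊔ L) (M ℕ.⊔ N) m≥
    n≥MN = ℕ.m⊔n≤o⇒n≤o (K ℕ.⊔ L) (M ℕ.⊔ N) n≥

-- These proofs are never computed with: only their statements matter.
opaque
  cauchy-const : ∀ q → Cauchy (λ _ → q)
  cauchy-const q ε 0<ε = 0 , λ _ _ _ _ →
    subst (λ r → ∣ r ∣ ℚ.≤ ε) (sym (ℚ.+-inverseʳ q)) (ℚ.<⇒≤ 0<ε)

  cauchy-+ : ∀ {x y} → Cauchy x → Cauchy y → Cauchy (λ n → x n ℚ.+ y n)
  cauchy-+ {x} {y} cx cy ε 0<ε =
    let δ , 0<δ , 2δ≡ε = split (1ℚ ℚ.+ 1ℚ) (ℚ.positive⁻¹ (1ℚ ℚ.+ 1ℚ)) 0<ε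
        M , hx = cx δ 0<δ
        N , hy = cy δ 0<δ
    in M ℕ.⊔ N , λ m n m≥ n≥ → begin
      ∣ (x m ℚ.+ y m) ℚ.- (x n ℚ.+ y n) ∣
        ≡⟨ cong ∣_∣ (add-sub-add (x m) (y m) (x n) (y n)) ⟩
      ∣ (x m ℚ.- x n) ℚ.+ (y m ℚ.- y n) ∣
        ≤⟨ ℚ.∣p+q∣≤∣p∣+∣q∣ (x m ℚ.- x n) (y m ℚ.- y n) ⟩
      ∣ x m ℚ.- x n ∣ ℚ.+ ∣ y m ℚ.- y n ∣
        ≤⟨ ℚ.+-mono-≤ (hx m n (ℕ.m⊔n≤o⇒m≤o M N m≥) (ℕ.m⊔n≤o⇒m≤o M N n≥))
                      (hy m n (ℕ.m⊔n≤o⇒n≤o M N m≥) (ℕ.m⊔n≤o⇒n≤o M N n≥)) ⟩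
      δ ℚ.+ δ
        ≡⟨ cong₂ ℚ._+_ (ℚ.*-identityˡ δ) (ℚ.*-identityˡ δ) ⟨
      1ℚ ℚ.* δ ℚ.+ 1ℚ ℚ.* δ
        ≡⟨ ℚ.*-distribʳ-+ δ 1ℚ 1ℚ ⟨
      (1ℚ ℚ.+ 1ℚ) ℚ.* δ
        ≡⟨ 2δ≡ε ⟩
      ε ∎
    where open ℚ.≤-Reasoning

  cauchy-neg : ∀ {x} → Cauchy x → Cauchy (λ n → ℚ.- x n)
  cauchy-neg {x} cx ε 0<ε =
    let N , hx = cx ε 0<ε
    in N , λ m n m≥ n≥ →
      subst (ℚ._≤ ε) (cong ∣_∣ (sym (neg-sub (x m) (x n)))) (hx n m n≥ m≥)

  cauchy-bounded : ∀ {x} → Cauchy x →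
                   ∃[ B ] (0ℚ ℚ.< B × Eventually (λ n → ∣ x n ∣ ℚ.≤ B))
  cauchy-bounded {x} cx =
    let N , hx = cx 1ℚ (ℚ.positive⁻¹ 1ℚ)
    in 1ℚ ℚ.+ ∣ x N ∣ ,
       ℚ.+-mono-<-≤ (ℚ.positive⁻¹ 1ℚ) (ℚ.0≤∣p∣ (x N)) ,
       N , λ n n≥ → begin
      ∣ x n ∣
        ≡⟨ cong ∣_∣ (sub-add (x n) (x N)) ⟩
      ∣ (x n ℚ.- x N) ℚ.+ x N ∣
        ≤⟨ ℚ.∣p+q∣≤∣p∣+∣q∣ (x n ℚ.- x N) (x N) ⟩
      ∣ x n ℚ.- x N ∣ ℚ.+ ∣ x N ∣
        ≤⟨ ℚ.+-monoˡ-≤ ∣ x N ∣ (hx n N n≥ ℕ.≤-refl) ⟩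
      1ℚ ℚ.+ ∣ x N ∣ ∎
    where open ℚ.≤-Reasoning

  cauchy-* : ∀ {x y} → Cauchy x → Cauchy y → Cauchy (λ n → x n ℚ.* y n)
  cauchy-* {x} {y} cx cy ε 0<ε =
    let B , 0<B , K , bx = cauchy-bounded {x} cx
        C , 0<C , L , by = cauchy-bounded {y} cy
        δ , 0<δ , eq = split (B ℚ.+ C) (0<sum B C 0<B 0<C) 0<ε
        M , hx = cx δ 0<δ
        N , hy = cy δ 0<δ
    in (K ℕ.⊔ L) ℕ.⊔ (M ℕ.⊔ N) ,
       cauchy-*-from-bounds x y B C δ ε K L M N 0<B bx 0<C by hx hy eq

infixl 6 _+_ _-_ _+ᶜ_
infixl 7 _*_ _*ᶜ_
infix  8 -_
infix  4 _≈_ _≤_ _<_ _≈ᶜ_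

0ℝ : ℝ
0ℝ = mkℝ (λ _ → 0ℚ) (cauchy-const 0ℚ)

_+_ : ℝ → ℝ → ℝ
x + y = mkℝ (λ n → seq x n ℚ.+ seq y n) (cauchy-+ {seq x} {seq y} (cauchy x) (cauchy y))

-_ : ℝ → ℝ
- x = mkℝ (λ n → ℚ.- seq x n) (cauchy-neg {seq x} (cauchy x))

_-_ : ℝ → ℝ → ℝ
x - y = x + (- y)

_*_ : ℝ → ℝ → ℝ
x * y = mkℝ (λ n → seq x n ℚ.* seq y n) (cauchy-* {seq x} {seq y} (cauchy x) (cauchy y))

_≈_ : ℝ → ℝ → Set
x ≈ y = ∀ ε → 0ℚ ℚ.< ε → Eventually (λ n → ∣ seq x n ℚ.- seq y n ∣ ℚ.≤ ε)

_≤_ : ℝ → ℝ → Set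
x ≤ y = ∀ ε → 0ℚ ℚ.< ε → Eventually (λ n → seq x n ℚ.≤ seq y n ℚ.+ ε)

_<_ : ℝ → ℝ → Set
x < y = ∃[ ε ] (0ℚ ℚ.< ε × Eventually (λ n → seq x n ℚ.+ ε ℚ.≤ seq y n))

record ℂ : Set where
  constructor _+i_
  field
    re im : ℝ

open ℂ public

fromℝ : ℝ → ℂ
fromℝ x = x +i 0ℝ

0ℂ : ℂ
0ℂ = fromℝ 0ℝ

_+ᶜ_ : ℂ → ℂ → ℂ
z +ᶜ w = (re z + re w) +i (im z + im w)

_*ᶜ_ : ℂ → ℂ → ℂ
z *ᶜ w = (re z * re w - im z * im w) +i (re z * im w + im z * re w)

_≈ᶜ_ : ℂ → ℂ → Set
z ≈ᶜ w = re z ≈ re w × im z ≈ im w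

∣_∣² : ℂ → ℝ
∣ z ∣² = re z * re z + im z * im z

Matrix : ℕ → Set
Matrix d = Fin d → Fin d → ℝ

_·_ : ∀ {d} → Matrix d → Vector ℂ d → Vector ℂ d
(A · v) k = foldr _+ᶜ_ 0ℂ (λ l → fromℝ (A k l) *ᶜ v l)

IsEigenvalue : ∀ {d} → Matrix d → ℂ → Set
IsEigenvalue {d} A z =
  Σ[ v ∈ Vector ℂ d ] (¬ (∀ k → v k ≈ᶜ 0ℂ) × (∀ k → (A · v) k ≈ᶜ z *ᶜ v k))

-- ρ is the largest modulus of a complex eigenvalue. Moduli are compared with
-- ρ ≥ 0 through their squares, which avoids square roots.
record IsSpectralRadius {d : ℕ} (A : Matrix d) (ρ : ℝ) : Set where
  field
    nonNegative : 0ℝ ≤ ρ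
    attained    : ∃[ z ] (IsEigenvalue A z × ∣ z ∣² ≈ ρ * ρ)
    maximal     : ∀ z → IsEigenvalue A z → ∣ z ∣² ≤ ρ * ρ

-- The edge joining u and u + 1 has weight a u.
pathAdjacency : (ℕ → ℝ) → ℕ → ℕ → ℝ
pathAdjacency a u v =
  if v ≡ᵇ suc u then a u else if u ≡ᵇ suc v then a v else 0ℝ

-- Row and column k of the matrix stand for the vertex i + k, so that for
-- i ≤ j the index set Fin (j - i + 1) represents i , … , j.
intervalMatrix : (ℕ → ℝ) → (i j : ℕ) → Matrix (suc (j ∸ i))
intervalMatrix a i j k l = pathAdjacency a (i ℕ.+ toℕ k) (i ℕ.+ toℕ l)

{-# OPTIONS --safe #-}

-- Write μ, ν, α, β for the radii of [2,n], [1,n+1], [1,n], [2,n+1], and u, v, p,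
-- q for the corresponding positive eigenvectors, extended by zero. If two walkers
-- x ≤ y of the same parity start inside [2,n] and [1,n+1], their paths can only
-- exchange order by meeting, and swapping the paths at meetings confines one
-- walker to [1,n] and the other to [2,n+1]. At the level of eigenvectors this says
-- that for a constant K, for c = (μν)^k and d = (αβ)^k K, and for all x ≤ y with
-- y - x even, the three inequalities
--   c v(x)u(y) ≤ d p(x)q(y),   c u(x)v(y) ≤ d p(x)q(y),
--   c (u(x)v(y) + v(x)u(y)) ≤ d (p(x)q(y) + q(x)p(y))
-- propagate from k to k + 1: off the diagonal each one follows from the same one
-- at the four neighbours of (x,y), and on the diagonal the two mixed neighbours
-- are handled by the third. Letting k grow gives μν ≤ αβ.
--
-- The eigenvectors come from the largest roots of the characteristic polynomials,
-- which interlace strictly by the Wronskian recursion; this also locates the next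
-- root constructively, since of two points x < y above the previous root, either
-- the polynomial is ≤ 0 at x or it is ≥ 0 at y.
module Submission where

open import Algebra.Bundles using (CommutativeRing)
import Algebra.Solver.Ring as RingSolver
open import Algebra.Solver.Ring.AlmostCommutativeRing using (fromCommutativeRing; _-Raw-AlmostCommutative⟶_)
open import Data.Empty using (⊥-elim)
open import Data.Fin.Base using (Fin; zero; suc; toℕ; fromℕ<)
import Data.Fin.Properties as Fin
open import Data.Integer.Base as ℤ using (+_; -[1+_])
import Data.Integer.Properties as ℤ
open import Data.Maybe.Base using (Maybe; just; nothing)
open import Data.Nat.Base as ℕ using (ℕ; zero; suc)
import Data.Nat.Properties as ℕ
open import Data.Product.Base using (∃-syntax; _×_; _,_; proj₁; proj₂)
open import Data.Rational.Base as ℚ using (ℚ; 0ℚ; 1ℚ; ½; ∣_∣; mkℚ)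
import Data.Rational.Properties as ℚ
open import Data.Rational.Solver using (module +-*-Solver)
open import Data.Rational.Unnormalised.Base as ℚᵘ using (mkℚᵘ; *≡*; *≤*)
import Data.Rational.Unnormalised.Properties as ℚᵘ
open import Data.Sum.Base using (_⊎_; inj₁; inj₂; [_,_]′)
open import Data.Vec.Functional using (Vector; foldr)
open import Function.Base using (_∘_)
open import Level using (0ℓ)
open import Relation.Binary.PropositionalEquality as ≡ using (_≡_)
open import Relation.Nullary.Decidable using (yes; no)
open import Relation.Nullary.Negation using (¬_)

-- Signs of reals are undecidable and the axioms offer no inverses. Quotients are therefore cleared
-- throughout, and weak inequalities are proved by refuting the strict reverse, which suffices
-- because `0≤` is stable under double negation. The same iterate-and-compare argument serves twice.
-- Besides comparing `μ * ν` with `α * β`, it identifies a given spectral radius with the Perron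
-- root `L`: the squared moduli of a complex eigenvector are at most `K` times those of the Perron
-- vector, and applying the matrix `k` times turns this into a bound of |z|^(2k) by a multiple of
-- L^(2k), so |z| > L forces the eigenvector to vanish. The supports shape the propagation step. An
-- eigenvector equation is available only inside the vector's own interval; next to an end one
-- neighbour is positive while the entry is zero. So the step first asks whether the left side
-- vanishes; where it does not, the order x ≤ y places x in [1,n] and y in [2,n+1], which is exactly
-- where the equations of `p` and `q` hold.

ι : ℕ → ℚ
ι zero    = 0ℚ
ι (suc n) = 1ℚ ℚ.+ ι n

-- Constructive axioms for the reals: 0≤-stable and 0<-split stand in for the
-- trichotomy of the order, bisection for its completeness.
record CompleteOrderedRing : Set₁ where
  field
    commutativeRing : CommutativeRing 0ℓ 0ℓ

  open CommutativeRing commutativeRing public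

  infix 4 0≤_ 0<_ _≤_ _<_

  field
    0≤_ 0<_ : Carrier → Set

    0≤-resp     : ∀ {x y} → x ≈ y → 0≤ x → 0≤ y
    0<-resp     : ∀ {x y} → x ≈ y → 0< x → 0< y
    0≤-+        : ∀ {x y} → 0≤ x → 0≤ y → 0≤ (x + y)
    0≤-*        : ∀ {x y} → 0≤ x → 0≤ y → 0≤ (x * y)
    0<-+        : ∀ {x y} → 0< x → 0≤ y → 0< (x + y)
    0<-*        : ∀ {x y} → 0< x → 0< y → 0< (x * y)
    0<⇒0≤       : ∀ {x} → 0< x → 0≤ x
    0<-split    : ∀ {x y} → 0< (x + y) → 0< x ⊎ 0< y
    0<-irrefl   : ∀ {x} → 0< x → ¬ (0≤ (- x))
    0≤-stable   : ∀ {x} → ¬ (0< (- x)) → 0≤ x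
    0≤-antisym  : ∀ {x} → 0≤ x → 0≤ (- x) → x ≈ 0#
    fromℚ       : ℚ → Carrier
    fromℚ-+     : ∀ p q → fromℚ (p ℚ.+ q) ≈ fromℚ p + fromℚ q
    fromℚ-*     : ∀ p q → fromℚ (p ℚ.* q) ≈ fromℚ p * fromℚ q
    fromℚ--     : ∀ p → fromℚ (ℚ.- p) ≈ - fromℚ p
    fromℚ-0     : fromℚ 0ℚ ≈ 0#
    fromℚ-1     : fromℚ 1ℚ ≈ 1#
    fromℚ-0≤    : ∀ {p} → 0ℚ ℚ.≤ p → 0≤ fromℚ p
    fromℚ-0<    : ∀ {p} → 0ℚ ℚ.< p → 0< fromℚ p
    archimedean : ∀ x {y} → 0< y → ∃[ n ] 0≤ (fromℚ (ι n) * y - x)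
    bisection   : ∀ (Lo Hi : ℚ → Set) k → Lo 0ℚ → Hi (ι k) →
                  (∀ x y → 0ℚ ℚ.≤ x → x ℚ.< y → y ℚ.≤ ι k → Lo x ⊎ Hi y) →
                  ∃[ r ] ((0≤ r) × (0≤ (fromℚ (ι k) - r)) ×
                    (∀ n → ∃[ x ] ∃[ y ] (Lo x × Hi y × 0ℚ ℚ.≤ x × y ℚ.≤ ι k ×
                       (0≤ (r - fromℚ x)) × (0≤ (fromℚ y - r)) × ι n ℚ.* (y ℚ.- x) ℚ.≤ 1ℚ)))

  _≤_ _<_ : Carrier → Carrier → Set
  x ≤ y = 0≤ (y - x)
  x < y = 0< (y - x)

-- Order arithmetic without division.

module OrderedRingTheory (O : CompleteOrderedRing) where
  open CompleteOrderedRing O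

  private
    ℚ-morphism : CommutativeRing.rawRing ℚ.+-*-commutativeRing
                   -Raw-AlmostCommutative⟶ fromCommutativeRing commutativeRing
    ℚ-morphism = record
      { ⟦_⟧ = fromℚ ; +-homo = fromℚ-+ ; *-homo = fromℚ-* ; -‿homo = fromℚ--
      ; 0-homo = fromℚ-0 ; 1-homo = fromℚ-1 }

    _coeff≟_ : ∀ p q → Maybe (fromℚ p ≈ fromℚ q)
    p coeff≟ q with p ℚ.≟ q
    ... | yes ≡.refl = just refl
    ... | no  _      = nothing

  open RingSolver (CommutativeRing.rawRing ℚ.+-*-commutativeRing)
         (fromCommutativeRing commutativeRing) ℚ-morphism _coeff≟_
    using (solve; _:+_; _:*_; :-_; _:-_; _:=_)

  open import Algebra.Properties.Ring ring using (-0#≈0#; -‿involutive)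

  0≤0 : 0≤ 0#
  0≤0 = 0≤-resp fromℚ-0 (fromℚ-0≤ ℚ.≤-refl)

  0<1 : 0< 1#
  0<1 = 0<-resp fromℚ-1 (fromℚ-0< (ℚ.positive⁻¹ 1ℚ))

  0≤-zero : ∀ {x} → x ≈ 0# → 0≤ x
  0≤-zero x≈0 = 0≤-resp (sym x≈0) 0≤0

  ≈⇒≤ : ∀ {x y} → x ≈ y → x ≤ y
  ≈⇒≤ {x} {y} x≈y = 0≤-zero (trans (+-congˡ (-‿cong x≈y)) (-‿inverseʳ y))

  ≤-refl : ∀ {x} → x ≤ x
  ≤-refl = ≈⇒≤ refl

  ≤-trans : ∀ {x y z} → x ≤ y → y ≤ z → x ≤ z
  ≤-trans {x} {y} {z} x≤y y≤z =
    0≤-resp (solve 3 (λ x y z → (y :- x) :+ (z :- y) := z :- x) refl x y z) (0≤-+ x≤y y≤z)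

  ≤-resp : ∀ {x x′ y y′} → x ≈ x′ → y ≈ y′ → x ≤ y → x′ ≤ y′
  ≤-resp x≈x′ y≈y′ = 0≤-resp (+-cong y≈y′ (-‿cong x≈x′))

  x-0≈x : ∀ {x z} → z ≈ 0# → x - z ≈ x
  x-0≈x z≈0 = trans (+-congˡ (trans (-‿cong z≈0) -0#≈0#)) (+-identityʳ _)

  ≤-antisym : ∀ {x y} → x ≤ y → y ≤ x → x ≈ y
  ≤-antisym {x} {y} x≤y y≤x = trans
    (solve 2 (λ x y → x := y :- (y :- x)) refl x y)
    (x-0≈x (0≤-antisym x≤y (0≤-resp (solve 2 (λ x y → x :- y := :- (y :- x)) refl x y) y≤x)))

  0≤-≤ : ∀ {x y} → 0≤ x → x ≤ y → 0≤ y
  0≤-≤ {x} {y} 0≤x x≤y = 0≤-resp (solve 2 (λ x y → x :+ (y :- x) := y) refl x y) (0≤-+ 0≤x x≤y)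

  0<-≤ : ∀ {x y} → 0< x → x ≤ y → 0< y
  0<-≤ {x} {y} 0<x x≤y = 0<-resp (solve 2 (λ x y → x :+ (y :- x) := y) refl x y) (0<-+ 0<x x≤y)

  ≤-zero : ∀ {x y} → x ≈ 0# → 0≤ y → x ≤ y
  ≤-zero x≈0 0≤y = 0≤-resp (sym (x-0≈x x≈0)) 0≤y

  0≮0 : ∀ {x} → x ≈ 0# → ¬ (0< x)
  0≮0 x≈0 0<x = 0<-irrefl 0<x (0≤-zero (trans (-‿cong x≈0) -0#≈0#))

  *-zeroˡ-≈ : ∀ {x} y → x ≈ 0# → x * y ≈ 0#
  *-zeroˡ-≈ y x≈0 = trans (*-congʳ x≈0) (zeroˡ y)

  *-zeroʳ-≈ : ∀ x {y} → y ≈ 0# → x * y ≈ 0#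
  *-zeroʳ-≈ x y≈0 = trans (*-congˡ y≈0) (zeroʳ x)

  ≤-stable : ∀ {x y} → ¬ (y < x) → x ≤ y
  ≤-stable {x} {y} y≮x = 0≤-stable λ 0<- →
    y≮x (0<-resp (solve 2 (λ x y → :- (y :- x) := x :- y) refl x y) 0<-)

  <⇒≱ : ∀ {x y} → x < y → ¬ (y ≤ x)
  <⇒≱ {x} {y} x<y y≤x = 0<-irrefl x<y (0≤-resp (solve 2 (λ x y → x :- y := :- (y :- x)) refl x y) y≤x)

  *-mono-≤ : ∀ {x y z w} → 0≤ x → 0≤ w → x ≤ y → z ≤ w → x * z ≤ y * w
  *-mono-≤ {x} {y} {z} {w} 0≤x 0≤w x≤y z≤w = 0≤-resp
    (solve 4 (λ x y z w → x :* (w :- z) :+ (y :- x) :* w := y :* w :- x :* z) refl x y z w)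
    (0≤-+ (0≤-* 0≤x z≤w) (0≤-* x≤y 0≤w))

  *-monoˡ-≤ : ∀ {x y} z → 0≤ z → x ≤ y → z * x ≤ z * y
  *-monoˡ-≤ {x} {y} z 0≤z x≤y =
    0≤-resp (solve 3 (λ x y z → z :* (y :- x) := z :* y :- z :* x) refl x y z) (0≤-* 0≤z x≤y)

  *-monoʳ-≤ : ∀ {x y} z → 0≤ z → x ≤ y → x * z ≤ y * z
  *-monoʳ-≤ {x} {y} z 0≤z x≤y =
    0≤-resp (solve 3 (λ x y z → (y :- x) :* z := y :* z :- x :* z) refl x y z) (0≤-* x≤y 0≤z)

  +-mono-≤ : ∀ {x y z w} → x ≤ y → z ≤ w → x + z ≤ y + w
  +-mono-≤ {x} {y} {z} {w} x≤y z≤w = 0≤-resp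
    (solve 4 (λ x y z w → (y :- x) :+ (w :- z) := (y :+ w) :- (x :+ z)) refl x y z w)
    (0≤-+ x≤y z≤w)

  0≤-cancel : ∀ {x y} → 0< x → 0≤ x * y → 0≤ y
  0≤-cancel {x} {y} 0<x 0≤xy = 0≤-stable λ 0<-y → 0<-irrefl (0<-* 0<x 0<-y)
    (0≤-resp (solve 2 (λ x y → x :* y := :- (x :* :- y)) refl x y) 0≤xy)

  *-pos⇒0≤ : ∀ {x y} → 0< x * y → 0≤ y → 0≤ x
  *-pos⇒0≤ {x} {y} 0<xy 0≤y = 0≤-stable λ 0<-x → 0<-irrefl 0<xy
    (0≤-resp (solve 2 (λ x y → (:- x) :* y := :- (x :* y)) refl x y) (0≤-* (0<⇒0≤ 0<-x) 0≤y))

  *-neg⇒0≤- : ∀ {x y} → 0< - (x * y) → 0≤ y → 0≤ - x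
  *-neg⇒0≤- {x} {y} 0<-xy =
    *-pos⇒0≤ (0<-resp (solve 2 (λ x y → :- (x :* y) := (:- x) :* y) refl x y) 0<-xy)

  fromℕ : ℕ → Carrier
  fromℕ n = fromℚ (ι n)

  0≤fromℕ : ∀ n → 0≤ fromℕ n
  0≤fromℕ n = fromℚ-0≤ (0≤ι n)
    where
    0≤ι : ∀ n → 0ℚ ℚ.≤ ι n
    0≤ι zero    = ℚ.≤-refl
    0≤ι (suc n) = ℚ.+-mono-≤ (ℚ.nonNegative⁻¹ 1ℚ) (0≤ι n)

  fromℕ-suc : ∀ n → fromℕ (suc n) ≈ 1# + fromℕ n
  fromℕ-suc n = trans (fromℚ-+ 1ℚ (ι n)) (+-congʳ fromℚ-1)

  -- The product is a sum of `n` copies of `x`, and `0<-split` finds a positive summand. This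
  -- replaces division by `n`.
  0<-fromℕ-* : ∀ n {x} → 0< fromℕ n * x → 0< x
  0<-fromℕ-* zero    {x} 0<nx = ⊥-elim (0≮0 (*-zeroˡ-≈ x fromℚ-0) 0<nx)
  0<-fromℕ-* (suc n) {x} 0<nx =
    [ (λ 0<x → 0<x) , 0<-fromℕ-* n ]′ (0<-split (0<-resp
      (trans (*-congʳ (fromℕ-suc n)) (trans (distribʳ x 1# (fromℕ n)) (+-congʳ (*-identityˡ x)))) 0<nx))

  -- Replacing `x` by a natural number above it keeps the product positive because `y` is
  -- nonnegative; a natural factor can then be removed.
  *-pos⇒0< : ∀ {x y} → 0< x * y → 0≤ y → 0< y
  *-pos⇒0< {x} {y} 0<xy 0≤y =
    let n , x≤n = archimedean x 0<1 in
    0<-fromℕ-* n (0<-resp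
      (solve 3 (λ x y n → x :* y :+ (n :- x) :* y := n :* y) refl x y (fromℕ n))
      (0<-+ 0<xy (0≤-* (0≤-resp (+-congʳ (*-identityʳ _)) x≤n) 0≤y)))

  -- No case split on the sign of `x` is available. A negative square would refute `x < 0`, hence
  -- give `0 ≤ x` by stability, and then the square is nonnegative after all.
  0≤-square : ∀ x → 0≤ x * x
  0≤-square x = 0≤-stable λ 0<-x² → 0<-irrefl 0<-x² (0≤-resp (sym (-‿involutive (x * x)))
    (let 0≤x = 0≤-stable λ 0<-x → 0<-irrefl (0<-* 0<-x 0<-x)
                 (0≤-resp (solve 1 (λ x → :- (x :* x) := :- ((:- x) :* (:- x))) refl x) (0<⇒0≤ 0<-x²))
     in 0≤-* 0≤x 0≤x))

  square-cancel-≤ : ∀ {x y} → 0≤ y → x * x ≤ y * y → x ≤ y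
  square-cancel-≤ {x} {y} 0≤y x²≤y² = ≤-stable λ y<x → <⇒≱ (0<-resp
    (solve 2 (λ x y → (x :- y) :* (x :- y) :+ ((x :- y) :* y :+ (x :- y) :* y) := x :* x :- y :* y) refl x y)
    (0<-+ (0<-* y<x y<x) (0≤-+ (0≤-* (0<⇒0≤ y<x) 0≤y) (0≤-* (0<⇒0≤ y<x) 0≤y)))) x²≤y²

  -- Powers and geometric growth.

  infixr 8 _^_

  _^_ : Carrier → ℕ → Carrier
  x ^ zero  = 1#
  x ^ suc n = x * x ^ n

  0≤-^ : ∀ {x} → 0≤ x → ∀ n → 0≤ x ^ n
  0≤-^ 0≤x zero    = 0<⇒0≤ 0<1
  0≤-^ 0≤x (suc n) = 0≤-* 0≤x (0≤-^ 0≤x n)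

  0<-^ : ∀ {x} → 0< x → ∀ n → 0< x ^ n
  0<-^ 0<x zero    = 0<1
  0<-^ 0<x (suc n) = 0<-* 0<x (0<-^ 0<x n)

  -- Bernoulli's inequality for `s / t` with the denominators cleared, so that `t` may be zero.
  bernoulli : ∀ {s t} → 0≤ t → t < s → ∀ n → t ^ n * (t + fromℕ (suc n) * (s - t)) ≤ s ^ suc n
  bernoulli {s} {t} 0≤t t<s zero = ≈⇒≤ (trans (*-identityˡ _) (trans
    (+-congˡ (trans (*-congʳ (trans (fromℕ-suc 0) (trans (+-congˡ fromℚ-0) (+-identityʳ 1#))))
      (*-identityˡ _)))
    (trans (solve 2 (λ s t → t :+ (s :- t) := s) refl s t) (sym (*-identityʳ s)))))
  bernoulli {s} {t} 0≤t t<s (suc n) = ≤-resp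
    (trans
      (+-congˡ (*-congˡ (sym (*-identityˡ (s - t)))))
      (trans
      (solve 5 (λ s t n P o → t :* (P :* (t :+ n :* (s :- t))) :+ P :* t :* (o :* (s :- t)) :=
                              t :* P :* (t :+ (o :+ n) :* (s :- t))) refl s t (fromℕ (suc n)) (t ^ n) 1#)
      (*-congˡ (+-congˡ (*-congʳ (sym (fromℕ-suc (suc n))))))))
    refl
    (≤-trans
      (0≤-resp (solve 4 (λ s t n P →
          P :* ((s :- t) :* (n :* (s :- t))) := 
          s :* (P :* (t :+ n :* (s :- t))) :- (t :* (P :* (t :+ n :* (s :- t))) :+ P :* t :* (s :- t)))
          refl s t (fromℕ (suc n)) (t ^ n))
        (0≤-* (0≤-^ 0≤t n) (0≤-* 0≤δ (0≤-* (0≤fromℕ (suc n)) 0≤δ))))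
      (*-monoˡ-≤ s 0≤s (bernoulli 0≤t t<s n)))
    where
    0≤δ = 0<⇒0≤ t<s
    0≤s = 0≤-≤ 0≤t 0≤δ

  -- By `bernoulli`, `s ^ suc k` exceeds `t ^ k` times a linear function of `k`; for `f` positive
  -- the Archimedean property makes that function times `f` overtake `t * D`.
  growth : ∀ {s t f D} → 0≤ t → t < s → 0≤ D → (∀ n → s ^ n * f ≤ t ^ n * D) → ¬ (0< f)
  growth {s} {t} {f} {D} 0≤t t<s 0≤D bound 0<f =
    let k , tD≤kδf = archimedean (t * D) (0<-* t<s 0<f)
        K = fromℕ (suc k)
        P = t ^ k in
    <⇒≱ {P * (t * D)} {P * (t * f + K * (δ * f))}
      (0<-resp (solve 4 (λ P x y z → P :* (x :+ (y :- z)) := P :* (x :+ y) :- P :* z) refl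
                  P (t * f) (K * (δ * f)) (t * D))
        (0<-* (0<-^ 0<t k) (0<-+ (0<-* 0<t 0<f) (≤-trans tD≤kδf (kδf≤ k)))))
      (≤-resp
        (solve 5 (λ P t f K δ → P :* (t :+ K :* δ) :* f := P :* (t :* f :+ K :* (δ :* f))) refl P t f K δ)
        (solve 3 (λ t D P → t :* P :* D := P :* (t :* D)) refl t D P)
        (≤-trans (*-monoʳ-≤ f (0<⇒0≤ 0<f) (bernoulli 0≤t t<s k)) (bound (suc k))))
    where
    δ = s - t
    0<s : 0< s
    0<s = 0<-resp (solve 2 (λ s t → s :- t :+ t := s) refl s t) (0<-+ t<s 0≤t)
    -- Cancelling `t ^ k` needs strict positivity, which the bound at exponent 1 supplies: `s * f`
    -- is positive and at most `t * D`.
    0<t : 0< t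
    0<t = *-pos⇒0< {D} {t} (0<-≤ (0<-* 0<s 0<f) (≤-resp
      (*-congʳ (*-identityʳ s)) (trans (*-congʳ (*-identityʳ t)) (*-comm t D)) (bound 1))) 0≤t
    kδf≤ : ∀ k → fromℕ k * (δ * f) ≤ fromℕ (suc k) * (δ * f)
    kδf≤ k = 0≤-resp
      (trans (sym (*-identityˡ (δ * f)))
      (trans (solve 3 (λ o k x → o :* x := (o :+ k) :* x :- k :* x) refl 1# (fromℕ k) (δ * f))
             (+-congʳ (*-congʳ (sym (fromℕ-suc k))))))
      (0<⇒0≤ (0<-* t<s 0<f))

  -- Each ratio is bounded by a natural number. These bounds are added up along the interval,
  -- because a maximum is not computable from an undecidable order.
  ratio-bound : ∀ (f g : ℕ → Carrier) i N → (∀ x → i ℕ.≤ x → x ℕ.≤ N → 0< g x) →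
                ∃[ K ] ((0≤ K) × (∀ x → i ℕ.≤ x → x ℕ.≤ N → f x ≤ K * g x))
  ratio-bound f g zero zero 0<g =
    let n , h = archimedean (f 0) (0<g 0 ℕ.z≤n ℕ.z≤n) in
    fromℕ n , 0≤fromℕ n , λ { zero _ _ → h }
  ratio-bound f g (suc i) zero 0<g = 0# , 0≤0 , λ { zero () _ ; (suc _) _ () }
  ratio-bound f g i (suc N) 0<g with i ℕ.≤? suc N
  ... | no  i≰ = 0# , 0≤0 , λ x i≤x x≤ → ⊥-elim (i≰ (ℕ.≤-trans i≤x x≤))
  ... | yes i≤ = K + fromℕ n , 0≤-+ 0≤K (0≤fromℕ n) , bound
    where
    IH = ratio-bound f g i N (λ x i≤x x≤N → 0<g x i≤x (ℕ.m≤n⇒m≤1+n x≤N))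
    K = proj₁ IH
    0≤K = proj₁ (proj₂ IH)
    top = archimedean (f (suc N)) (0<g (suc N) i≤ ℕ.≤-refl)
    n = proj₁ top
    bound : ∀ x → i ℕ.≤ x → x ℕ.≤ suc N → f x ≤ (K + fromℕ n) * g x
    bound x i≤x x≤ with ℕ.m≤n⇒m<n∨m≡n x≤
    ... | inj₁ x< = ≤-trans (proj₂ (proj₂ IH) x i≤x (ℕ.≤-pred x<))
      (0≤-resp (solve 3 (λ K n z → n :* z := (K :+ n) :* z :- K :* z) refl K (fromℕ n) (g x))
         (0≤-* (0≤fromℕ n) (0<⇒0≤ (0<g x i≤x x≤))))
    ... | inj₂ ≡.refl = ≤-trans (proj₂ top)
      (0≤-resp (solve 3 (λ K n z → K :* z := (K :+ n) :* z :- n :* z) refl K (fromℕ n) (g x))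
         (0≤-* 0≤K (0<⇒0≤ (0<g x i≤x x≤))))

  -- Largest roots of the characteristic polynomials

  -- Stands for |z| ≤ M; the ordered ring has no absolute value.
  record Bounded (M z : Carrier) : Set where
    constructor _,_
    field
      lower : 0≤ M + z
      upper : 0≤ M - z

  Bounded-weaken : ∀ {M N z} → M ≤ N → Bounded M z → Bounded N z
  Bounded-weaken {M} {N} {z} M≤N (lo , hi) =
    0≤-resp (solve 3 (λ M N z → N :- M :+ (M :+ z) := N :+ z) refl M N z) (0≤-+ M≤N lo) ,
    0≤-resp (solve 3 (λ M N z → N :- M :+ (M :- z) := N :- z) refl M N z) (0≤-+ M≤N hi)

  Bounded-self : ∀ {z} → 0≤ z → Bounded z z
  Bounded-self {z} 0≤z = 0≤-+ 0≤z 0≤z , 0≤-zero (-‿inverseʳ z)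

  Bounded-+ : ∀ {M N z w} → Bounded M z → Bounded N w → Bounded (M + N) (z + w)
  Bounded-+ {M} {N} {z} {w} (lo , hi) (lo′ , hi′) =
    0≤-resp (solve 4 (λ M N z w → M :+ z :+ (N :+ w) := M :+ N :+ (z :+ w)) refl M N z w) (0≤-+ lo lo′) ,
    0≤-resp (solve 4 (λ M N z w → M :- z :+ (N :- w) := M :+ N :- (z :+ w)) refl M N z w) (0≤-+ hi hi′)

  Bounded-neg : ∀ {M z} → Bounded M z → Bounded M (- z)
  Bounded-neg {M} {z} (lo , hi) =
    hi , 0≤-resp (solve 2 (λ M z → M :+ z := M :- (:- z)) refl M z) lo

  Bounded-* : ∀ {B M x z} → 0≤ x → x ≤ B → 0≤ M → Bounded M z → Bounded (B * M) (x * z)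
  Bounded-* {B} {M} {x} {z} 0≤x x≤B 0≤M (lo , hi) =
    0≤-resp (solve 4 (λ B M x z → (B :- x) :* M :+ x :* (M :+ z) := B :* M :+ x :* z) refl B M x z)
      (0≤-+ (0≤-* x≤B 0≤M) (0≤-* 0≤x lo)) ,
    0≤-resp (solve 4 (λ B M x z → (B :- x) :* M :+ x :* (M :- z) := B :* M :- x :* z) refl B M x z)
      (0≤-+ (0≤-* x≤B 0≤M) (0≤-* 0≤x hi))

  infinitesimal⇒0≤ : ∀ {x} M → (∀ n → fromℕ n * x ≤ M) → 0≤ - x
  infinitesimal⇒0≤ {x} M bound = 0≤-stable λ 0<--x →
    let 0<x = 0<-resp (-‿involutive x) 0<--x
        n , h = archimedean (M + 1#) 0<x
    in 0<-irrefl 0<1 (0≤-resp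
         (solve 3 (λ M o z → (z :- (M :+ o)) :+ (M :- z) := :- o) refl M 1# (fromℕ n * x))
         (0≤-+ h (bound n)))

  ≤-+ʳ : ∀ {x y} → 0≤ y → x ≤ x + y
  ≤-+ʳ {x} {y} = 0≤-resp (solve 2 (λ x y → y := x :+ y :- x) refl x y)

  scaled-≤ : ∀ {n d e M g} → 0≤ n → 0≤ M → d ≤ e → n * e ≤ 1# → g ≤ d * M → n * g ≤ M
  scaled-≤ {n} {d} {e} {M} {g} 0≤n 0≤M d≤e ne≤1 g≤dM = ≤-trans
    (*-monoˡ-≤ n 0≤n (≤-trans g≤dM (*-monoʳ-≤ M 0≤M d≤e)))
    (≤-resp (*-assoc n e M) (*-identityˡ M) (*-monoʳ-≤ M 0≤M ne≤1))

  +-monoˡ-≤ : ∀ z {x y} → x ≤ y → z + x ≤ z + y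
  +-monoˡ-≤ z x≤y = +-mono-≤ ≤-refl x≤y

  shift-diff : ∀ L x y → (L + y) - (L + x) ≈ y - x
  shift-diff = solve 3 (λ L x y → (L :+ y) :- (L :+ x) := y :- x) refl

  fromℚ-diff : ∀ p q → fromℚ (q ℚ.- p) ≈ fromℚ q - fromℚ p
  fromℚ-diff p q = trans (fromℚ-+ q (ℚ.- p)) (+-congˡ (fromℚ-- p))

  fromℚ-mono-≤ : ∀ {p q} → p ℚ.≤ q → fromℚ p ≤ fromℚ q
  fromℚ-mono-≤ {p} {q} p≤q = 0≤-resp (fromℚ-diff p q)
    (fromℚ-0≤ (≡.subst (ℚ._≤ q ℚ.- p) (ℚ.+-inverseʳ p) (ℚ.+-monoˡ-≤ (ℚ.- p) p≤q)))

  fromℚ-mono-< : ∀ {p q} → p ℚ.< q → fromℚ p < fromℚ q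
  fromℚ-mono-< {p} {q} p<q = 0<-resp (fromℚ-diff p q)
    (fromℚ-0< (≡.subst (ℚ._< q ℚ.- p) (ℚ.+-inverseʳ p) (ℚ.+-monoˡ-< (ℚ.- p) p<q)))

  module Path (a : ℕ → Carrier) where

    b : ℕ → Carrier
    b k = a (suc k) * a (suc k)

    -- Characteristic polynomial of the path on k vertices whose edges have
    -- weights a 1 , … , a (k - 1).
    φ : ℕ → Carrier → Carrier
    φ zero          x = 1#
    φ (suc zero)    x = x
    φ (suc (suc k)) x = x * φ (suc k) x - b k * φ k x

    φ-cong : ∀ k {x y} → x ≈ y → φ k x ≈ φ k y
    φ-cong zero          x≈y = refl
    φ-cong (suc zero)    x≈y = x≈y
    φ-cong (suc (suc k)) x≈y =
      +-cong (*-cong x≈y (φ-cong (suc k) x≈y)) (-‿cong (*-congˡ (φ-cong k x≈y)))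

    -- Divided difference of φ k at x and y.
    Δ : ℕ → Carrier → Carrier → Carrier
    Δ zero          x y = 0#
    Δ (suc zero)    x y = 1#
    Δ (suc (suc k)) x y = φ (suc k) y + x * Δ (suc k) x y - b k * Δ k x y

    -- Together with `Δ-bounded` this is a Lipschitz estimate for `φ k` on bounded intervals,
    -- obtained without derivatives.
    φ-Δ : ∀ k x y → φ k y - φ k x ≈ (y - x) * Δ k x y
    φ-Δ zero          x y = trans (-‿inverseʳ 1#) (sym (zeroʳ (y - x)))
    φ-Δ (suc zero)    x y = sym (*-identityʳ (y - x))
    φ-Δ (suc (suc k)) x y = trans
      (solve 7 (λ x y b p₁ q₁ p q → (y :* q₁ :- b :* q) :- (x :* p₁ :- b :* p) :=
                                    (y :- x) :* q₁ :+ x :* (q₁ :- p₁) :- b :* (q :- p)) refl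
         x y (b k) (φ (suc k) x) (φ (suc k) y) (φ k x) (φ k y))
      (trans (+-cong (+-congˡ (*-congˡ (φ-Δ (suc k) x y))) (-‿cong (*-congˡ (φ-Δ k x y))))
        (solve 6 (λ x y b q₁ d₁ d → (y :- x) :* q₁ :+ x :* ((y :- x) :* d₁) :- b :* ((y :- x) :* d) :=
                                    (y :- x) :* (q₁ :+ x :* d₁ :- b :* d)) refl
           x y (b k) (φ (suc k) y) (Δ (suc k) x y) (Δ k x y)))

    -- The Christoffel-Darboux numerator: unrolling its recursion gives `y - x` times a sum of the
    -- products `φ j x * φ j y`, weighted by products of the `b`.
    wronskian : ℕ → Carrier → Carrier → Carrier
    wronskian k x y = φ (suc k) y * φ k x - φ (suc k) x * φ k y

    wronskian-zero : ∀ x y → wronskian 0 x y ≈ y - x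
    wronskian-zero x y = +-cong (*-identityʳ y) (-‿cong (*-identityʳ x))

    wronskian-suc : ∀ k x y →
      wronskian (suc k) x y ≈ (y - x) * (φ (suc k) x * φ (suc k) y) + b k * wronskian k x y
    wronskian-suc k x y =
      solve 7 (λ x y b p₁ q₁ p q → (y :* q₁ :- b :* q) :* p₁ :- (x :* p₁ :- b :* p) :* q₁ :=
                                   (y :- x) :* (p₁ :* q₁) :+ b :* (q₁ :* p :- p₁ :* q)) refl
         x y (b k) (φ (suc k) x) (φ (suc k) y) (φ k x) (φ k y)

    0≤b : ∀ k → 0≤ b k
    0≤b k = 0≤-square (a (suc k))

    φ-bounded : ∀ B → 0≤ B → ∀ k → ∃[ M ] ((0≤ M) × (∀ x → 0≤ x → x ≤ B → Bounded M (φ k x)))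
    φ-bounded B 0≤B zero       = 1# , 0<⇒0≤ 0<1 , λ x _ _ → Bounded-self (0<⇒0≤ 0<1)
    φ-bounded B 0≤B (suc zero) = B , 0≤B , λ x 0≤x x≤B → Bounded-weaken x≤B (Bounded-self 0≤x)
    φ-bounded B 0≤B (suc (suc k)) with φ-bounded B 0≤B (suc k) | φ-bounded B 0≤B k
    ... | M , 0≤M , bM | N , 0≤N , bN =
      B * M + b k * N , 0≤-+ (0≤-* 0≤B 0≤M) (0≤-* (0≤b k) 0≤N) , λ x 0≤x x≤B →
        Bounded-+ (Bounded-* 0≤x x≤B 0≤M (bM x 0≤x x≤B))
                  (Bounded-neg (Bounded-* (0≤b k) ≤-refl 0≤N (bN x 0≤x x≤B)))

    Δ-bounded : ∀ B → 0≤ B → ∀ k →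
      ∃[ M ] ((0≤ M) × (∀ x y → 0≤ x → x ≤ B → 0≤ y → y ≤ B → Bounded M (Δ k x y)))
    Δ-bounded B 0≤B zero       = 0# , 0≤0 , λ _ _ _ _ _ _ → Bounded-self 0≤0
    Δ-bounded B 0≤B (suc zero) = 1# , 0<⇒0≤ 0<1 , λ _ _ _ _ _ _ → Bounded-self (0<⇒0≤ 0<1)
    Δ-bounded B 0≤B (suc (suc k))
      with φ-bounded B 0≤B (suc k) | Δ-bounded B 0≤B (suc k) | Δ-bounded B 0≤B k
    ... | M , 0≤M , bM | N , 0≤N , bN | P , 0≤P , bP =
      M + B * N + b k * P , 0≤-+ (0≤-+ 0≤M (0≤-* 0≤B 0≤N)) (0≤-* (0≤b k) 0≤P) ,
      λ x y 0≤x x≤B 0≤y y≤B → Bounded-+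
        (Bounded-+ (bM y 0≤y y≤B) (Bounded-* 0≤x x≤B 0≤N (bN x y 0≤x x≤B 0≤y y≤B)))
        (Bounded-neg (Bounded-* (0≤b k) ≤-refl 0≤P (bP x y 0≤x x≤B 0≤y y≤B)))

    -- Positivity of all lower polynomials certifies that the root is the largest one, and it is
    -- also what makes the eigenvector entries positive. `m` counts edges, so the path has `suc m`
    -- vertices.
    record IsTopRoot (m : ℕ) (L : Carrier) : Set where
      field
        0≤root : 0≤ L
        0<φ    : ∀ k → k ℕ.≤ m → 0< φ k L
        root   : φ (suc m) L ≈ 0#

      0≤φ : ∀ k → k ℕ.≤ suc m → 0≤ φ k L
      0≤φ k k≤ with ℕ.m≤n⇒m<n∨m≡n k≤
      ... | inj₁ k<     = 0<⇒0≤ (0<φ k (ℕ.≤-pred k<))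
      ... | inj₂ ≡.refl = 0≤-zero root

    -- The Wronskian at `L` and `x` is carried through the induction: adding
    -- `φ (suc (suc k)) L * φ (suc k) x` to it leaves `φ (suc k) L * φ (suc (suc k)) x`, whose first
    -- factor is positive and cancels.
    φ-nonneg-beyond : ∀ {m L} → IsTopRoot m L → ∀ {x} → L ≤ x → ∀ k → k ℕ.≤ m →
                      (0≤ φ k x) × (0≤ φ (suc k) x) × (0≤ wronskian k L x)
    φ-nonneg-beyond top L≤x zero _ =
      0<⇒0≤ 0<1 , 0≤-≤ (IsTopRoot.0≤root top) L≤x , 0≤-resp (sym (wronskian-zero _ _)) L≤x
    φ-nonneg-beyond {m} {L} top {x} L≤x (suc k) k<m
      with φ-nonneg-beyond top L≤x k (ℕ.<⇒≤ k<m)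
    ... | _ , 0≤φx , 0≤w = 0≤φx ,
          0≤-cancel (0<φ (suc k) k<m) (0≤-resp
            (solve 4 (λ p₂ p₁ q₂ q₁ → q₂ :* p₁ :- p₂ :* q₁ :+ p₂ :* q₁ := p₁ :* q₂) refl
               (φ (suc (suc k)) L) (φ (suc k) L) (φ (suc (suc k)) x) (φ (suc k) x))
            (0≤-+ 0≤w′ (0≤-* (0≤φ (suc (suc k)) (ℕ.s≤s k<m)) 0≤φx))) ,
          0≤w′
      where
      open IsTopRoot top
      0≤w′ : 0≤ wronskian (suc k) L x
      0≤w′ = 0≤-resp (sym (wronskian-suc k L x))
        (0≤-+ (0≤-* L≤x (0≤-* (0<⇒0≤ (0<φ (suc k) k<m)) 0≤φx)) (0≤-* (0≤b k) 0≤w))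

    φ-nonneg-beyond′ : ∀ {m L} → IsTopRoot m L → ∀ {x} → L ≤ x → ∀ k → k ℕ.≤ suc m → 0≤ φ k x
    φ-nonneg-beyond′ top L≤x zero    _         = 0<⇒0≤ 0<1
    φ-nonneg-beyond′ top L≤x (suc k) (ℕ.s≤s k≤m) = proj₁ (proj₂ (φ-nonneg-beyond top L≤x k k≤m))

    -- The term with `φ` products is only known to be nonnegative; strictness starts at `y - x` and
    -- is carried upward by the positive factors `b k`.
    0<wronskian : ∀ {m L} → IsTopRoot m L → (∀ k → k ℕ.≤ m → 0< b k) →
                  ∀ {x y} → L ≤ x → x < y → ∀ k → k ℕ.≤ suc m → 0< wronskian k x y
    0<wronskian top 0<b L≤x x<y zero    _  = 0<-resp (sym (wronskian-zero _ _)) x<y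
    0<wronskian top 0<b {x} {y} L≤x x<y (suc k) k< = 0<-resp
      (trans (+-comm _ _) (sym (wronskian-suc k x y)))
      (0<-+ (0<-* (0<b k (ℕ.≤-pred k<)) (0<wronskian top 0<b L≤x x<y k (ℕ.<⇒≤ k<)))
            (0≤-* (0<⇒0≤ x<y) (0≤-* (φ-nonneg-beyond′ top L≤x (suc k) k<)
              (φ-nonneg-beyond′ top (≤-trans L≤x (0<⇒0≤ x<y)) (suc k) k<))))

    -- The Wronskian is a positive sum of two terms, so one of them is positive. Its cofactor
    -- `φ (suc m)` is nonnegative beyond `L`, which determines the sign of the other factor.
    sign-change : ∀ {m L} → IsTopRoot m L → (∀ k → k ℕ.≤ m → 0< b k) →
                  ∀ {x y} → L ≤ x → x < y → 0≤ - φ (suc (suc m)) x ⊎ 0≤ φ (suc (suc m)) y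
    sign-change {m} top 0<b {x} {y} L≤x x<y =
      [ (λ 0<φφ → inj₂ (*-pos⇒0≤ {φ (suc (suc m)) y} 0<φφ (φ-nonneg-beyond′ top L≤x (suc m) ℕ.≤-refl)))
      , (λ 0<φφ → inj₁ (*-neg⇒0≤- {φ (suc (suc m)) x} 0<φφ
          (φ-nonneg-beyond′ top (≤-trans L≤x (0<⇒0≤ x<y)) (suc m) ℕ.≤-refl)))
      ]′ (0<-split (0<wronskian top 0<b L≤x x<y (suc m) ℕ.≤-refl))

    -- The increment from `suc k` to `suc (suc k)` is `(B - b k - 1) * φ (suc k) B` plus `b k` times
    -- the previous increment. This gives a right end for the bisection.
    φ-increasing : ∀ {B} m → 1# ≤ B → (∀ k → k ℕ.≤ m → b k + 1# ≤ B) →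
                   ∀ k → k ℕ.≤ suc m → (0≤ φ k B) × (φ k B ≤ φ (suc k) B)
    φ-increasing m 1≤B b≤B zero _ = 0<⇒0≤ 0<1 , 1≤B
    φ-increasing {B} m 1≤B b≤B (suc k) k<
      with φ-increasing m 1≤B b≤B k (ℕ.<⇒≤ k<)
    ... | 0≤φ , φ≤φ = 0≤-≤ 0≤φ φ≤φ , 0≤-resp
      (trans (solve 5 (λ B b o p₁ p → (B :- (b :+ o)) :* p₁ :+ b :* (p₁ :- p) :=
                                      B :* p₁ :- b :* p :- o :* p₁) refl
                B (b k) 1# (φ (suc k) B) (φ k B))
             (+-congˡ (-‿cong (*-identityˡ _))))
      (0≤-+ (0≤-* (b≤B k (ℕ.≤-pred k<)) (0≤-≤ 0≤φ φ≤φ)) (0≤-* (0≤b k) φ≤φ))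

    -- Weak signs at `L′` become strict from below: `L′ * φ (suc k) L′` equals `b k * φ k L′`,
    -- already positive, plus the nonnegative `φ (suc (suc k)) L′`.
    topRoot-next : ∀ {m L} → IsTopRoot m L → (∀ k → k ℕ.≤ m → 0< b k) →
                   ∀ {L′} → L ≤ L′ → φ (suc (suc m)) L′ ≈ 0# → IsTopRoot (suc m) L′
    topRoot-next {m} {L} top 0<b {L′} L≤L′ φ≈0 = record
      { 0≤root = 0≤L′ ; 0<φ = 0<φ′ ; root = φ≈0 }
      where
      0≤L′ = 0≤-≤ (IsTopRoot.0≤root top) L≤L′

      0≤φ′ : ∀ k → k ℕ.≤ suc (suc m) → 0≤ φ k L′
      0≤φ′ k k≤ with ℕ.m≤n⇒m<n∨m≡n k≤
      ... | inj₁ k<     = φ-nonneg-beyond′ top L≤L′ k (ℕ.≤-pred k<)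
      ... | inj₂ ≡.refl = 0≤-zero φ≈0

      0<φ′ : ∀ k → k ℕ.≤ suc m → 0< φ k L′
      0<φ′ zero    _  = 0<1
      0<φ′ (suc k) k< = *-pos⇒0< (0<-resp
        (solve 4 (λ x p b q → b :* q :+ (x :* p :- b :* q) := x :* p) refl
          L′ (φ (suc k) L′) (b k) (φ k L′))
        (0<-+ (0<-* (0<b k (ℕ.≤-pred k<)) (0<φ′ k (ℕ.<⇒≤ k<))) (0≤φ′ (suc (suc k)) (ℕ.s≤s k<))))
        (0≤φ′ (suc k) (ℕ.m≤n⇒m≤1+n k<))

    φ-upper-end : ∀ {m L} → 0≤ L → ∃[ N ] 0≤ φ (suc (suc m)) (L + fromℕ N)
    φ-upper-end {m} {L} 0≤L =
      let K , 0≤K , b≤K = ratio-bound b (λ _ → 1#) 0 m (λ _ _ _ → 0<1)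
          N , K+1≤N     = archimedean (K + 1#) 0<1
          K+1≤L+N       = ≤-trans (≤-resp refl (*-identityʳ (fromℕ N)) K+1≤N)
                            (0≤-resp (solve 2 (λ L n → L := L :+ n :- n) refl L (fromℕ N)) 0≤L)
          1≤L+N         = ≤-trans (0≤-resp (solve 2 (λ K o → K := K :+ o :- o) refl K 1#) 0≤K) K+1≤L+N
          0≤φ , φ≤φ     = φ-increasing m 1≤L+N
                            (λ k k≤m → ≤-trans (+-mono-≤ (≤-resp refl (*-identityʳ K) (b≤K k ℕ.z≤n k≤m)) ≤-refl) K+1≤L+N)
                            (suc m) ℕ.≤-refl
      in N , 0≤-≤ 0≤φ φ≤φ

    -- At the previous root the recursion loses its first term and leaves `- (b m * φ m L)`.
    φ-lower-end : ∀ {m L} → IsTopRoot m L → 0≤ - φ (suc (suc m)) L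
    φ-lower-end {m} {L} top = 0≤-resp
      (solve 3 (λ x p y → y :- x :* p := :- (x :* p :- y)) refl L (φ (suc m) L) (b m * φ m L))
      (0≤-resp (sym (x-0≈x (*-zeroʳ-≈ L root))) (0≤-* (0≤b m) (0<⇒0≤ (0<φ m ℕ.≤-refl))))
      where open IsTopRoot top

    φ-upper : ∀ k {x y M} → x ≤ y → Δ k x y ≤ M → 0≤ - φ k x → φ k y ≤ (y - x) * M
    φ-upper k {x} {y} {M} x≤y Δ≤M 0≤-φx = ≤-trans
      (0≤-resp (solve 2 (λ p q → :- p := (q :- p) :- q) refl (φ k x) (φ k y)) 0≤-φx)
      (≤-resp (sym (φ-Δ k x y)) refl (*-monoˡ-≤ (y - x) x≤y Δ≤M))

    φ-lower : ∀ k {x y M} → x ≤ y → Δ k x y ≤ M → 0≤ φ k y → - φ k x ≤ (y - x) * M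
    φ-lower k {x} {y} {M} x≤y Δ≤M 0≤φy = ≤-trans
      (0≤-resp (solve 2 (λ p q → q := (q :- p) :- (:- p)) refl (φ k x) (φ k y)) 0≤φy)
      (≤-resp (sym (φ-Δ k x y)) refl (*-monoˡ-≤ (y - x) x≤y Δ≤M))

    -- The bracket number `n` has width at most 1/n, so the Lipschitz constant `M` bounds both
    -- `n * φ` and `n * - φ` at the limit; being true for all `n`, this forces the value zero.
    φ-limit-root : ∀ j L N r → 0≤ L → 0≤ r → r ≤ fromℕ N →
      (∀ n → ∃[ x ] ∃[ y ] ((0≤ - φ j (L + fromℚ x)) × (0≤ φ j (L + fromℚ y)) ×
         0ℚ ℚ.≤ x × y ℚ.≤ ι N × (fromℚ x ≤ r) × (r ≤ fromℚ y) × ι n ℚ.* (y ℚ.- x) ℚ.≤ 1ℚ)) →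
      φ j (L + r) ≈ 0#
    φ-limit-root j L N r 0≤L 0≤r r≤N bracket =
      0≤-antisym (0≤-resp (-‿involutive _) (infinitesimal⇒0≤ M (λ n → proj₂ (bounds n))))
                 (infinitesimal⇒0≤ M (λ n → proj₁ (bounds n)))
      where
      B = L + fromℕ N
      Δ-bound = Δ-bounded B (0≤-+ 0≤L (0≤fromℕ N)) j
      M = proj₁ Δ-bound
      0≤M = proj₁ (proj₂ Δ-bound)

      Δ≤M : ∀ x y → 0≤ x → x ≤ fromℕ N → 0≤ y → y ≤ fromℕ N → Δ j (L + x) (L + y) ≤ M
      Δ≤M x y 0≤x x≤N 0≤y y≤N = Bounded.upper (proj₂ (proj₂ Δ-bound) (L + x) (L + y)
        (0≤-+ 0≤L 0≤x) (+-monoˡ-≤ L x≤N) (0≤-+ 0≤L 0≤y) (+-monoˡ-≤ L y≤N))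

      bounds : ∀ n → (fromℕ n * φ j (L + r) ≤ M) × (fromℕ n * - φ j (L + r) ≤ M)
      bounds n with bracket n
      ... | x , y , 0≤-φx , 0≤φy , 0≤x , y≤N , x≤r , r≤y , n[y-x]≤1 =
        scaled-≤ (0≤fromℕ n) 0≤M (0≤-resp (upper-gap L X Y r) r≤y) nd≤1
          (φ-upper j (+-monoˡ-≤ L x≤r) (Δ≤M X r 0≤X (≤-trans x≤r r≤N) 0≤r r≤N) 0≤-φx) ,
        scaled-≤ (0≤fromℕ n) 0≤M (0≤-resp (lower-gap L X Y r) x≤r) nd≤1
          (φ-lower j (+-monoˡ-≤ L r≤y) (Δ≤M r Y 0≤r r≤N (0≤-≤ 0≤r r≤y) (fromℚ-mono-≤ y≤N)) 0≤φy)
        where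
        X = fromℚ x
        Y = fromℚ y
        0≤X : 0≤ X
        0≤X = fromℚ-0≤ 0≤x
        upper-gap : ∀ L X Y r → Y - r ≈ (Y - X) - ((L + r) - (L + X))
        upper-gap = solve 4 (λ L X Y r → Y :- r := (Y :- X) :- ((L :+ r) :- (L :+ X))) refl
        lower-gap : ∀ L X Y r → r - X ≈ (Y - X) - ((L + Y) - (L + r))
        lower-gap = solve 4 (λ L X Y r → r :- X := (Y :- X) :- ((L :+ Y) :- (L :+ r))) refl
        nd≤1 : fromℕ n * (Y - X) ≤ 1#
        nd≤1 = ≤-resp (trans (fromℚ-* (ι n) (y ℚ.- x)) (*-congˡ (fromℚ-diff x y))) fromℚ-1
                 (fromℚ-mono-≤ n[y-x]≤1)

    topRoot-step : ∀ {m L} → IsTopRoot m L → (∀ k → k ℕ.≤ m → 0< b k) → ∃[ L′ ] IsTopRoot (suc m) L′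
    topRoot-step {m} {L} top 0<b =
      let N , 0≤φ[L+N] = φ-upper-end {m} 0≤root
          -- Bisection probes rationals only while `L` is real, so it runs over offsets from `L`.
          -- Nonnegative offsets also keep every probed point beyond `L`, as `sign-change` requires.
          r , 0≤r , r≤N , bracket =
            bisection (λ q → 0≤ - φ (suc (suc m)) (L + fromℚ q)) (λ q → 0≤ φ (suc (suc m)) (L + fromℚ q)) N
              (φ-lower-end-0 (L + fromℚ 0ℚ) (trans (+-congˡ fromℚ-0) (+-identityʳ L))) 0≤φ[L+N]
              (λ x y 0≤x x<y _ → sign-change top 0<b (≤-+ʳ (fromℚ-0≤ 0≤x))
                (0<-resp (sym (shift-diff L (fromℚ x) (fromℚ y))) (fromℚ-mono-< x<y)))
      in L + r , topRoot-next top 0<b (≤-+ʳ 0≤r)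
                   (φ-limit-root (suc (suc m)) L N r 0≤root 0≤r r≤N bracket)
      where
      open IsTopRoot top
      φ-lower-end-0 : ∀ x → x ≈ L → 0≤ - φ (suc (suc m)) x
      φ-lower-end-0 x x≈L = 0≤-resp (-‿cong (φ-cong (suc (suc m)) (sym x≈L))) (φ-lower-end top)

    topRoot : ∀ m → (∀ k → k ℕ.< m → 0< b k) → ∃[ L ] IsTopRoot m L
    topRoot zero    _   = 0# , record
      { 0≤root = 0≤0 ; 0<φ = λ { zero _ → 0<1 ; (suc _) () } ; root = refl }
    topRoot (suc m) 0<b =
      topRoot-step (proj₂ (topRoot m (λ k k<m → 0<b k (ℕ.m≤n⇒m≤1+n k<m)))) (λ k k≤m → 0<b k (ℕ.s≤s k≤m))

  -- Perron vectors

  shiftBy : ℕ → (ℕ → Carrier) → ℕ → Carrier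
  shiftBy zero    f x       = f x
  shiftBy (suc i) f zero    = 0#
  shiftBy (suc i) f (suc x) = shiftBy i f x

  shiftBy-+ : ∀ i f k → shiftBy i f (i ℕ.+ k) ≡ f k
  shiftBy-+ zero    f k = ≡.refl
  shiftBy-+ (suc i) f k = shiftBy-+ i f k

  shiftBy-< : ∀ i f {x} → x ℕ.< i → shiftBy i f x ≡ 0#
  shiftBy-< (suc i) f {zero}  _           = ≡.refl
  shiftBy-< (suc i) f {suc x} (ℕ.s≤s x<i) = shiftBy-< i f x<i

  shiftBy-all : ∀ (P : Carrier → Set) i f → P 0# → (∀ k → P (f k)) → ∀ x → P (shiftBy i f x)
  shiftBy-all P zero    f P0 Pf x       = Pf x
  shiftBy-all P (suc i) f P0 Pf zero    = P0
  shiftBy-all P (suc i) f P0 Pf (suc x) = shiftBy-all P i f P0 Pf x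

  -- Extension by zero gives the end rows the same two-neighbour form as the inner ones, and stating
  -- the equation at `suc x` avoids predecessors. It is claimed inside the interval only.
  record IsPerronVector (a : ℕ → Carrier) (i j : ℕ) (L : Carrier) (w : ℕ → Carrier) : Set where
    field
      0≤root      : 0≤ L
      nonNegative : ∀ x → 0≤ w x
      positive    : ∀ x → i ℕ.≤ x → x ℕ.≤ j → 0< w x
      below       : ∀ x → x ℕ.< i → w x ≈ 0#
      above       : ∀ x → j ℕ.< x → w x ≈ 0#
      eigen       : ∀ x → i ℕ.≤ suc x → suc x ℕ.≤ j →
                    L * w (suc x) ≈ a x * w x + a (suc x) * w (suc (suc x))

  module _ (a : ℕ → Carrier) (m : ℕ) (L : Carrier) where
    open Path a

    edgeProduct : ℕ → ℕ → Carrier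
    edgeProduct k zero    = 1#
    edgeProduct k (suc r) = a (suc k) * edgeProduct (suc k) r

    -- The factor edgeProduct turns the recursion of the monic polynomials φ into
    -- the eigenvector equation of the symmetric matrix without dividing by a.
    rootVector : ℕ → Carrier
    rootVector zero    = 0#
    rootVector (suc k) with k ℕ.≤? m
    ... | yes _ = φ k L * edgeProduct k (m ℕ.∸ k)
    ... | no  _ = 0#

    rootVector-≤ : ∀ k → k ℕ.≤ m → rootVector (suc k) ≡ φ k L * edgeProduct k (m ℕ.∸ k)
    rootVector-≤ k k≤m with k ℕ.≤? m
    ... | yes _   = ≡.refl
    ... | no  k≰m = ⊥-elim (k≰m k≤m)

    rootVector-> : ∀ k → m ℕ.< k → rootVector (suc k) ≡ 0#
    rootVector-> k m<k with k ℕ.≤? m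
    ... | yes k≤m = ⊥-elim (ℕ.<⇒≱ m<k k≤m)
    ... | no  _   = ≡.refl

    edgeProduct-∸ : ∀ k → k ℕ.< m → edgeProduct k (m ℕ.∸ k) ≡ a (suc k) * edgeProduct (suc k) (m ℕ.∸ suc k)
    edgeProduct-∸ k k<m = ≡.cong (edgeProduct k) (ℕ.+-∸-assoc 1 k<m)

    module _ (0<a : ∀ k → k ℕ.< m → 0< a (suc k)) (top : IsTopRoot m L) where
      open IsTopRoot top

      0<edgeProduct : ∀ k r → k ℕ.+ r ℕ.≤ m → 0< edgeProduct k r
      0<edgeProduct k zero    _ = 0<1
      0<edgeProduct k (suc r) h =
        let h′ = ≡.subst (ℕ._≤ m) (ℕ.+-suc k r) h in
        0<-* (0<a k (ℕ.≤-trans (ℕ.s≤s (ℕ.m≤m+n k r)) h′)) (0<edgeProduct (suc k) r h′)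

      0<rootVector : ∀ k → k ℕ.≤ m → 0< rootVector (suc k)
      0<rootVector k k≤m = ≡.subst 0<_ (≡.sym (rootVector-≤ k k≤m))
        (0<-* (0<φ k k≤m) (0<edgeProduct k (m ℕ.∸ k) (ℕ.≤-reflexive (ℕ.m+[n∸m]≡n k≤m))))

      0≤rootVector : ∀ k → 0≤ rootVector k
      0≤rootVector zero    = 0≤0
      0≤rootVector (suc k) with k ℕ.≤? m
      ... | yes k≤m = 0<⇒0≤ (≡.subst 0<_ (rootVector-≤ k k≤m) (0<rootVector k k≤m))
      ... | no  _   = 0≤0

      rootVector-next : ∀ k → k ℕ.≤ m →
        a (suc k) * rootVector (suc (suc k)) ≈ φ (suc k) L * edgeProduct k (m ℕ.∸ k)
      rootVector-next k k≤m with ℕ.m≤n⇒m<n∨m≡n k≤m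
      ... | inj₁ k<m = trans (*-congˡ (reflexive (rootVector-≤ (suc k) k<m)))
        (trans (solve 3 (λ x p t → x :* (p :* t) := p :* (x :* t)) refl
                  (a (suc k)) (φ (suc k) L) (edgeProduct (suc k) (m ℕ.∸ suc k)))
               (*-congˡ (reflexive (≡.sym (edgeProduct-∸ k k<m)))))
      -- At the last vertex both sides vanish, the left because the neighbour lies outside the path,
      -- the right because `L` is a root.
      ... | inj₂ ≡.refl = trans (*-zeroʳ-≈ _ (reflexive (rootVector-> (suc m) (ℕ.n<1+n m))))
        (sym (*-zeroˡ-≈ _ root))

      rootVector-eigen : ∀ k → k ℕ.≤ m →
        L * rootVector (suc k) ≈ a k * rootVector k + a (suc k) * rootVector (suc (suc k))
      rootVector-eigen zero _ = trans (*-congˡ (reflexive (rootVector-≤ 0 ℕ.z≤n)))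
        (trans (trans (*-congˡ (*-identityˡ _)) (sym (rootVector-next 0 ℕ.z≤n)))
          (sym (trans (+-congʳ (zeroʳ (a 0))) (+-identityˡ _))))
      rootVector-eigen (suc k) k<m = trans (*-congˡ (reflexive (rootVector-≤ (suc k) k<m)))
        (trans (solve 5 (λ L x p q t → L :* (p :* t) :=
                         x :* (q :* (x :* t)) :+ (L :* p :- x :* x :* q) :* t) refl
                  L (a (suc k)) (φ (suc k) L) (φ k L) (edgeProduct (suc k) (m ℕ.∸ suc k)))
          (+-cong
            (*-congˡ (trans (*-congˡ (reflexive (≡.sym (edgeProduct-∸ k k<m))))
                            (reflexive (≡.sym (rootVector-≤ k (ℕ.<⇒≤ k<m))))))
            (sym (rootVector-next (suc k) k<m))))

  perronVector : ∀ (a : ℕ → Carrier) i m →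
    (∀ x → suc i ℕ.≤ x → x ℕ.< suc i ℕ.+ m → 0< a x) →
    ∃[ L ] ∃[ w ] IsPerronVector a (suc i) (suc i ℕ.+ m) L w
  perronVector a i m 0<a = L , w , record
    { 0≤root      = IsTopRoot.0≤root top
    ; nonNegative = shiftBy-all 0≤_ i v 0≤0 (0≤rootVector a′ m L 0<a′ top)
    ; positive    = λ x i<x x≤ → positive x i<x x≤
    ; below       = below
    ; above       = above
    ; eigen       = eigen
    }
    where
    a′ : ℕ → Carrier
    a′ k = a (i ℕ.+ k)
    open Path a′ using (IsTopRoot; topRoot; b)

    0<a′ : ∀ k → k ℕ.< m → 0< a′ (suc k)
    0<a′ k k<m = 0<a (i ℕ.+ suc k)
      (≡.subst (suc i ℕ.≤_) (≡.sym (ℕ.+-suc i k)) (ℕ.s≤s (ℕ.m≤m+n i k)))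
      (≡.subst (ℕ._< suc (i ℕ.+ m)) (≡.sym (ℕ.+-suc i k)) (ℕ.s≤s (ℕ.+-monoʳ-< i k<m)))

    rooted = topRoot m (λ k k<m → 0<-* (0<a′ k k<m) (0<a′ k k<m))
    L = proj₁ rooted
    top = proj₂ rooted
    v = rootVector a′ m L
    w = shiftBy i v

    w-+ : ∀ k → w (i ℕ.+ k) ≡ v k
    w-+ = shiftBy-+ i v

    offset : ∀ {x} → suc i ℕ.≤ x → ∃[ k ] i ℕ.+ suc k ≡ x
    offset i<x = let k , eq = ℕ.m≤n⇒∃[o]m+o≡n i<x in k , ≡.trans (ℕ.+-suc i k) eq

    positive : ∀ x → suc i ℕ.≤ x → x ℕ.≤ suc i ℕ.+ m → 0< w x
    positive x i<x x≤ with offset i<x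
    ... | k , ≡.refl = ≡.subst 0<_ (≡.sym (w-+ (suc k)))
      (0<rootVector a′ m L 0<a′ top k (ℕ.+-cancelˡ-≤ (suc i) k m (≡.subst (ℕ._≤ suc i ℕ.+ m) (ℕ.+-suc i k) x≤)))

    below : ∀ x → x ℕ.< suc i → w x ≈ 0#
    below x (ℕ.s≤s x≤i) with ℕ.m≤n⇒m<n∨m≡n x≤i
    ... | inj₁ x<i    = reflexive (shiftBy-< i v x<i)
    ... | inj₂ ≡.refl = reflexive (≡.trans (≡.cong w (≡.sym (ℕ.+-identityʳ i))) (w-+ 0))

    above : ∀ x → suc i ℕ.+ m ℕ.< x → w x ≈ 0#
    above x i+m<x with offset (ℕ.≤-trans (ℕ.s≤s (ℕ.m≤m+n i m)) (ℕ.<⇒≤ i+m<x))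
    ... | k , ≡.refl = reflexive (≡.trans (w-+ (suc k)) (rootVector-> a′ m L k
      (ℕ.+-cancelˡ-< (suc i) m k (≡.subst (suc i ℕ.+ m ℕ.<_) (ℕ.+-suc i k) i+m<x))))

    eigen : ∀ x → suc i ℕ.≤ suc x → suc x ℕ.≤ suc i ℕ.+ m →
            L * w (suc x) ≈ a x * w x + a (suc x) * w (suc (suc x))
    eigen x (ℕ.s≤s i≤x) (ℕ.s≤s x≤) with ℕ.m≤n⇒∃[o]m+o≡n i≤x
    ... | k , ≡.refl = trans (*-congˡ (reflexive (w-suc k)))
      (trans (rootVector-eigen a′ m L 0<a′ top k (ℕ.+-cancelˡ-≤ i k m x≤))
        (sym (+-cong (*-congˡ (reflexive (w-+ k)))
          (*-cong (reflexive (≡.cong a (≡.sym (ℕ.+-suc i k))))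
            (reflexive (≡.trans (≡.cong (w ∘ suc) (≡.sym (ℕ.+-suc i k))) (w-suc (suc k))))))))
      where
      w-suc : ∀ k → w (suc (i ℕ.+ k)) ≡ v (suc k)
      w-suc k = ≡.trans (≡.cong w (≡.sym (ℕ.+-suc i k))) (w-+ (suc k))

  -- The inequality between Perron roots

  -- x ⊑ y : the difference y - x is a nonnegative even number.
  data _⊑_ : ℕ → ℕ → Set where
    ⊑-refl : ∀ {x} → x ⊑ x
    ⊑-step : ∀ {x y} → x ⊑ y → x ⊑ suc (suc y)

  ⊑-suc : ∀ {x y} → x ⊑ y → suc x ⊑ suc y
  ⊑-suc ⊑-refl     = ⊑-refl
  ⊑-suc (⊑-step p) = ⊑-step (⊑-suc p)

  ⊑-pred : ∀ {x y} → suc x ⊑ y → x ⊑ suc y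
  ⊑-pred ⊑-refl     = ⊑-step ⊑-refl
  ⊑-pred (⊑-step p) = ⊑-step (⊑-pred p)

  ⊑⇒≤ : ∀ {x y} → x ⊑ y → x ℕ.≤ y
  ⊑⇒≤ ⊑-refl     = ℕ.≤-refl
  ⊑⇒≤ (⊑-step p) = ℕ.m≤n⇒m≤1+n (ℕ.m≤n⇒m≤1+n (⊑⇒≤ p))

  -- The value at (x , y) of the product of two path operators, whose four
  -- neighbours of (x , y) have the weights r * s, r * s′, r′ * s, r′ * s′.
  combination : (r r′ s s′ f₁₁ f₁₂ f₂₁ f₂₂ : Carrier) → Carrier
  combination r r′ s s′ f₁₁ f₁₂ f₂₁ f₂₂ =
    r * s * f₁₁ + r * s′ * f₁₂ + (r′ * s * f₂₁ + r′ * s′ * f₂₂)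

  combination-mono : ∀ {r r′ s s′ f₁₁ f₁₂ f₂₁ f₂₂ g₁₁ g₁₂ g₂₁ g₂₂} →
    0≤ r → 0≤ r′ → 0≤ s → 0≤ s′ → f₁₁ ≤ g₁₁ → f₁₂ ≤ g₁₂ → f₂₁ ≤ g₂₁ → f₂₂ ≤ g₂₂ →
    combination r r′ s s′ f₁₁ f₁₂ f₂₁ f₂₂ ≤ combination r r′ s s′ g₁₁ g₁₂ g₂₁ g₂₂
  combination-mono 0≤r 0≤r′ 0≤s 0≤s′ h₁₁ h₁₂ h₂₁ h₂₂ = +-mono-≤
    (+-mono-≤ (*-monoˡ-≤ _ (0≤-* 0≤r 0≤s) h₁₁) (*-monoˡ-≤ _ (0≤-* 0≤r 0≤s′) h₁₂))
    (+-mono-≤ (*-monoˡ-≤ _ (0≤-* 0≤r′ 0≤s) h₂₁) (*-monoˡ-≤ _ (0≤-* 0≤r′ 0≤s′) h₂₂))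

  combination-* : ∀ c r r′ s s′ f f′ g g′ →
    combination r r′ s s′ (c * (f * g)) (c * (f * g′)) (c * (f′ * g)) (c * (f′ * g′)) ≈
    c * ((r * f + r′ * f′) * (s * g + s′ * g′))
  combination-* = solve 9 (λ c r r′ s s′ f f′ g g′ →
    r :* s :* (c :* (f :* g)) :+ r :* s′ :* (c :* (f :* g′)) :+
      (r′ :* s :* (c :* (f′ :* g)) :+ r′ :* s′ :* (c :* (f′ :* g′))) :=
    c :* ((r :* f :+ r′ :* f′) :* (s :* g :+ s′ :* g′))) refl

  combination-+ : ∀ r r′ s s′ f₁₁ f₁₂ f₂₁ f₂₂ g₁₁ g₁₂ g₂₁ g₂₂ →
    combination r r′ s s′ f₁₁ f₁₂ f₂₁ f₂₂ + combination r r′ s s′ g₁₁ g₁₂ g₂₁ g₂₂ ≈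
    combination r r′ s s′ (f₁₁ + g₁₁) (f₁₂ + g₁₂) (f₂₁ + g₂₁) (f₂₂ + g₂₂)
  combination-+ = solve 12 (λ r r′ s s′ f₁₁ f₁₂ f₂₁ f₂₂ g₁₁ g₁₂ g₂₁ g₂₂ →
    (r :* s :* f₁₁ :+ r :* s′ :* f₁₂ :+ (r′ :* s :* f₂₁ :+ r′ :* s′ :* f₂₂)) :+
    (r :* s :* g₁₁ :+ r :* s′ :* g₁₂ :+ (r′ :* s :* g₂₁ :+ r′ :* s′ :* g₂₂)) :=
    r :* s :* (f₁₁ :+ g₁₁) :+ r :* s′ :* (f₁₂ :+ g₁₂) :+
      (r′ :* s :* (f₂₁ :+ g₂₁) :+ r′ :* s′ :* (f₂₂ :+ g₂₂))) refl

  -- With equal weights in both coordinates the two mixed neighbours share the coefficient `r * r′`,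
  -- so a comparison of their sums is enough.
  combination-mono-diag : ∀ {r r′ f₁₁ f₁₂ f₂₁ f₂₂ g₁₁ g₁₂ g₂₁ g₂₂} →
    0≤ r → 0≤ r′ → f₁₁ ≤ g₁₁ → f₁₂ + f₂₁ ≤ g₁₂ + g₂₁ → f₂₂ ≤ g₂₂ →
    combination r r′ r r′ f₁₁ f₁₂ f₂₁ f₂₂ ≤ combination r r′ r r′ g₁₁ g₁₂ g₂₁ g₂₂
  combination-mono-diag {r} {r′} {f₁₁} {f₁₂} {f₂₁} {f₂₂} {g₁₁} {g₁₂} {g₂₁} {g₂₂} 0≤r 0≤r′ h₁₁ h h₂₂ = 0≤-resp
    (solve 10 (λ r r′ f₁₁ f₁₂ f₂₁ f₂₂ g₁₁ g₁₂ g₂₁ g₂₂ →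
       r :* r :* (g₁₁ :- f₁₁) :+ r :* r′ :* (g₁₂ :+ g₂₁ :- (f₁₂ :+ f₂₁)) :+ r′ :* r′ :* (g₂₂ :- f₂₂) :=
       (r :* r :* g₁₁ :+ r :* r′ :* g₁₂ :+ (r′ :* r :* g₂₁ :+ r′ :* r′ :* g₂₂)) :-
       (r :* r :* f₁₁ :+ r :* r′ :* f₁₂ :+ (r′ :* r :* f₂₁ :+ r′ :* r′ :* f₂₂))) refl
       r r′ f₁₁ f₁₂ f₂₁ f₂₂ g₁₁ g₁₂ g₂₁ g₂₂)
    (0≤-+ (0≤-+ (0≤-* (0≤-* 0≤r 0≤r) h₁₁) (0≤-* (0≤-* 0≤r 0≤r′) h)) (0≤-* (0≤-* 0≤r′ 0≤r′) h₂₂))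

  module PairInequality
    (a : ℕ → Carrier) (0≤a : ∀ x → 0≤ a x) (n : ℕ)
    {μ ν α β : Carrier} {u v p q : ℕ → Carrier}
    (U : IsPerronVector a 2 n μ u) (V : IsPerronVector a 1 (suc n) ν v)
    (P : IsPerronVector a 1 n α p) (Q : IsPerronVector a 2 (suc n) β q)
    where

    private
      module U = IsPerronVector U
      module V = IsPerronVector V
      module P = IsPerronVector P
      module Q = IsPerronVector Q

    record Dominated (c d : Carrier) (x y : ℕ) : Set where
      field
        vu  : c * (v x * u y) ≤ d * (p x * q y)
        uv  : c * (u x * v y) ≤ d * (p x * q y)
        sum : c * (u x * v y) + c * (v x * u y) ≤ d * (p x * q y) + d * (q x * p y)

    open Dominated

    private
      0≤pq : ∀ {d} → 0≤ d → ∀ x y → 0≤ d * (p x * q y)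
      0≤pq 0≤d x y = 0≤-* 0≤d (0≤-* (P.nonNegative x) (Q.nonNegative y))

      0≤qp : ∀ {d} → 0≤ d → ∀ x y → 0≤ d * (q x * p y)
      0≤qp 0≤d x y = 0≤-* 0≤d (0≤-* (Q.nonNegative x) (P.nonNegative y))

      zeroˡ₃ : ∀ c {f} g → f ≈ 0# → c * (f * g) ≈ 0#
      zeroˡ₃ c g f≈0 = *-zeroʳ-≈ c (*-zeroˡ-≈ g f≈0)

      zeroʳ₃ : ∀ c f {g} → g ≈ 0# → c * (f * g) ≈ 0#
      zeroʳ₃ c f g≈0 = *-zeroʳ-≈ c (*-zeroʳ-≈ f g≈0)

      sum-≤ : ∀ {f g h k} → f ≈ 0# → g ≤ h → 0≤ k → f + g ≤ h + k
      sum-≤ f≈0 g≤h 0≤k = ≤-resp (+-comm _ _) refl (+-mono-≤ g≤h (≤-zero f≈0 0≤k))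

    dominated-resp : ∀ {c d d′ x y} → d ≈ d′ → Dominated c d x y → Dominated c d′ x y
    dominated-resp d≈d′ D = record
      { vu  = ≤-resp refl (*-congʳ d≈d′) (vu D)
      ; uv  = ≤-resp refl (*-congʳ d≈d′) (uv D)
      ; sum = ≤-resp refl (+-cong (*-congʳ d≈d′) (*-congʳ d≈d′)) (sum D)
      }

    -- Once `u x` vanishes, the left side of `sum` is that of `vu`, and its right side only gains
    -- the nonnegative term with `q x * p y`.
    dominated-ux : ∀ {c d x y} → 0≤ d → u x ≈ 0# → c * (v x * u y) ≤ d * (p x * q y) → Dominated c d x y
    dominated-ux {c} {d} {x} {y} 0≤d ux≈0 h = record
      { vu  = h
      ; uv  = ≤-zero (zeroˡ₃ c (v y) ux≈0) (0≤pq 0≤d x y)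
      ; sum = sum-≤ (zeroˡ₃ c (v y) ux≈0) h (0≤qp 0≤d x y)
      }

    dominated-uy : ∀ {c d x y} → 0≤ d → u y ≈ 0# → c * (u x * v y) ≤ d * (p x * q y) → Dominated c d x y
    dominated-uy {c} {d} {x} {y} 0≤d uy≈0 h = record
      { vu  = ≤-zero (zeroʳ₃ c (v x) uy≈0) (0≤pq 0≤d x y)
      ; uv  = h
      ; sum = ≤-resp (+-comm _ _) refl (sum-≤ (zeroʳ₃ c (v x) uy≈0) h (0≤qp 0≤d x y))
      }

    dominated-uxy : ∀ {c d x y} → 0≤ d → u x ≈ 0# → u y ≈ 0# → Dominated c d x y
    dominated-uxy {c} {d} {x} {y} 0≤d ux≈0 uy≈0 =
      dominated-ux 0≤d ux≈0 (≤-zero (zeroʳ₃ c (v x) uy≈0) (0≤pq 0≤d x y))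

    u-support : ∀ x → (2 ℕ.≤ x × x ℕ.≤ n) ⊎ u x ≈ 0#
    u-support x with 2 ℕ.≤? x | x ℕ.≤? n
    ... | no x≱2  | _       = inj₂ (U.below x (ℕ.≰⇒> x≱2))
    ... | yes 2≤x | no x≰n  = inj₂ (U.above x (ℕ.≰⇒> x≰n))
    ... | yes 2≤x | yes x≤n = inj₁ (2≤x , x≤n)

    -- A product of eigenvectors, one in each coordinate, is an eigenfunction of the product
    -- operator, and its eigenvalue is the product of the roots.
    eigen-* : ∀ {σ τ f f′ g g′ h h′ r r′ s s′} c → σ * f ≈ r * g + r′ * g′ → τ * h ≈ s * f′ + s′ * h′ →
      combination r r′ s s′ (c * (g * f′)) (c * (g * h′)) (c * (g′ * f′)) (c * (g′ * h′)) ≈ σ * τ * c * (f * h)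
    eigen-* {σ} {τ} {f} {f′} {g} {g′} {h} {h′} {r} {r′} {s} {s′} c eq eq′ = trans
      (combination-* c r r′ s s′ g g′ f′ h′)
      (trans (*-congˡ (*-cong (sym eq) (sym eq′)))
        (solve 5 (λ c σ τ f h → c :* ((σ :* f) :* (τ :* h)) := σ :* τ :* c :* (f :* h)) refl c σ τ f h))

    module _ {c d : Carrier} (0≤c : 0≤ c) (0≤d : 0≤ d) (IH : ∀ {x y} → x ⊑ y → Dominated c d x y) where
      private
        c′ = μ * ν * c
        d′ = α * β * d

        0≤d′ : 0≤ d′
        0≤d′ = 0≤-* (0≤-* P.0≤root Q.0≤root) 0≤d

        comm-μν : ∀ z → ν * μ * c * z ≈ c′ * z
        comm-μν z = *-congʳ (*-congʳ (*-comm ν μ))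

        comm-αβ : ∀ z → β * α * d * z ≈ d′ * z
        comm-αβ z = *-congʳ (*-congʳ (*-comm β α))

      -- For equal coordinates the three inequalities are one and the same up to commutativity.
      diagonal-step : ∀ x → 2 ℕ.≤ suc x → suc x ℕ.≤ n → Dominated c′ d′ (suc x) (suc x)
      diagonal-step x 2≤x x≤n = record
        { vu  = ≤-resp (*-congˡ (*-comm _ _)) refl diag
        ; uv  = diag
        ; sum = +-mono-≤ diag (≤-resp (*-congˡ (*-comm _ _)) (*-congˡ (*-comm _ _)) diag)
        }
        where
        1≤x = ℕ.≤-trans (ℕ.n≤1+n 1) 2≤x
        x≤1+n = ℕ.m≤n⇒m≤1+n x≤n
        -- The neighbour with coordinates in the wrong order is outside the induction hypothesis;
        -- its term reappears, with factors commuted, as the second summand of `sum` here.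
        corner = IH {x} {suc (suc x)} (⊑-step ⊑-refl)
        diag : c′ * (u (suc x) * v (suc x)) ≤ d′ * (p (suc x) * q (suc x))
        diag = ≤-resp (eigen-* c (U.eigen x 2≤x x≤n) (V.eigen x 1≤x x≤1+n))
          (eigen-* d (P.eigen x 1≤x x≤n) (Q.eigen x 2≤x x≤1+n))
          (combination-mono-diag (0≤a x) (0≤a (suc x)) (uv (IH ⊑-refl))
            (≤-resp (+-congˡ (*-congˡ (*-comm _ _))) (+-congˡ (*-congˡ (*-comm _ _))) (sum corner))
            (uv (IH ⊑-refl)))

      module _ {x y} (x⊑y : suc x ⊑ y) where
        private
          -- Off the diagonal the gap is at least two, so all four neighbours stay ordered, even the
          -- one where both coordinates move towards each other.
          IH₁₁ = IH (⊑-pred x⊑y)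
          IH₁₂ = IH (⊑-step (⊑-pred x⊑y))
          IH₂₁ = IH (⊑-suc x⊑y)
          IH₂₂ = IH (⊑-step (⊑-suc x⊑y))

          1≤x : 1 ℕ.≤ suc x
          1≤x = ℕ.s≤s ℕ.z≤n

          2≤y : 2 ℕ.≤ suc (suc y)
          2≤y = ℕ.s≤s (ℕ.s≤s ℕ.z≤n)

          x<y : suc x ℕ.< suc (suc y)
          x<y = ℕ.s≤s (ℕ.m≤n⇒m≤1+n (⊑⇒≤ x⊑y))

          step-mono : ∀ {f₁₁ f₁₂ f₂₁ f₂₂ g₁₁ g₁₂ g₂₁ g₂₂} →
            f₁₁ ≤ g₁₁ → f₁₂ ≤ g₁₂ → f₂₁ ≤ g₂₁ → f₂₂ ≤ g₂₂ →
            combination (a x) (a (suc x)) (a (suc y)) (a (suc (suc y))) f₁₁ f₁₂ f₂₁ f₂₂ ≤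
            combination (a x) (a (suc x)) (a (suc y)) (a (suc (suc y))) g₁₁ g₁₂ g₂₁ g₂₂
          step-mono = combination-mono (0≤a x) (0≤a (suc x)) (0≤a (suc y)) (0≤a (suc (suc y)))

        -- The order makes the four equations available together: the first coordinate lies below
        -- the second, hence within [1,n], where `p` has its equation although `v` reaches one
        -- vertex further.
        vu-step : suc (suc y) ℕ.≤ n → c′ * (v (suc x) * u (suc (suc y))) ≤ d′ * (p (suc x) * q (suc (suc y)))
        vu-step y≤n = ≤-resp
          (trans (eigen-* c (V.eigen x 1≤x (ℕ.m≤n⇒m≤1+n x≤n)) (U.eigen (suc y) 2≤y y≤n)) (comm-μν _))
          (eigen-* d (P.eigen x 1≤x x≤n) (Q.eigen (suc y) 2≤y (ℕ.m≤n⇒m≤1+n y≤n)))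
          (step-mono (vu IH₁₁) (vu IH₁₂) (vu IH₂₁) (vu IH₂₂))
          where x≤n = ℕ.<⇒≤ (ℕ.<-≤-trans x<y y≤n)

        uv-step : 2 ℕ.≤ suc x → suc x ℕ.≤ n → suc (suc y) ℕ.≤ suc n →
                  c′ * (u (suc x) * v (suc (suc y))) ≤ d′ * (p (suc x) * q (suc (suc y)))
        uv-step 2≤x x≤n y≤1+n = ≤-resp
          (eigen-* c (U.eigen x 2≤x x≤n) (V.eigen (suc y) (ℕ.s≤s ℕ.z≤n) y≤1+n))
          (eigen-* d (P.eigen x 1≤x x≤n) (Q.eigen (suc y) 2≤y y≤1+n))
          (step-mono (uv IH₁₁) (uv IH₁₂) (uv IH₂₁) (uv IH₂₂))

        sum-step : 2 ℕ.≤ suc x → suc (suc y) ℕ.≤ n →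
          c′ * (u (suc x) * v (suc (suc y))) + c′ * (v (suc x) * u (suc (suc y))) ≤
          d′ * (p (suc x) * q (suc (suc y))) + d′ * (q (suc x) * p (suc (suc y)))
        sum-step 2≤x y≤n = ≤-resp
          (trans (sym (combination-+ _ _ _ _ _ _ _ _ _ _ _ _)) (+-cong
            (eigen-* c (U.eigen x 2≤x x≤n) (V.eigen (suc y) (ℕ.s≤s ℕ.z≤n) y≤1+n))
            (trans (eigen-* c (V.eigen x 1≤x x≤1+n) (U.eigen (suc y) 2≤y y≤n)) (comm-μν _))))
          (trans (sym (combination-+ _ _ _ _ _ _ _ _ _ _ _ _)) (+-cong
            (eigen-* d (P.eigen x 1≤x x≤n) (Q.eigen (suc y) 2≤y y≤1+n))
            (trans (eigen-* d (Q.eigen x 2≤x x≤1+n) (P.eigen (suc y) (ℕ.s≤s ℕ.z≤n) y≤n)) (comm-αβ _))))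
          (step-mono (sum IH₁₁) (sum IH₁₂) (sum IH₂₁) (sum IH₂₂))
          where
          x≤n = ℕ.<⇒≤ (ℕ.<-≤-trans x<y y≤n)
          x≤1+n = ℕ.m≤n⇒m≤1+n x≤n
          y≤1+n = ℕ.m≤n⇒m≤1+n y≤n

        off-diagonal-step : Dominated c′ d′ (suc x) (suc (suc y))
        off-diagonal-step with u-support (suc x) | u-support (suc (suc y))
        ... | inj₂ ux≈0        | inj₂ uy≈0      = dominated-uxy 0≤d′ ux≈0 uy≈0
        ... | inj₂ ux≈0        | inj₁ (_ , y≤n) = dominated-ux 0≤d′ ux≈0 (vu-step y≤n)
        ... | inj₁ (2≤x , x≤n) | inj₁ (_ , y≤n) = record
          { vu = vu-step y≤n ; uv = uv-step 2≤x x≤n (ℕ.m≤n⇒m≤1+n y≤n) ; sum = sum-step 2≤x y≤n }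
        -- The second coordinate may be the vertex `suc n`, where `v` and `q` still satisfy their
        -- equations; beyond it `v` is zero.
        ... | inj₁ (2≤x , x≤n) | inj₂ uy≈0 with suc (suc y) ℕ.≤? suc n
        ...   | yes y≤1+n = dominated-uy 0≤d′ uy≈0 (uv-step 2≤x x≤n y≤1+n)
        ...   | no  y≰1+n = dominated-uy 0≤d′ uy≈0
          (≤-zero (zeroʳ₃ c′ (u (suc x)) (V.above (suc (suc y)) (ℕ.≰⇒> y≰1+n))) (0≤pq 0≤d′ (suc x) (suc (suc y))))

      dominated-step : ∀ {x y} → x ⊑ y → Dominated c′ d′ x y
      dominated-step {zero} {y} x⊑y = dominated-ux 0≤d′ (U.below 0 (ℕ.s≤s ℕ.z≤n))
        (≤-zero (zeroˡ₃ c′ (u y) (V.below 0 (ℕ.s≤s ℕ.z≤n))) (0≤pq 0≤d′ 0 y))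
      dominated-step {suc x} (⊑-step x⊑y) = off-diagonal-step x⊑y
      dominated-step {suc x} ⊑-refl with u-support (suc x)
      ... | inj₁ (2≤x , x≤n) = diagonal-step x 2≤x x≤n
      ... | inj₂ ux≈0        = dominated-uxy 0≤d′ ux≈0 ux≈0

    private
      product-≤ : ∀ {f g h k K L} → 0≤ f → 0≤ L * k → f ≤ K * h → g ≤ L * k →
                  1# * (f * g) ≤ K * L * (h * k)
      product-≤ {f} {g} {h} {k} {K} {L} 0≤f 0≤Lk f≤ g≤ = ≤-resp (sym (*-identityˡ (f * g)))
        (solve 4 (λ K L h k → (K :* h) :* (L :* k) := K :* L :* (h :* k)) refl K L h k)
        (*-mono-≤ 0≤f 0≤Lk f≤ g≤)

    -- `v` is not bounded by a multiple of `p` at vertex `suc n`, but x ≤ y ≤ n keeps `x` where `p`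
    -- is positive. In `uv-base` the condition 2 ≤ x likewise keeps `y` away from vertex 1, where
    -- `q` vanishes.
    vu-base : ∃[ K ] ((0≤ K) × (∀ {x y} → x ℕ.≤ y → y ℕ.≤ n → 2 ℕ.≤ y → 1# * (v x * u y) ≤ K * (p x * q y)))
    vu-base with ratio-bound v p 1 n P.positive
               | ratio-bound u q 2 n (λ x 2≤x x≤n → Q.positive x 2≤x (ℕ.m≤n⇒m≤1+n x≤n))
    ... | K , 0≤K , v≤Kp | L , 0≤L , u≤Lq = K * L , 0≤-* 0≤K 0≤L , bound
      where
      bound : ∀ {x y} → x ℕ.≤ y → y ℕ.≤ n → 2 ℕ.≤ y → 1# * (v x * u y) ≤ K * L * (p x * q y)
      bound {zero}  {y} _   _   _   =
        ≤-zero (zeroˡ₃ 1# (u y) (V.below 0 (ℕ.s≤s ℕ.z≤n))) (0≤pq (0≤-* 0≤K 0≤L) 0 y)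
      bound {suc x} {y} x≤y y≤n 2≤y = product-≤ (V.nonNegative (suc x)) (0≤-* 0≤L (Q.nonNegative y))
        (v≤Kp (suc x) (ℕ.s≤s ℕ.z≤n) (ℕ.≤-trans x≤y y≤n)) (u≤Lq y 2≤y y≤n)

    uv-base : ∃[ K ] ((0≤ K) × (∀ {x y} → x ℕ.≤ y → x ℕ.≤ n → 2 ℕ.≤ x → 1# * (u x * v y) ≤ K * (p x * q y)))
    uv-base with ratio-bound u p 2 n (λ x 2≤x → P.positive x (ℕ.<⇒≤ 2≤x))
               | ratio-bound v q 2 (suc n) Q.positive
    ... | K , 0≤K , u≤Kp | L , 0≤L , v≤Lq = K * L , 0≤-* 0≤K 0≤L , bound
      where
      bound : ∀ {x y} → x ℕ.≤ y → x ℕ.≤ n → 2 ℕ.≤ x → 1# * (u x * v y) ≤ K * L * (p x * q y)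
      bound {x} {y} x≤y x≤n 2≤x with y ℕ.≤? suc n
      ... | yes y≤1+n = product-≤ (U.nonNegative x) (0≤-* 0≤L (Q.nonNegative y))
        (u≤Kp x 2≤x x≤n) (v≤Lq y (ℕ.≤-trans 2≤x x≤y) y≤1+n)
      ... | no  y≰1+n =
        ≤-zero (zeroʳ₃ 1# (u x) (V.above y (ℕ.≰⇒> y≰1+n))) (0≤pq (0≤-* 0≤K 0≤L) x y)

    dominated-base : ∃[ K ] ((0≤ K) × (∀ {x y} → x ⊑ y → Dominated 1# K x y))
    dominated-base with vu-base | uv-base
    ... | K , 0≤K , vu≤K | L , 0≤L , uv≤L = K + L , 0≤K+L , base
      where
      0≤K+L = 0≤-+ 0≤K 0≤L

      K≤K+L : ∀ z → 0≤ z → K * z ≤ (K + L) * z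
      K≤K+L z 0≤z = 0≤-resp (solve 3 (λ K L z → L :* z := (K :+ L) :* z :- K :* z) refl K L z) (0≤-* 0≤L 0≤z)

      L≤K+L : ∀ z → 0≤ z → L * z ≤ (K + L) * z
      L≤K+L z 0≤z = 0≤-resp (solve 3 (λ K L z → K :* z := (K :+ L) :* z :- L :* z) refl K L z) (0≤-* 0≤K 0≤z)

      base : ∀ {x y} → x ⊑ y → Dominated 1# (K + L) x y
      base {x} {y} x⊑y = cases (u-support x) (u-support y)
        where
        x≤y = ⊑⇒≤ x⊑y
        0≤pxqy = 0≤-* (P.nonNegative x) (Q.nonNegative y)

        vu≤ : y ℕ.≤ n → 2 ℕ.≤ y → 1# * (v x * u y) ≤ (K + L) * (p x * q y)
        vu≤ y≤n 2≤y = ≤-trans (vu≤K x≤y y≤n 2≤y) (K≤K+L _ 0≤pxqy)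

        uv≤ : x ℕ.≤ n → 2 ℕ.≤ x → 1# * (u x * v y) ≤ (K + L) * (p x * q y)
        uv≤ x≤n 2≤x = ≤-trans (uv≤L x≤y x≤n 2≤x) (L≤K+L _ 0≤pxqy)

        cases : (2 ℕ.≤ x × x ℕ.≤ n) ⊎ u x ≈ 0# → (2 ℕ.≤ y × y ℕ.≤ n) ⊎ u y ≈ 0# → Dominated 1# (K + L) x y
        cases (inj₂ ux≈0)        (inj₂ uy≈0)        = dominated-uxy 0≤K+L ux≈0 uy≈0
        cases (inj₂ ux≈0)        (inj₁ (2≤y , y≤n)) = dominated-ux 0≤K+L ux≈0 (vu≤ y≤n 2≤y)
        cases (inj₁ (2≤x , x≤n)) (inj₂ uy≈0)        = dominated-uy 0≤K+L uy≈0 (uv≤ x≤n 2≤x)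
        cases (inj₁ (2≤x , x≤n)) (inj₁ (2≤y , y≤n)) = record
          { vu  = vu≤ y≤n 2≤y
          ; uv  = uv≤ x≤n 2≤x
          -- Both summands are charged to `p x * q y` alone, which is why the constant is `K + L`.
          ; sum = ≤-trans
              (≤-resp (+-comm _ _) (sym (distribʳ (p x * q y) K L))
                (+-mono-≤ (vu≤K x≤y y≤n 2≤y) (uv≤L x≤y x≤n 2≤x)))
              (0≤-resp (solve 2 (λ f g → g := f :+ g :- f) refl _ _) (0≤qp 0≤K+L x y))
          }

    pair-inequality : 2 ℕ.≤ n → μ * ν ≤ α * β
    pair-inequality 2≤n = ≤-stable λ αβ<μλ →
      let K , 0≤K , base = dominated-base in
      -- The bounds are read at the diagonal point (2 , 2): vertex 2 lies in [2,n], so `u` and `v`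
      -- are both positive there.
      growth (0≤-* P.0≤root Q.0≤root) αβ<μλ (0≤-* 0≤K (0≤-* (P.nonNegative 2) (Q.nonNegative 2)))
        (λ k → ≤-resp refl (*-assoc _ _ _) (uv (iterate K 0≤K base k ⊑-refl)))
        (0<-* (U.positive 2 ℕ.≤-refl 2≤n) (V.positive 2 (ℕ.s≤s ℕ.z≤n) (ℕ.m≤n⇒m≤1+n 2≤n)))
      where
      0≤c : ∀ k → 0≤ (μ * ν) ^ k
      0≤c = 0≤-^ (0≤-* U.0≤root V.0≤root)
      0≤d : ∀ {K} → 0≤ K → ∀ k → 0≤ (α * β) ^ k * K
      0≤d 0≤K k = 0≤-* (0≤-^ (0≤-* P.0≤root Q.0≤root) k) 0≤K

      iterate : ∀ K → 0≤ K → (∀ {x y} → x ⊑ y → Dominated 1# K x y) →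
                ∀ k {x y} → x ⊑ y → Dominated ((μ * ν) ^ k) ((α * β) ^ k * K) x y
      iterate K 0≤K base zero    x⊑y = dominated-resp (sym (*-identityˡ K)) (base x⊑y)
      iterate K 0≤K base (suc k) x⊑y = dominated-resp (sym (*-assoc _ _ _))
        (dominated-step (0≤c k) (0≤d 0≤K k) (iterate K 0≤K base k) x⊑y)

  -- Perron roots and spectral radii

  ∥_,_∥² : Carrier → Carrier → Carrier
  ∥ x , y ∥² = x * x + y * y

  0≤∥∥² : ∀ x y → 0≤ ∥ x , y ∥²
  0≤∥∥² x y = 0≤-+ (0≤-square x) (0≤-square y)

  ∥∥²-cong : ∀ {x x′ y y′} → x ≈ x′ → y ≈ y′ → ∥ x , y ∥² ≈ ∥ x′ , y′ ∥²
  ∥∥²-cong x≈x′ y≈y′ = +-cong (*-cong x≈x′ x≈x′) (*-cong y≈y′ y≈y′)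

  ∥∥²-zero : ∀ {x y} → x ≈ 0# → y ≈ 0# → ∥ x , y ∥² ≈ 0#
  ∥∥²-zero x≈0 y≈0 = trans (+-cong (*-zeroˡ-≈ _ x≈0) (*-zeroˡ-≈ _ y≈0)) (+-identityˡ 0#)

  -- Cauchy-Schwarz in the plane: by Lagrange's identity the defect is the square of the determinant
  -- `x₁ * y₂ - x₂ * y₁`. Comparing squares avoids square roots.
  inner-≤ : ∀ {A D x₁ y₁ x₂ y₂ w₁ w₂} → 0≤ A → 0≤ D → 0≤ w₁ → 0≤ w₂ →
    A * ∥ x₁ , y₁ ∥² ≤ D * (w₁ * w₁) → A * ∥ x₂ , y₂ ∥² ≤ D * (w₂ * w₂) →
    A * (x₁ * x₂ + y₁ * y₂) ≤ D * (w₁ * w₂)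
  inner-≤ {A} {D} {x₁} {y₁} {x₂} {y₂} {w₁} {w₂} 0≤A 0≤D 0≤w₁ 0≤w₂ h₁ h₂ =
    square-cancel-≤ (0≤-* 0≤D (0≤-* 0≤w₁ 0≤w₂)) (≤-trans
      (0≤-resp (solve 5 (λ A x₁ y₁ x₂ y₂ →
          A :* A :* ((x₁ :* y₂ :- x₂ :* y₁) :* (x₁ :* y₂ :- x₂ :* y₁)) :=
          (A :* (x₁ :* x₁ :+ y₁ :* y₁)) :* (A :* (x₂ :* x₂ :+ y₂ :* y₂)) :-
          (A :* (x₁ :* x₂ :+ y₁ :* y₂)) :* (A :* (x₁ :* x₂ :+ y₁ :* y₂))) refl A x₁ y₁ x₂ y₂)
        (0≤-* (0≤-* 0≤A 0≤A) (0≤-square (x₁ * y₂ - x₂ * y₁))))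
      (≤-resp refl
        (solve 3 (λ D w₁ w₂ → (D :* (w₁ :* w₁)) :* (D :* (w₂ :* w₂)) :=
                              (D :* (w₁ :* w₂)) :* (D :* (w₁ :* w₂))) refl D w₁ w₂)
        (*-mono-≤ (0≤-* 0≤A (0≤∥∥² x₁ y₁)) (0≤-* 0≤D (0≤-* 0≤w₂ 0≤w₂)) h₁ h₂)))

  -- The triangle inequality for a nonnegative combination of two complex numbers, in squared form;
  -- `inner-≤` bounds the cross terms.
  triangle-≤ : ∀ {A D r r′ x₁ y₁ x₂ y₂ w₁ w₂} → 0≤ A → 0≤ D → 0≤ r → 0≤ r′ → 0≤ w₁ → 0≤ w₂ →
    A * ∥ x₁ , y₁ ∥² ≤ D * (w₁ * w₁) → A * ∥ x₂ , y₂ ∥² ≤ D * (w₂ * w₂) →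
    A * ∥ r * x₁ + r′ * x₂ , r * y₁ + r′ * y₂ ∥² ≤ D * ((r * w₁ + r′ * w₂) * (r * w₁ + r′ * w₂))
  triangle-≤ {A} {D} {r} {r′} {x₁} {y₁} {x₂} {y₂} {w₁} {w₂} 0≤A 0≤D 0≤r 0≤r′ 0≤w₁ 0≤w₂ h₁ h₂ =
    ≤-resp
      (solve 7 (λ A r r′ x₁ y₁ x₂ y₂ →
          r :* r :* (A :* (x₁ :* x₁ :+ y₁ :* y₁)) :+
            (r :* r′ :* (A :* (x₁ :* x₂ :+ y₁ :* y₂)) :+ r :* r′ :* (A :* (x₁ :* x₂ :+ y₁ :* y₂))) :+
            r′ :* r′ :* (A :* (x₂ :* x₂ :+ y₂ :* y₂)) :=
          A :* ((r :* x₁ :+ r′ :* x₂) :* (r :* x₁ :+ r′ :* x₂) :+ (r :* y₁ :+ r′ :* y₂) :* (r :* y₁ :+ r′ :* y₂)))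
        refl A r r′ x₁ y₁ x₂ y₂)
      (solve 5 (λ D r r′ w₁ w₂ →
          r :* r :* (D :* (w₁ :* w₁)) :+ (r :* r′ :* (D :* (w₁ :* w₂)) :+ r :* r′ :* (D :* (w₁ :* w₂))) :+
            r′ :* r′ :* (D :* (w₂ :* w₂)) :=
          D :* ((r :* w₁ :+ r′ :* w₂) :* (r :* w₁ :+ r′ :* w₂)))
        refl D r r′ w₁ w₂)
      (+-mono-≤ (+-mono-≤ (*-monoˡ-≤ _ (0≤-* 0≤r 0≤r) h₁) (+-mono-≤ cross cross))
                (*-monoˡ-≤ _ (0≤-* 0≤r′ 0≤r′) h₂))
    where cross = *-monoˡ-≤ _ (0≤-* 0≤r 0≤r′) (inner-≤ 0≤A 0≤D 0≤w₁ 0≤w₂ h₁ h₂)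

  -- Complex eigenvalues against the Perron root.

  module EigenvalueBound
    (a : ℕ → Carrier) (0≤a : ∀ x → 0≤ a x) (i j : ℕ) {L : Carrier} {w : ℕ → Carrier}
    (W : IsPerronVector a (suc i) j L w) (z z′ : Carrier) (X Y : ℕ → Carrier)
    (X-below : ∀ x → x ℕ.< suc i → X x ≈ 0#) (X-above : ∀ x → j ℕ.< x → X x ≈ 0#)
    (Y-below : ∀ x → x ℕ.< suc i → Y x ≈ 0#) (Y-above : ∀ x → j ℕ.< x → Y x ≈ 0#)
    (X-eigen : ∀ x → suc i ℕ.≤ suc x → suc x ℕ.≤ j →
       a x * X x + a (suc x) * X (suc (suc x)) ≈ z * X (suc x) - z′ * Y (suc x))
    (Y-eigen : ∀ x → suc i ℕ.≤ suc x → suc x ℕ.≤ j →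
       a x * Y x + a (suc x) * Y (suc (suc x)) ≈ z * Y (suc x) + z′ * X (suc x))
    where
    open IsPerronVector W

    private
      s t : Carrier
      s = ∥ z , z′ ∥²
      t = L * L

      0≤t : 0≤ t
      0≤t = 0≤-* 0≤root 0≤root

      Dominated : Carrier → Carrier → ℕ → Set
      Dominated A D x = A * ∥ X x , Y x ∥² ≤ D * (w x * w x)

      dominated-zero : ∀ {A D} → 0≤ D → ∀ x → X x ≈ 0# → Y x ≈ 0# → Dominated A D x
      dominated-zero 0≤D x X≈0 Y≈0 =
        ≤-zero (*-zeroʳ-≈ _ (∥∥²-zero X≈0 Y≈0)) (0≤-* 0≤D (0≤-* (nonNegative x) (nonNegative x)))

      dominated-inside : ∀ {A D} → 0≤ D → (∀ x → suc i ℕ.≤ x → x ℕ.≤ j → Dominated A D x) → ∀ x → Dominated A D x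
      dominated-inside 0≤D inside x with suc i ℕ.≤? x | x ℕ.≤? j
      ... | no  i≰x | _       = dominated-zero 0≤D x (X-below x (ℕ.≰⇒> i≰x)) (Y-below x (ℕ.≰⇒> i≰x))
      ... | yes i≤x | yes x≤j = inside x i≤x x≤j
      ... | yes i≤x | no  x≰j = dominated-zero 0≤D x (X-above x (ℕ.≰⇒> x≰j)) (Y-above x (ℕ.≰⇒> x≰j))

      -- One application of the matrix multiplies the eigenvector's squared moduli by `s` and the
      -- Perron vector's squares by `t`, and `triangle-≤` preserves the domination.
      dominated-step : ∀ {A D} → 0≤ A → 0≤ D → (∀ x → Dominated A D x) → ∀ x → Dominated (s * A) (t * D) x
      dominated-step {A} {D} 0≤A 0≤D IH = dominated-inside (0≤-* 0≤t 0≤D) inside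
        where
        inside : ∀ x → suc i ℕ.≤ x → x ℕ.≤ j → Dominated (s * A) (t * D) x
        inside (suc x) i≤x x≤j = ≤-resp
          (trans (*-congˡ (∥∥²-cong (X-eigen x i≤x x≤j) (Y-eigen x i≤x x≤j)))
            (solve 5 (λ A z z′ x y →
               A :* ((z :* x :- z′ :* y) :* (z :* x :- z′ :* y) :+ (z :* y :+ z′ :* x) :* (z :* y :+ z′ :* x)) :=
               (z :* z :+ z′ :* z′) :* A :* (x :* x :+ y :* y)) refl A z z′ (X (suc x)) (Y (suc x))))
          (trans (*-congˡ (*-cong (sym (eigen x i≤x x≤j)) (sym (eigen x i≤x x≤j))))
            (solve 3 (λ D L w → D :* ((L :* w) :* (L :* w)) := L :* L :* D :* (w :* w)) refl D L (w (suc x))))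
          (triangle-≤ 0≤A 0≤D (0≤a x) (0≤a (suc x)) (nonNegative x) (nonNegative (suc (suc x)))
            (IH x) (IH (suc (suc x))))

    -- `ratio-bound` supplies an initial domination, iteration multiplies its sides by `s ^ k` and
    -- `t ^ k`, and `growth` concludes.
    eigenvector-vanishes : t < s → ∀ x → ¬ (0< ∥ X x , Y x ∥²)
    eigenvector-vanishes t<s x with ratio-bound (λ x → ∥ X x , Y x ∥²) (λ x → w x * w x) (suc i) j
                                      (λ x i≤x x≤j → 0<-* (positive x i≤x x≤j) (positive x i≤x x≤j))
    ... | K , 0≤K , bound = growth 0≤t t<s (0≤-* 0≤K (0≤-* (nonNegative x) (nonNegative x)))
      (λ k → ≤-resp refl (*-assoc _ _ _) (iterate k x))
      where
      iterate : ∀ k x → Dominated (s ^ k) (t ^ k * K) x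
      iterate zero    = dominated-inside (0≤-* (0<⇒0≤ 0<1) 0≤K) λ x i≤x x≤j →
        ≤-resp (sym (*-identityˡ _)) (*-congʳ (sym (*-identityˡ K))) (bound x i≤x x≤j)
      iterate (suc k) x = ≤-resp refl (*-congʳ (sym (*-assoc t (t ^ k) K)))
        (dominated-step (0≤-^ (0≤∥∥² z z′) k) (0≤-* (0≤-^ 0≤t k) 0≤K) (iterate k) x)

  -- X and Y are the real and imaginary parts of an eigenvector for z + i z′,
  -- extended by zero outside [ i , j ].
  record IsComplexEigenvector (a : ℕ → Carrier) (i j : ℕ) (z z′ : Carrier) (X Y : ℕ → Carrier) : Set where
    field
      X-below : ∀ x → x ℕ.< i → X x ≈ 0#
      X-above : ∀ x → j ℕ.< x → X x ≈ 0#
      Y-below : ∀ x → x ℕ.< i → Y x ≈ 0#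
      Y-above : ∀ x → j ℕ.< x → Y x ≈ 0#
      X-eigen : ∀ x → i ℕ.≤ suc x → suc x ℕ.≤ j →
                a x * X x + a (suc x) * X (suc (suc x)) ≈ z * X (suc x) - z′ * Y (suc x)
      Y-eigen : ∀ x → i ℕ.≤ suc x → suc x ℕ.≤ j →
                a x * Y x + a (suc x) * Y (suc (suc x)) ≈ z * Y (suc x) + z′ * X (suc x)
      nonzero : ¬ (∀ x → X x ≈ 0# × Y x ≈ 0#)

  -- Maximality is kept only against Perron roots; with the attained eigenvalue this already pins
  -- `ρ` down.
  record IsRadius (a : ℕ → Carrier) (i j : ℕ) (ρ : Carrier) : Set where
    field
      0≤ρ      : 0≤ ρ
      {z z′}   : Carrier
      {X Y}    : ℕ → Carrier
      attained : IsComplexEigenvector a i j z z′ X Y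
      modulus  : ∥ z , z′ ∥² ≈ ρ * ρ
      maximal  : ∀ {L w} → IsPerronVector a i j L w → L * L ≤ ρ * ρ

  -- Independence of the weights outside the interval.

  module _ {a a′ : ℕ → Carrier} {i j : ℕ} (a≈a′ : ∀ x → i ℕ.≤ x → x ℕ.< j → a x ≈ a′ x) where

    private
      term-resp : ∀ x {f} → i ℕ.≤ suc x → x ℕ.≤ j → (x ℕ.< i → f ≈ 0#) → (j ℕ.≤ x → f ≈ 0#) → a x * f ≈ a′ x * f
      term-resp x {f} i≤ x≤j below above with i ℕ.≤? x | suc x ℕ.≤? j
      ... | no i≰x  | _       = trans (*-zeroʳ-≈ _ (below (ℕ.≰⇒> i≰x))) (sym (*-zeroʳ-≈ _ (below (ℕ.≰⇒> i≰x))))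
      ... | yes i≤x | yes x<j = *-congʳ (a≈a′ x i≤x x<j)
      ... | yes i≤x | no  x≮j = trans (*-zeroʳ-≈ _ (above (ℕ.≮⇒≥ x≮j))) (sym (*-zeroʳ-≈ _ (above (ℕ.≮⇒≥ x≮j))))

    -- Only the two edges leaving the interval may carry different weights, and these multiply
    -- entries that are zero.
    neighbours-resp : ∀ {f : ℕ → Carrier} → (∀ x → x ℕ.< i → f x ≈ 0#) → (∀ x → j ℕ.< x → f x ≈ 0#) →
      ∀ x → i ℕ.≤ suc x → suc x ℕ.≤ j →
      a x * f x + a (suc x) * f (suc (suc x)) ≈ a′ x * f x + a′ (suc x) * f (suc (suc x))
    neighbours-resp below above x i≤ x≤ = +-cong
      (term-resp x i≤ (ℕ.<⇒≤ x≤) (below x) (λ j≤x → ⊥-elim (ℕ.<⇒≱ x≤ j≤x)))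
      (term-resp (suc x) (ℕ.m≤n⇒m≤1+n i≤) x≤ (λ x<i → ⊥-elim (ℕ.<⇒≱ x<i i≤)) (λ j≤x → above (suc (suc x)) (ℕ.s≤s j≤x)))

    perronVector-resp : ∀ {L w} → IsPerronVector a i j L w → IsPerronVector a′ i j L w
    perronVector-resp W = record
      { 0≤root = 0≤root ; nonNegative = nonNegative ; positive = positive ; below = below ; above = above
      ; eigen = λ x i≤ x≤ → trans (eigen x i≤ x≤) (neighbours-resp below above x i≤ x≤) }
      where open IsPerronVector W

    complexEigenvector-resp : ∀ {z z′ X Y} → IsComplexEigenvector a i j z z′ X Y → IsComplexEigenvector a′ i j z z′ X Y
    complexEigenvector-resp E = record
      { X-below = X-below ; X-above = X-above ; Y-below = Y-below ; Y-above = Y-above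
      ; X-eigen = λ x i≤ x≤ → trans (sym (neighbours-resp X-below X-above x i≤ x≤)) (X-eigen x i≤ x≤)
      ; Y-eigen = λ x i≤ x≤ → trans (sym (neighbours-resp Y-below Y-above x i≤ x≤)) (Y-eigen x i≤ x≤)
      ; nonzero = nonzero }
      where open IsComplexEigenvector E

  radius-resp : ∀ {a a′ i j ρ} → (∀ x → i ℕ.≤ x → x ℕ.< j → a x ≈ a′ x) → IsRadius a i j ρ → IsRadius a′ i j ρ
  radius-resp a≈a′ R = record
    { 0≤ρ = 0≤ρ ; attained = complexEigenvector-resp a≈a′ attained ; modulus = modulus
    ; maximal = λ W → maximal (perronVector-resp (λ x i≤x x<j → sym (a≈a′ x i≤x x<j)) W) }
    where open IsRadius R

  square≤0⇒≈0 : ∀ {x} → x * x ≤ 0# → x ≈ 0#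
  square≤0⇒≈0 {x} x²≤0 = 0≤-antisym
    (0≤-resp (-‿involutive x) (≤0⇒0≤- (square-cancel-≤ 0≤0
      (≤-trans (≈⇒≤ (solve 1 (λ x → (:- x) :* (:- x) := x :* x) refl x)) x²≤0²))))
    (≤0⇒0≤- (square-cancel-≤ 0≤0 x²≤0²))
    where
    x²≤0² : x * x ≤ 0# * 0#
    x²≤0² = ≤-trans x²≤0 (≈⇒≤ (sym (zeroˡ 0#)))
    ≤0⇒0≤- : ∀ {y} → y ≤ 0# → 0≤ - y
    ≤0⇒0≤- = 0≤-resp (+-identityˡ _)

  ∥∥²-pos-unless-zero : ∀ {x y} → ¬ (0< ∥ x , y ∥²) → x ≈ 0# × y ≈ 0#
  ∥∥²-pos-unless-zero {x} {y} ∥∥≯0 =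
    square≤0⇒≈0 (≤-trans (0≤-resp (solve 2 (λ x y → y :* y := x :* x :+ y :* y :- x :* x) refl x y) (0≤-square y)) ∥∥≤0) ,
    square≤0⇒≈0 (≤-trans (0≤-resp (solve 2 (λ x y → x :* x := x :* x :+ y :* y :- y :* y) refl x y) (0≤-square x)) ∥∥≤0)
    where
    ∥∥≤0 : ∥ x , y ∥² ≤ 0#
    ∥∥≤0 = ≤-stable λ 0<∥∥ → ∥∥≯0 (0<-resp (x-0≈x refl) 0<∥∥)

  -- `maximal` gives `L ≤ ρ`. Conversely, `L * L < ρ * ρ` would make every entry of the attaining
  -- eigenvector vanish; as `nonzero` is only a negation, this direction rests on the stability of
  -- the order.
  radius≈root : ∀ {a i j ρ L w} → (∀ x → 0≤ a x) → IsRadius a (suc i) j ρ → IsPerronVector a (suc i) j L w → ρ ≈ L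
  radius≈root {a} {i} {j} {ρ} {L} 0≤a R W = ≤-antisym
    (square-cancel-≤ (IsPerronVector.0≤root W) (≤-stable λ L²<ρ² →
      nonzero λ x → ∥∥²-pos-unless-zero (eigenvector-vanishes (0<-resp (+-congʳ (sym modulus)) L²<ρ²) x)))
    (square-cancel-≤ 0≤ρ (maximal W))
    where
    open IsRadius R
    open IsComplexEigenvector attained
    open EigenvalueBound a 0≤a i j W z z′ X Y X-below X-above Y-below Y-above X-eigen Y-eigen

  module _ (a : ℕ → Carrier) (i j : ℕ) where

    -- The comparison arguments ask for nonnegative weights at every index, while the given weights
    -- have a known sign only on the path.
    restrict : ℕ → Carrier
    restrict x with i ℕ.≤? x | x ℕ.≤? j
    ... | yes _ | yes _ = a x
    ... | yes _ | no  _ = 0#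
    ... | no  _ | _     = 0#

    restrict-inside : ∀ x → i ℕ.≤ x → x ℕ.≤ j → a x ≈ restrict x
    restrict-inside x i≤x x≤j with i ℕ.≤? x | x ℕ.≤? j
    ... | yes _  | yes _  = refl
    ... | yes _  | no x≰j = ⊥-elim (x≰j x≤j)
    ... | no i≰x | _      = ⊥-elim (i≰x i≤x)

    0≤restrict : (∀ x → i ℕ.≤ x → x ℕ.≤ j → 0< a x) → ∀ x → 0≤ restrict x
    0≤restrict 0<a x with i ℕ.≤? x | x ℕ.≤? j
    ... | yes i≤x | yes x≤j = 0<⇒0≤ (0<a x i≤x x≤j)
    ... | yes _   | no  _   = 0≤0
    ... | no  _   | _       = 0≤0

  radius-inequality : ∀ n (a : ℕ → Carrier) → (∀ x → 1 ℕ.≤ x → x ℕ.≤ suc (suc n) → 0< a x) →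
    ∀ {μ ν α β} →
    IsRadius a 2 (suc (suc n)) μ → IsRadius a 1 (suc (suc (suc n))) ν →
    IsRadius a 1 (suc (suc n)) α → IsRadius a 2 (suc (suc (suc n))) β →
    μ * ν ≤ α * β
  radius-inequality n a 0<a {μ} {ν} {α} {β} Rμ Rν Rα Rβ =
    ≤-resp (sym (*-cong (root≈ 1≤2 1+n≤ U Rμ) (root≈ ℕ.≤-refl ℕ.≤-refl V Rν)))
           (sym (*-cong (root≈ ℕ.≤-refl 1+n≤ P Rα) (root≈ 1≤2 ℕ.≤-refl Q Rβ)))
      (PairInequality.pair-inequality a⁺ 0≤a⁺ (suc (suc n)) (proj₂ (proj₂ U)) (proj₂ (proj₂ V))
         (proj₂ (proj₂ P)) (proj₂ (proj₂ Q)) (ℕ.s≤s (ℕ.s≤s ℕ.z≤n)))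
    where
    a⁺ = restrict a 1 (suc (suc n))
    0≤a⁺ = 0≤restrict a 1 (suc (suc n)) 0<a

    1≤2 : 1 ℕ.≤ 2
    1≤2 = ℕ.n≤1+n 1

    1+n≤ : suc (suc n) ℕ.≤ suc (suc (suc n))
    1+n≤ = ℕ.n≤1+n _

    a≈a⁺ : ∀ {i j} → 1 ℕ.≤ i → j ℕ.≤ suc (suc (suc n)) → ∀ x → i ℕ.≤ x → x ℕ.< j → a x ≈ a⁺ x
    a≈a⁺ 1≤i j≤ x i≤x x<j =
      restrict-inside a 1 (suc (suc n)) x (ℕ.≤-trans 1≤i i≤x) (ℕ.≤-pred (ℕ.≤-trans x<j j≤))

    perron : ∀ i m → suc i ℕ.+ m ℕ.≤ suc (suc (suc n)) → ∃[ L ] ∃[ w ] IsPerronVector a⁺ (suc i) (suc i ℕ.+ m) L w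
    perron i m j≤ = perronVector a⁺ i m λ x i≤x x<j →
      let 1≤x = ℕ.≤-trans (ℕ.s≤s ℕ.z≤n) i≤x
          x≤  = ℕ.≤-pred (ℕ.≤-trans x<j j≤)
      in 0<-resp (restrict-inside a 1 (suc (suc n)) x 1≤x x≤) (0<a x 1≤x x≤)

    -- `perron i m` covers the vertices from `suc i` to `suc i + m`; the path itself has
    -- `suc (suc n)` edges.
    U = perron 1 n 1+n≤
    V = perron 0 (suc (suc n)) ℕ.≤-refl
    P = perron 0 (suc n) 1+n≤
    Q = perron 1 (suc n) ℕ.≤-refl

    root≈ : ∀ {i j ρ} → 1 ℕ.≤ suc i → j ℕ.≤ suc (suc (suc n)) →
            (W : ∃[ L ] ∃[ w ] IsPerronVector a⁺ (suc i) j L w) → IsRadius a (suc i) j ρ → ρ ≈ proj₁ W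
    root≈ 1≤i j≤ (L , w , W) R = radius≈root 0≤a⁺ (radius-resp (a≈a⁺ 1≤i j≤) R) W

-- The real numbers

open import Defs
open import Relation.Binary.PropositionalEquality using (refl)
open +-*-Solver using (solve; con; _:+_; _:*_; :-_; _:-_; _:=_)

-- Inequalities between rationals.

by-ring : ∀ {p q} → p ≡ q → 0ℚ ℚ.≤ p → 0ℚ ℚ.≤ q
by-ring = ≡.subst (0ℚ ℚ.≤_)

diff : ∀ {p q} → p ℚ.≤ q → 0ℚ ℚ.≤ q ℚ.- p
diff {p} {q} p≤q = ≡.subst (ℚ._≤ q ℚ.- p) (ℚ.+-inverseʳ p) (ℚ.+-monoˡ-≤ (ℚ.- p) p≤q)

undiff : ∀ {p q} → 0ℚ ℚ.≤ q ℚ.- p → p ℚ.≤ q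
undiff {p} {q} h = ≡.subst₂ ℚ._≤_ (ℚ.+-identityˡ p)
  (solve 2 (λ p q → q :- p :+ p := q) refl p q) (ℚ.+-monoˡ-≤ p h)

0≤-+ : ∀ {p q} → 0ℚ ℚ.≤ p → 0ℚ ℚ.≤ q → 0ℚ ℚ.≤ p ℚ.+ q
0≤-+ = ℚ.+-mono-≤

0≤-* : ∀ {p q} → 0ℚ ℚ.≤ p → 0ℚ ℚ.≤ q → 0ℚ ℚ.≤ p ℚ.* q
0≤-* {p} {q} 0≤p 0≤q =
  ≡.subst (ℚ._≤ p ℚ.* q) (ℚ.*-zeroʳ p) (ℚ.*-monoˡ-≤-nonNeg p {{ℚ.nonNegative 0≤p}} 0≤q)

0<-* : ∀ {p q} → 0ℚ ℚ.< p → 0ℚ ℚ.< q → 0ℚ ℚ.< p ℚ.* q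
0<-* {p} {q} 0<p 0<q =
  ≡.subst (ℚ._< p ℚ.* q) (ℚ.*-zeroʳ p) (ℚ.*-monoʳ-<-pos p {{ℚ.positive 0<p}} 0<q)

*-cancel-≤ : ∀ {p q} r → 0ℚ ℚ.< r → r ℚ.* p ℚ.≤ r ℚ.* q → p ℚ.≤ q
*-cancel-≤ r 0<r = ℚ.*-cancelˡ-≤-pos r {{ℚ.positive 0<r}}

inverse : ∀ p → 0ℚ ℚ.< p → ∃[ r ] (0ℚ ℚ.< r × p ℚ.* r ≡ 1ℚ)
inverse p 0<p = (ℚ.1/ p) , ℚ.positive⁻¹ (ℚ.1/ p) {{ℚ.1/pos⇒pos p}} , ℚ.*-inverseʳ p
  where
  instance
    p>0 = ℚ.positive 0<p
    p≢0 = ℚ.pos⇒nonZero p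

p≤∣p∣ : ∀ p → p ℚ.≤ ∣ p ∣
p≤∣p∣ p with ℚ.≤-total 0ℚ p
... | inj₁ 0≤p = ℚ.≤-reflexive (≡.sym (ℚ.0≤p⇒∣p∣≡p 0≤p))
... | inj₂ p≤0 = ℚ.≤-trans p≤0 (ℚ.0≤∣p∣ p)

-p≤∣p∣ : ∀ p → ℚ.- p ℚ.≤ ∣ p ∣
-p≤∣p∣ p = ≡.subst (ℚ.- p ℚ.≤_) (ℚ.∣-p∣≡∣p∣ p) (p≤∣p∣ (ℚ.- p))

∣p-q∣≤⇒p≤q+ : ∀ {p q d} → ∣ p ℚ.- q ∣ ℚ.≤ d → p ℚ.≤ q ℚ.+ d
∣p-q∣≤⇒p≤q+ {p} {q} {d} h = undiff (by-ring
  (solve 3 (λ p q d → d :- (p :- q) := q :+ d :- p) refl p q d) (diff (ℚ.≤-trans (p≤∣p∣ (p ℚ.- q)) h)))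

∣p-q∣≤⇒q≤p+ : ∀ {p q d} → ∣ p ℚ.- q ∣ ℚ.≤ d → q ℚ.≤ p ℚ.+ d
∣p-q∣≤⇒q≤p+ {p} {q} {d} h = undiff (by-ring
  (solve 3 (λ p q d → d :- (:- (p :- q)) := p :+ d :- q) refl p q d) (diff (ℚ.≤-trans (-p≤∣p∣ (p ℚ.- q)) h)))

∣p-q∣≤ : ∀ {p q d} → p ℚ.≤ q ℚ.+ d → q ℚ.≤ p ℚ.+ d → ∣ p ℚ.- q ∣ ℚ.≤ d
∣p-q∣≤ {p} {q} {d} p≤q+d q≤p+d with ℚ.∣p∣≡p∨∣p∣≡-p (p ℚ.- q)
... | inj₁ eq = ≡.subst (ℚ._≤ d) (≡.sym eq) (undiff (by-ring
  (solve 3 (λ p q d → q :+ d :- p := d :- (p :- q)) refl p q d) (diff p≤q+d)))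
... | inj₂ eq = ≡.subst (ℚ._≤ d) (≡.sym eq) (undiff (by-ring
  (solve 3 (λ p q d → p :+ d :- q := d :- (:- (p :- q))) refl p q d) (diff q≤p+d)))

halve : ∀ {ε} → 0ℚ ℚ.< ε → ∃[ δ ] (0ℚ ℚ.< δ × δ ℚ.+ δ ≡ ε)
halve {ε} 0<ε = ε ℚ.* ½ , 0<-* 0<ε (ℚ.positive⁻¹ ½) ,
  ≡.trans (≡.sym (ℚ.*-distribˡ-+ ε ½ ½)) (ℚ.*-identityʳ ε)

ev-map : ∀ {P Q : ℕ → Set} → (∀ n → P n → Q n) → Eventually P → Eventually Q
ev-map f (N , h) = N , λ n N≤n → f n (h n N≤n)

ev-map₂ : ∀ {P Q R : ℕ → Set} → (∀ n → P n → Q n → R n) → Eventually P → Eventually Q → Eventually R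
ev-map₂ f (M , g) (N , h) = M ℕ.⊔ N , λ n M⊔N≤n →
  f n (g n (ℕ.m⊔n≤o⇒m≤o M N M⊔N≤n)) (h n (ℕ.m⊔n≤o⇒n≤o M N M⊔N≤n))

ev-witness : ∀ {P : ℕ → Set} → Eventually P → ∃[ n ] P n
ev-witness (N , h) = N , h N ℕ.≤-refl

always : ∀ {P : ℕ → Set} → (∀ n → P n) → Eventually P
always h = 0 , λ n _ → h n

pointwise : ∀ {x y} → (∀ n → seq x n ≡ seq y n) → x ≈ y
pointwise {x} {y} eq ε 0<ε = always λ n → ≡.subst (λ q → ∣ seq x n ℚ.- q ∣ ℚ.≤ ε) (eq n)
  (≡.subst (λ q → ∣ q ∣ ℚ.≤ ε) (≡.sym (ℚ.+-inverseʳ (seq x n))) (ℚ.<⇒≤ 0<ε))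

≈-refl : ∀ {x} → x ≈ x
≈-refl {x} = pointwise {x} {x} λ _ → refl

≈-sym : ∀ {x y} → x ≈ y → y ≈ x
≈-sym {x} {y} x≈y ε 0<ε = ev-map
  (λ n h → ∣p-q∣≤ {seq y n} {seq x n} (∣p-q∣≤⇒q≤p+ {seq x n} h) (∣p-q∣≤⇒p≤q+ {seq x n} h)) (x≈y ε 0<ε)

≈-trans : ∀ {x y z} → x ≈ y → y ≈ z → x ≈ z
≈-trans {x} {y} {z} x≈y y≈z ε 0<ε with halve 0<ε
... | δ , 0<δ , refl = ev-map₂ (λ n h k → close (seq x n) (seq y n) (seq z n) h k) (x≈y δ 0<δ) (y≈z δ 0<δ)
  where
  close : ∀ p q r → ∣ p ℚ.- q ∣ ℚ.≤ δ → ∣ q ℚ.- r ∣ ℚ.≤ δ → ∣ p ℚ.- r ∣ ℚ.≤ δ ℚ.+ δ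
  close p q r h k = ≡.subst (λ d → ∣ d ∣ ℚ.≤ δ ℚ.+ δ)
    (solve 3 (λ p q r → (p :- q) :+ (q :- r) := p :- r) refl p q r)
    (ℚ.≤-trans (ℚ.∣p+q∣≤∣p∣+∣q∣ (p ℚ.- q) (q ℚ.- r)) (ℚ.+-mono-≤ h k))

+-cong : ∀ {x x′ y y′} → x ≈ x′ → y ≈ y′ → x + y ≈ x′ + y′
+-cong {x} {x′} {y} {y′} x≈x′ y≈y′ ε 0<ε with halve 0<ε
... | δ , 0<δ , refl = ev-map₂ (λ n h k → close (seq x n) (seq x′ n) (seq y n) (seq y′ n) h k)
    (x≈x′ δ 0<δ) (y≈y′ δ 0<δ)
  where
  close : ∀ p p′ q q′ → ∣ p ℚ.- p′ ∣ ℚ.≤ δ → ∣ q ℚ.- q′ ∣ ℚ.≤ δ →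
          ∣ (p ℚ.+ q) ℚ.- (p′ ℚ.+ q′) ∣ ℚ.≤ δ ℚ.+ δ
  close p p′ q q′ h k = ≡.subst (λ d → ∣ d ∣ ℚ.≤ δ ℚ.+ δ)
    (solve 4 (λ p p′ q q′ → (p :- p′) :+ (q :- q′) := (p :+ q) :- (p′ :+ q′)) refl p p′ q q′)
    (ℚ.≤-trans (ℚ.∣p+q∣≤∣p∣+∣q∣ (p ℚ.- p′) (q ℚ.- q′)) (ℚ.+-mono-≤ h k))

neg-cong : ∀ {x y} → x ≈ y → - x ≈ - y
neg-cong {x} {y} x≈y ε 0<ε = ev-map
  (λ n → ≡.subst (ℚ._≤ ε) (≡.trans (≡.sym (ℚ.∣-p∣≡∣p∣ (seq x n ℚ.- seq y n)))
    (≡.cong ∣_∣ (solve 2 (λ p q → :- (p :- q) := (:- p) :- (:- q)) refl (seq x n) (seq y n)))))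
  (x≈y ε 0<ε)

bounded : ∀ x → ∃[ B ] (0ℚ ℚ.< B × Eventually (λ n → ∣ seq x n ∣ ℚ.≤ B))
bounded x = cauchy-bounded {seq x} (cauchy x)

*-congʳ : ∀ {x x′} y → x ≈ x′ → x * y ≈ x′ * y
*-congʳ {x} {x′} y x≈x′ ε 0<ε with bounded y
... | B , 0<B , evB with inverse B 0<B
...   | r , 0<r , Br≡1 = ev-map₂ (λ n h k → close (seq x n) (seq x′ n) (seq y n) h k)
    (x≈x′ (r ℚ.* ε) (0<-* 0<r 0<ε)) evB
  where
  rεB≡ε : (r ℚ.* ε) ℚ.* B ≡ ε
  rεB≡ε = ≡.trans (solve 3 (λ r ε B → (r :* ε) :* B := (B :* r) :* ε) refl r ε B)
    (≡.trans (≡.cong (ℚ._* ε) Br≡1) (ℚ.*-identityˡ ε))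
  close : ∀ p p′ q → ∣ p ℚ.- p′ ∣ ℚ.≤ r ℚ.* ε → ∣ q ∣ ℚ.≤ B → ∣ p ℚ.* q ℚ.- p′ ℚ.* q ∣ ℚ.≤ ε
  close p p′ q h k = ≡.subst₂ ℚ._≤_
    (≡.trans (≡.sym (ℚ.∣p*q∣≡∣p∣*∣q∣ (p ℚ.- p′) q))
      (≡.cong ∣_∣ (solve 3 (λ p p′ q → (p :- p′) :* q := p :* q :- p′ :* q) refl p p′ q)))
    rεB≡ε
    (ℚ.≤-trans (ℚ.*-monoʳ-≤-nonNeg ∣ q ∣ {{ℚ.nonNegative (ℚ.0≤∣p∣ q)}} h)
               (ℚ.*-monoˡ-≤-nonNeg (r ℚ.* ε) {{ℚ.nonNegative (ℚ.<⇒≤ (0<-* 0<r 0<ε))}} k))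

*-comm : ∀ x y → x * y ≈ y * x
*-comm x y = pointwise {x * y} {y * x} λ n → ℚ.*-comm (seq x n) (seq y n)

*-cong : ∀ {x x′ y y′} → x ≈ x′ → y ≈ y′ → x * y ≈ x′ * y′
*-cong {x} {x′} {y} {y′} x≈x′ y≈y′ =
  ≈-trans {x * y} {x′ * y} {x′ * y′} (*-congʳ {x} {x′} y x≈x′)
    (≈-trans {x′ * y} {y * x′} {x′ * y′} (*-comm x′ y)
      (≈-trans {y * x′} {y′ * x′} {x′ * y′} (*-congʳ {y} {y′} x′ y≈y′) (*-comm y′ x′)))

fromℚ : ℚ → ℝ
fromℚ q = mkℝ (λ _ → q) (cauchy-const q)

ℝ-commutativeRing : CommutativeRing 0ℓ 0ℓ
ℝ-commutativeRing = record
  { Carrier = ℝ ; _≈_ = _≈_ ; _+_ = _+_ ; _*_ = _*_ ; -_ = -_ ; 0# = 0ℝ ; 1# = fromℚ 1ℚ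
  ; isCommutativeRing = record
    { isRing = record
      { +-isAbelianGroup = record
        { isGroup = record
          { isMonoid = record
            { isSemigroup = record
              { isMagma = record
                { isEquivalence = record
                  { refl  = λ {x} → ≈-refl {x}
                  ; sym   = λ {x} {y} → ≈-sym {x} {y}
                  ; trans = λ {x} {y} {z} → ≈-trans {x} {y} {z} }
                ; ∙-cong = λ {x} {x′} {y} {y′} → +-cong {x} {x′} {y} {y′} }
              ; assoc = λ x y z → pointwise {x + y + z} {x + (y + z)} λ n → ℚ.+-assoc (seq x n) (seq y n) (seq z n) }
            ; identity = (λ x → pointwise {0ℝ + x} {x} λ n → ℚ.+-identityˡ (seq x n))
                       , (λ x → pointwise {x + 0ℝ} {x} λ n → ℚ.+-identityʳ (seq x n)) }
          ; inverse = (λ x → pointwise {(- x) + x} {0ℝ} λ n → ℚ.+-inverseˡ (seq x n))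
                    , (λ x → pointwise {x + (- x)} {0ℝ} λ n → ℚ.+-inverseʳ (seq x n))
          ; ⁻¹-cong = λ {x} {y} → neg-cong {x} {y} }
        ; comm = λ x y → pointwise {x + y} {y + x} λ n → ℚ.+-comm (seq x n) (seq y n) }
      ; *-cong = λ {x} {x′} {y} {y′} → *-cong {x} {x′} {y} {y′}
      ; *-assoc = λ x y z → pointwise {x * y * z} {x * (y * z)} λ n → ℚ.*-assoc (seq x n) (seq y n) (seq z n)
      ; *-identity = (λ x → pointwise {fromℚ 1ℚ * x} {x} λ n → ℚ.*-identityˡ (seq x n))
                   , (λ x → pointwise {x * fromℚ 1ℚ} {x} λ n → ℚ.*-identityʳ (seq x n))
      ; distrib = (λ x y z → pointwise {x * (y + z)} {x * y + x * z} λ n → ℚ.*-distribˡ-+ (seq x n) (seq y n) (seq z n))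
                , (λ x y z → pointwise {(y + z) * x} {y * x + z * x} λ n → ℚ.*-distribʳ-+ (seq x n) (seq y n) (seq z n)) }
    ; *-comm = *-comm } }

-- The order of the Cauchy reals.

nonNeg Pos : ℝ → Set
nonNeg x = 0ℝ ≤ x
Pos x = 0ℝ < x

0+ε≤⇒ : ∀ {p ε} → 0ℚ ℚ.+ ε ℚ.≤ p → ε ℚ.≤ p
0+ε≤⇒ {p} {ε} = ≡.subst (ℚ._≤ p) (ℚ.+-identityˡ ε)

⇒0+ε≤ : ∀ {p ε} → ε ℚ.≤ p → 0ℚ ℚ.+ ε ℚ.≤ p
⇒0+ε≤ {p} {ε} = ≡.subst (ℚ._≤ p) (≡.sym (ℚ.+-identityˡ ε))

nonNeg-resp : ∀ {x y} → x ≈ y → nonNeg x → nonNeg y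
nonNeg-resp {x} {y} x≈y 0≤x ε 0<ε with halve 0<ε
... | δ , 0<δ , refl = ev-map₂ (λ n h k → by-ring
    (solve 3 (λ p q d → (p :+ d) :+ (q :+ d :- p) := q :+ (d :+ d)) refl (seq x n) (seq y n) δ)
    (0≤-+ k (diff (∣p-q∣≤⇒p≤q+ {seq x n} {seq y n} h)))) (x≈y δ 0<δ) (0≤x δ 0<δ)

Pos-resp : ∀ {x y} → x ≈ y → Pos x → Pos y
Pos-resp {x} {y} x≈y (ε , 0<ε , h) with halve 0<ε
... | δ , 0<δ , refl = δ , 0<δ , ev-map₂ (λ n h k → ⇒0+ε≤ (undiff (by-ring
    (solve 3 (λ p q d → (p :- (d :+ d)) :+ (q :+ d :- p) := q :- d) refl (seq x n) (seq y n) δ)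
    (0≤-+ (diff (0+ε≤⇒ k)) (diff (∣p-q∣≤⇒p≤q+ {seq x n} {seq y n} h)))))) (x≈y δ 0<δ) h

nonNeg-+ : ∀ {x y} → nonNeg x → nonNeg y → nonNeg (x + y)
nonNeg-+ {x} {y} 0≤x 0≤y ε 0<ε with halve 0<ε
... | δ , 0<δ , refl = ev-map₂ (λ n h k → by-ring
    (solve 3 (λ p q d → (p :+ d) :+ (q :+ d) := p :+ q :+ (d :+ d)) refl (seq x n) (seq y n) δ)
    (0≤-+ h k)) (0≤x δ 0<δ) (0≤y δ 0<δ)

-- Expanding `(p + δ) * (q + δ) ≥ 0` bounds `p * q` below by `- δ * (p + q + δ)`, and `p + q + δ` is
-- at most `B + C + 1`.
product-bound : ∀ p q δ B C η → 0ℚ ℚ.≤ δ → δ ℚ.≤ 1ℚ → δ ℚ.≤ η → 0ℚ ℚ.≤ B → 0ℚ ℚ.≤ C →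
  0ℚ ℚ.≤ p ℚ.+ δ → 0ℚ ℚ.≤ q ℚ.+ δ → p ℚ.≤ B → q ℚ.≤ C →
  0ℚ ℚ.≤ p ℚ.* q ℚ.+ (B ℚ.+ C ℚ.+ 1ℚ) ℚ.* η
product-bound p q δ B C η 0≤δ δ≤1 δ≤η 0≤B 0≤C hp hq p≤B q≤C = by-ring
  (solve 7 (λ p q d b c o e →
      (p :+ d) :* (q :+ d) :+ d :* ((b :- p) :+ (c :- q) :+ (o :- d)) :+ (b :+ c :+ o) :* (e :- d) :=
      p :* q :+ (b :+ c :+ o) :* e) refl p q δ B C 1ℚ η)
  (0≤-+ (0≤-+ (0≤-* hp hq) (0≤-* 0≤δ (0≤-+ (0≤-+ (diff p≤B) (diff q≤C)) (diff δ≤1))))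
    (0≤-* (0≤-+ (0≤-+ 0≤B 0≤C) (ℚ.nonNegative⁻¹ 1ℚ)) (diff δ≤η)))

minimum : ∀ {p q} → 0ℚ ℚ.< p → 0ℚ ℚ.< q → ∃[ r ] (0ℚ ℚ.< r × r ℚ.≤ p × r ℚ.≤ q)
minimum {p} {q} 0<p 0<q with ℚ.≤-total p q
... | inj₁ p≤q = p , 0<p , ℚ.≤-refl , p≤q
... | inj₂ q≤p = q , 0<q , q≤p , ℚ.≤-refl

nonNeg-* : ∀ {x y} → nonNeg x → nonNeg y → nonNeg (x * y)
nonNeg-* {x} {y} 0≤x 0≤y ε 0<ε =
  let B , 0<B , evB       = bounded x
      C , 0<C , evC       = bounded y
      D                   = B ℚ.+ C ℚ.+ 1ℚ
      r , 0<r , Dr≡1      = inverse D (ℚ.+-mono-< (ℚ.+-mono-< 0<B 0<C) (ℚ.positive⁻¹ 1ℚ))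
      δ , 0<δ , δ≤rε , δ≤1 = minimum (0<-* 0<r 0<ε) (ℚ.positive⁻¹ 1ℚ)
  in ev-map₂ (λ n (h , k) (l , m) → by-ring
       (≡.cong (seq x n ℚ.* seq y n ℚ.+_) (cancel-inverse D r Dr≡1))
       (product-bound (seq x n) (seq y n) δ B C (r ℚ.* ε) (ℚ.<⇒≤ 0<δ) δ≤1 δ≤rε (ℚ.<⇒≤ 0<B) (ℚ.<⇒≤ 0<C)
          h k (ℚ.≤-trans (p≤∣p∣ (seq x n)) l) (ℚ.≤-trans (p≤∣p∣ (seq y n)) m)))
     (ev-map₂ (λ n → _,_) (0≤x δ 0<δ) (0≤y δ 0<δ)) (ev-map₂ (λ n → _,_) evB evC)
  where
  cancel-inverse : ∀ D r → D ℚ.* r ≡ 1ℚ → D ℚ.* (r ℚ.* ε) ≡ ε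
  cancel-inverse D r Dr≡1 =
    ≡.trans (≡.sym (ℚ.*-assoc D r ε)) (≡.trans (≡.cong (ℚ._* ε) Dr≡1) (ℚ.*-identityˡ ε))

Pos-+ : ∀ {x y} → Pos x → nonNeg y → Pos (x + y)
Pos-+ {x} {y} (ε , 0<ε , h) 0≤y with halve 0<ε
... | δ , 0<δ , refl = δ , 0<δ , ev-map₂ (λ n h k → ⇒0+ε≤ (undiff (by-ring
    (solve 3 (λ p q d → (p :- (d :+ d)) :+ (q :+ d) := p :+ q :- d) refl (seq x n) (seq y n) δ)
    (0≤-+ (diff (0+ε≤⇒ h)) k)))) h (0≤y δ 0<δ)

Pos-* : ∀ {x y} → Pos x → Pos y → Pos (x * y)
Pos-* {x} {y} (ε , 0<ε , h) (δ , 0<δ , k) = ε ℚ.* δ , 0<-* 0<ε 0<δ , ev-map₂ (λ n h k → ⇒0+ε≤ (undiff (by-ring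
    (solve 4 (λ p q e d → (p :- e) :* q :+ e :* (q :- d) := p :* q :- e :* d) refl (seq x n) (seq y n) ε δ)
    (0≤-+ (0≤-* (diff (0+ε≤⇒ h)) (ℚ.≤-trans (ℚ.<⇒≤ 0<δ) (0+ε≤⇒ k)))
          (0≤-* (ℚ.<⇒≤ 0<ε) (diff (0+ε≤⇒ k))))))) h k

Pos⇒nonNeg : ∀ {x} → Pos x → nonNeg x
Pos⇒nonNeg {x} (ε , 0<ε , h) δ 0<δ = ev-map
  (λ n h → 0≤-+ (ℚ.≤-trans (ℚ.<⇒≤ 0<ε) (0+ε≤⇒ h)) (ℚ.<⇒≤ 0<δ)) h

-- Positivity is read off a single rational term: later terms lose at most `δ` of the `2δ` present
-- at index `n`. This makes decidable tests on rationals usable for reals.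
Pos-eventually : ∀ x {δ} n → 0ℚ ℚ.< δ → (∀ m k → n ℕ.≤ m → n ℕ.≤ k → ∣ seq x m ℚ.- seq x k ∣ ℚ.≤ δ) →
                 δ ℚ.+ δ ℚ.≤ seq x n → Pos x
Pos-eventually x {δ} n 0<δ close h = δ , 0<δ , n , λ m n≤m → ⇒0+ε≤ (undiff (by-ring
  (solve 3 (λ p q d → (q :- (d :+ d)) :+ (p :+ d :- q) := p :- d) refl (seq x m) (seq x n) δ)
  (0≤-+ (diff h) (diff (∣p-q∣≤⇒p≤q+ {seq x n} {seq x m} (close n m ℕ.≤-refl n≤m))))))

-- With `ε` equal to `4δ`, the two terms at a late index add up to at least `4δ`; the test whether
-- the first is at least `2δ` decides, since otherwise the second is.
Pos-split : ∀ {x y} → Pos (x + y) → Pos x ⊎ Pos y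
Pos-split {x} {y} (ε , 0<ε , K , h) with halve 0<ε
... | ε′ , 0<ε′ , refl with halve 0<ε′
...   | δ , 0<δ , refl with cauchy x δ 0<δ | cauchy y δ 0<δ
...     | M , cx | N , cy = decide (ℚ._≤?_ (δ ℚ.+ δ) (seq x n))
  where
  n = (M ℕ.⊔ N) ℕ.⊔ K
  M≤n = ℕ.≤-trans (ℕ.m≤m⊔n M N) (ℕ.m≤m⊔n (M ℕ.⊔ N) K)
  N≤n = ℕ.≤-trans (ℕ.m≤n⊔m M N) (ℕ.m≤m⊔n (M ℕ.⊔ N) K)
  hn = h n (ℕ.m≤n⊔m (M ℕ.⊔ N) K)
  decide : _ → Pos x ⊎ Pos y
  decide (yes p) = inj₁ (Pos-eventually x n 0<δ
    (λ m k n≤m n≤k → cx m k (ℕ.≤-trans M≤n n≤m) (ℕ.≤-trans M≤n n≤k)) p)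
  decide (no ¬p) = inj₂ (Pos-eventually y n 0<δ
    (λ m k n≤m n≤k → cy m k (ℕ.≤-trans N≤n n≤m) (ℕ.≤-trans N≤n n≤k)) (undiff (by-ring
      (solve 3 (λ p q d → ((d :+ d) :- p) :+ (p :+ q :- (d :+ d :+ (d :+ d))) := q :- (d :+ d)) refl
        (seq x n) (seq y n) δ)
      (0≤-+ (diff (ℚ.<⇒≤ (ℚ.≰⇒> ¬p))) (diff (0+ε≤⇒ hn))))))

Pos-irrefl : ∀ {x} → Pos x → ¬ nonNeg (- x)
Pos-irrefl {x} (ε , 0<ε , h) 0≤-x with halve 0<ε
... | δ , 0<δ , refl with ev-witness (ev-map₂ (λ n → _,_) h (0≤-x δ 0<δ))
...   | n , hn , kn = ℚ.<-irrefl refl (ℚ.<-≤-trans 0<δ (undiff (by-ring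
    (solve 2 (λ p d → (p :- (d :+ d)) :+ (:- p :+ d) := con 0ℚ :- d) refl (seq x n) δ)
    (0≤-+ (diff (0+ε≤⇒ hn)) kn))))

-- A term of `- x` reaching `2δ` at the index `N` would make `- x` positive. Otherwise later terms
-- of `x` are at least `- 3δ`, within the tolerance `4δ`.
nonNeg-stable : ∀ {x} → ¬ Pos (- x) → nonNeg x
nonNeg-stable {x} x≮0 ε 0<ε with halve 0<ε
... | ε′ , 0<ε′ , refl with halve 0<ε′
...   | δ , 0<δ , refl with cauchy (- x) δ 0<δ
...     | N , c with ℚ._≤?_ (δ ℚ.+ δ) (ℚ.- seq x N)
...       | yes p = ⊥-elim (x≮0 (Pos-eventually (- x) N 0<δ c p))
...       | no ¬p = N , λ n N≤n → by-ring
  (solve 3 (λ p q d → ((d :+ d) :- (:- q)) :+ ((:- q :+ d) :- (:- p)) :+ d := p :+ (d :+ d :+ (d :+ d))) refl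
    (seq x n) (seq x N) δ)
  (0≤-+ (0≤-+ (diff (ℚ.<⇒≤ (ℚ.≰⇒> ¬p)))
              (diff (∣p-q∣≤⇒p≤q+ {ℚ.- seq x n} {ℚ.- seq x N} (c n N N≤n ℕ.≤-refl))))
        (ℚ.<⇒≤ 0<δ))

nonNeg-antisym : ∀ {x} → nonNeg x → nonNeg (- x) → x ≈ 0ℝ
nonNeg-antisym {x} 0≤x 0≤-x ε 0<ε = ev-map₂ (λ n h k → ∣p-q∣≤ {seq x n} {0ℚ}
    (undiff (by-ring (solve 2 (λ p e → :- p :+ e := con 0ℚ :+ e :- p) refl (seq x n) ε) k)) h)
  (0≤x ε 0<ε) (0≤-x ε 0<ε)

-- The Archimedean property and bisection.

toℚᵘ-ι : ∀ n → ℚ.toℚᵘ (ι n) ℚᵘ.≃ mkℚᵘ (+ n) 0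
toℚᵘ-ι zero    = ℚᵘ.≃-refl
toℚᵘ-ι (suc n) = ℚᵘ.≃-trans (ℚ.toℚᵘ-homo-+ 1ℚ (ι n)) (ℚᵘ.≃-trans (ℚᵘ.+-congʳ (ℚ.toℚᵘ 1ℚ) (toℚᵘ-ι n))
  (*≡* (≡.cong (λ z → (+ 1 ℤ.+ z) ℤ.* + 1) (ℤ.*-identityʳ (+ n)))))

≤∣∣*suc : ∀ z d → z ℤ.* (+ 1) ℤ.≤ (+ ℤ.∣ z ∣) ℤ.* (+ suc d)
≤∣∣*suc (+ n)      d = ≡.subst₂ ℤ._≤_ (ℤ.pos-* n 1) (ℤ.pos-* n (suc d)) (ℤ.+≤+ (ℕ.*-monoʳ-≤ n (ℕ.s≤s ℕ.z≤n)))
≤∣∣*suc (-[1+ n ]) d = ≡.subst (-[1+ n ] ℤ.* (+ 1) ℤ.≤_) (ℤ.pos-* (suc n) (suc d)) ℤ.-≤+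
p≤ι : ∀ p → ∃[ n ] p ℚ.≤ ι n
p≤ι p@(mkℚ z d _) = ℤ.∣ z ∣ , ℚ.toℚᵘ-cancel-≤ {p} {ι ℤ.∣ z ∣}
  (ℚᵘ.≤-respʳ-≃ {mkℚᵘ z d} (ℚᵘ.≃-sym (toℚᵘ-ι ℤ.∣ z ∣)) (*≤* (≤∣∣*suc z d)))

ι-archimedean : ∀ p {ε} → 0ℚ ℚ.< ε → ∃[ n ] p ℚ.≤ ι n ℚ.* ε
ι-archimedean p {ε} 0<ε =
  let r , _ , εr≡1 = inverse ε 0<ε
      n , pr≤n     = p≤ι (p ℚ.* r)
  in n , ≡.subst (ℚ._≤ ι n ℚ.* ε)
    (≡.trans (solve 3 (λ p r e → (p :* r) :* e := p :* (e :* r)) refl p r ε)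
      (≡.trans (≡.cong (p ℚ.*_) εr≡1) (ℚ.*-identityʳ p)))
    (ℚ.*-monoʳ-≤-nonNeg ε {{ℚ.nonNegative (ℚ.<⇒≤ 0<ε)}} pr≤n)

0≤ι : ∀ n → 0ℚ ℚ.≤ ι n
0≤ι zero    = ℚ.≤-refl
0≤ι (suc n) = 0≤-+ (ℚ.nonNegative⁻¹ 1ℚ) (0≤ι n)

archimedean : ∀ x {y} → Pos y → ∃[ n ] nonNeg (fromℚ (ι n) * y - x)
archimedean x {y} (ε , 0<ε , h) =
  let B , _ , k = bounded x
      n , B≤nε  = ι-archimedean B 0<ε
  in n , λ δ 0<δ → ev-map₂ (λ m h k → scaled (seq x m) (seq y m) B (ι n) δ (0≤ι n) (ℚ.<⇒≤ 0<δ) B≤nε h k) h k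
  where
  scaled : ∀ p q b n d → 0ℚ ℚ.≤ n → 0ℚ ℚ.≤ d → b ℚ.≤ n ℚ.* ε → 0ℚ ℚ.+ ε ℚ.≤ q → ∣ p ∣ ℚ.≤ b →
           0ℚ ℚ.≤ n ℚ.* q ℚ.- p ℚ.+ d
  scaled p q b n d 0≤n 0≤d b≤nε ε≤q p≤b = by-ring
    (solve 6 (λ p q b n e d → (n :* e :- b) :+ (b :- p) :+ n :* (q :- e) :+ d := n :* q :- p :+ d) refl p q b n ε d)
    (0≤-+ (0≤-+ (0≤-+ (diff b≤nε) (diff (ℚ.≤-trans (p≤∣p∣ p) p≤b))) (0≤-* 0≤n (diff (0+ε≤⇒ ε≤q)))) 0≤d)

-- Nested intervals: since the sign at a single point is not decidable, each step
-- compares two interior points and keeps two thirds of the interval.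
module Bisection (Lo Hi : ℚ → Set) (W : ℚ) (0<W : 0ℚ ℚ.< W) (lo₀ : Lo 0ℚ) (hi₀ : Hi W)
  (decide : ∀ x y → 0ℚ ℚ.≤ x → x ℚ.< y → y ℚ.≤ W → Lo x ⊎ Hi y) where

  ⅓ : ℚ
  ⅓ = + 1 ℚ./ 3

  record Bracket (h : ℚ) : Set where
    field
      left  : ℚ
      0≤left : 0ℚ ℚ.≤ left
      right≤ : left ℚ.+ h ℚ.≤ W
      lo    : Lo left
      hi    : Hi (left ℚ.+ h)

  open Bracket

  _⊇_ : ∀ {h h′} → Bracket h → Bracket h′ → Set
  _⊇_ {h} {h′} B B′ = left B ℚ.≤ left B′ × left B′ ℚ.+ h′ ℚ.≤ left B ℚ.+ h

  shrink : ℚ → ℚ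
  shrink h = h ℚ.* (⅓ ℚ.+ ⅓)

  0<⅓ : 0ℚ ℚ.< ⅓
  0<⅓ = ℚ.positive⁻¹ ⅓

  0<shrink : ∀ {h} → 0ℚ ℚ.< h → 0ℚ ℚ.< shrink h
  0<shrink 0<h = 0<-* 0<h (ℚ.positive⁻¹ (⅓ ℚ.+ ⅓))

  shrink-⅓ : ∀ x h → (x ℚ.+ h ℚ.* ⅓) ℚ.+ shrink h ≡ x ℚ.+ h
  shrink-⅓ = solve 2 (λ x h → (x :+ h :* con ⅓) :+ h :* (con ⅓ :+ con ⅓) := x :+ h) refl

  p≤p+q : ∀ p {q} → 0ℚ ℚ.≤ q → p ℚ.≤ p ℚ.+ q
  p≤p+q p {q} 0≤q = undiff (by-ring (solve 2 (λ p q → q := p :+ q :- p) refl p q) 0≤q)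

  p<p+q : ∀ p {q} → 0ℚ ℚ.< q → p ℚ.< p ℚ.+ q
  p<p+q p {q} 0<q = ≡.subst (ℚ._< p ℚ.+ q) (ℚ.+-identityʳ p) (ℚ.+-monoʳ-< p 0<q)

  next : ∀ {h} → 0ℚ ℚ.< h → (B : Bracket h) → ∃[ B′ ] _⊇_ {h} {shrink h} B B′
  next {h} 0<h B = [ take-right , take-left ]′
    (decide x y (ℚ.≤-trans (0≤left B) (p≤p+q (left B) 0≤h⅓))
      (≡.subst (x ℚ.<_) (solve 3 (λ l h t → l :+ h :* t :+ h :* t := l :+ h :* (t :+ t)) refl (left B) h ⅓)
        (p<p+q x (0<-* 0<h 0<⅓)))
      (ℚ.≤-trans y≤right (right≤ B)))
    where
    x = left B ℚ.+ h ℚ.* ⅓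
    y = left B ℚ.+ shrink h
    0≤h⅓ = ℚ.<⇒≤ (0<-* 0<h 0<⅓)
    y≤right : y ℚ.≤ left B ℚ.+ h
    y≤right = undiff (by-ring
      (solve 2 (λ l h → h :* con ⅓ := l :+ h :- (l :+ h :* (con ⅓ :+ con ⅓))) refl (left B) h) 0≤h⅓)

    take-right : Lo x → ∃[ B′ ] _⊇_ {h} {shrink h} B B′
    take-right lox = record
      { left = x ; 0≤left = ℚ.≤-trans (0≤left B) (p≤p+q (left B) 0≤h⅓)
      ; right≤ = ≡.subst (ℚ._≤ W) (≡.sym (shrink-⅓ (left B) h)) (right≤ B)
      ; lo = lox ; hi = ≡.subst Hi (≡.sym (shrink-⅓ (left B) h)) (hi B) } ,
      p≤p+q (left B) 0≤h⅓ , ℚ.≤-reflexive (shrink-⅓ (left B) h)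

    take-left : Hi y → ∃[ B′ ] _⊇_ {h} {shrink h} B B′
    take-left hiy = record
      { left = left B ; 0≤left = 0≤left B ; right≤ = ℚ.≤-trans y≤right (right≤ B) ; lo = lo B ; hi = hiy } ,
      ℚ.≤-refl , y≤right

  width : ℕ → ℚ
  width zero    = W
  width (suc k) = shrink (width k)

  0<width : ∀ k → 0ℚ ℚ.< width k
  0<width zero    = 0<W
  0<width (suc k) = 0<shrink (0<width k)

  bracket : ∀ k → Bracket (width k)
  bracket zero    = record
    { left = 0ℚ ; 0≤left = ℚ.≤-refl ; right≤ = ℚ.≤-reflexive (ℚ.+-identityˡ W)
    ; lo = lo₀ ; hi = ≡.subst Hi (≡.sym (ℚ.+-identityˡ W)) hi₀ }
  bracket (suc k) = proj₁ (next (0<width k) (bracket k))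

  nested : ∀ {m n} → m ℕ.≤′ n → bracket m ⊇ bracket n
  nested ℕ.≤′-refl         = ℚ.≤-refl , ℚ.≤-refl
  nested (ℕ.≤′-step {n} m≤n) =
    let l , r   = nested m≤n
        l′ , r′ = proj₂ (next (0<width n) (bracket n))
    in ℚ.≤-trans l l′ , ℚ.≤-trans r′ r

  -- Linear decay of the geometric widths is all that is needed. The offset two makes the induction
  -- close: 2(k + 3) ≤ 3(k + 2) for every k, with equality at k = 0.
  width-bound : ∀ k → width k ℚ.* ι (suc (suc k)) ℚ.≤ W ℚ.+ W
  width-bound zero    = ℚ.≤-reflexive (solve 1 (λ w → w :* (con 1ℚ :+ (con 1ℚ :+ con 0ℚ)) := w :+ w) refl W)
  width-bound (suc k) = ℚ.≤-trans (undiff (by-ring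
    (solve 2 (λ h n → h :* con ⅓ :* n := h :* (con 1ℚ :+ (con 1ℚ :+ n)) :- h :* (con ⅓ :+ con ⅓) :* (con 1ℚ :+ (con 1ℚ :+ (con 1ℚ :+ n))))
       refl (width k) (ι k))
    (0≤-* (ℚ.<⇒≤ (0<-* (0<width k) 0<⅓)) (0≤ι k)))) (width-bound k)

  ι-pos : ∀ n → 0ℚ ℚ.< ι (suc n)
  ι-pos n = ℚ.+-mono-<-≤ (ℚ.positive⁻¹ 1ℚ) (0≤ι n)

  width-small : ∀ q → 0ℚ ℚ.≤ q → ∃[ M ] q ℚ.* width M ℚ.≤ 1ℚ
  width-small q 0≤q =
    let M , 2Wq≤M = p≤ι ((W ℚ.+ W) ℚ.* q)
    in M , *-cancel-≤ (ι (suc (suc M))) (ι-pos (suc M)) (small q (ι M) (width M) 0≤q (width-bound M) 2Wq≤M)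
    where
    small : ∀ q i w → 0ℚ ℚ.≤ q → w ℚ.* (1ℚ ℚ.+ (1ℚ ℚ.+ i)) ℚ.≤ W ℚ.+ W → (W ℚ.+ W) ℚ.* q ℚ.≤ i →
            (1ℚ ℚ.+ (1ℚ ℚ.+ i)) ℚ.* (q ℚ.* w) ℚ.≤ (1ℚ ℚ.+ (1ℚ ℚ.+ i)) ℚ.* 1ℚ
    small q i w 0≤q h k = undiff (by-ring
      (solve 4 (λ q i w v → q :* (v :- w :* (con 1ℚ :+ (con 1ℚ :+ i))) :+ (i :- v :* q) :+ (con 1ℚ :+ con 1ℚ) :=
         (con 1ℚ :+ (con 1ℚ :+ i)) :* con 1ℚ :- (con 1ℚ :+ (con 1ℚ :+ i)) :* (q :* w)) refl q i w (W ℚ.+ W))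
      (0≤-+ (0≤-+ (0≤-* 0≤q (diff h)) (diff k)) (ℚ.nonNegative⁻¹ (1ℚ ℚ.+ 1ℚ))))

  approach : ℕ → ℚ
  approach k = left (bracket k)

  approach-upper : ∀ {m n} → m ℕ.≤ n → approach n ℚ.≤ approach m ℚ.+ width m
  approach-upper {m} {n} m≤n =
    ℚ.≤-trans (p≤p+q (approach n) (ℚ.<⇒≤ (0<width n))) (proj₂ (nested (ℕ.≤⇒≤′ m≤n)))

  approach-lower : ∀ {m n} → m ℕ.≤ n → approach m ℚ.≤ approach n
  approach-lower m≤n = proj₁ (nested (ℕ.≤⇒≤′ m≤n))

  approach-cauchy : Cauchy approach
  approach-cauchy ε 0<ε =
    let r , 0<r , εr≡1 = inverse ε 0<ε
        M , rw≤1       = width-small r (ℚ.<⇒≤ 0<r)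
        w≤ε            = *-cancel-≤ r 0<r (≡.subst (r ℚ.* width M ℚ.≤_) (≡.trans (≡.sym εr≡1) (ℚ.*-comm ε r)) rw≤1)
        close          = λ m n M≤m M≤n → ℚ.≤-trans (approach-upper {M} {m} M≤m)
                           (ℚ.+-mono-≤ (approach-lower {M} {n} M≤n) w≤ε)
    in M , λ m n M≤m M≤n → ∣p-q∣≤ {approach m} {approach n} (close m n M≤m M≤n) (close n m M≤n M≤m)

  limit : ℝ
  limit = mkℝ approach approach-cauchy

  0≤⇒0≤+ : ∀ {p ε} → 0ℚ ℚ.≤ p → 0ℚ ℚ.< ε → 0ℚ ℚ.≤ p ℚ.+ ε
  0≤⇒0≤+ 0≤p 0<ε = 0≤-+ 0≤p (ℚ.<⇒≤ 0<ε)

  bisect : ∃[ r ] (nonNeg r × nonNeg (fromℚ W - r) ×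
    (∀ n → ∃[ x ] ∃[ y ] (Lo x × Hi y × 0ℚ ℚ.≤ x × y ℚ.≤ W ×
       nonNeg (r - fromℚ x) × nonNeg (fromℚ y - r) × ι n ℚ.* (y ℚ.- x) ℚ.≤ 1ℚ)))
  bisect = limit ,
    (λ ε 0<ε → always λ n → 0≤⇒0≤+ (0≤left (bracket n)) 0<ε) ,
    (λ ε 0<ε → always λ n → 0≤⇒0≤+ (diff (ℚ.≤-trans (p≤p+q (approach n) (ℚ.<⇒≤ (0<width n))) (right≤ (bracket n)))) 0<ε) ,
    λ n → let M , nw≤1 = width-small (ι n) (0≤ι n)
              B        = bracket M
      in left B , left B ℚ.+ width M , lo B , hi B , 0≤left B , right≤ B ,
         (λ ε 0<ε → M , λ k M≤k → 0≤⇒0≤+ (diff (approach-lower M≤k)) 0<ε) ,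
         (λ ε 0<ε → M , λ k M≤k → 0≤⇒0≤+ (diff (approach-upper M≤k)) 0<ε) ,
         ≡.subst (λ w → ι n ℚ.* w ℚ.≤ 1ℚ) (solve 2 (λ l w → w := (l :+ w) :- l) refl (left B) (width M)) nw≤1

bisection : ∀ (Lo Hi : ℚ → Set) k → Lo 0ℚ → Hi (ι k) →
  (∀ x y → 0ℚ ℚ.≤ x → x ℚ.< y → y ℚ.≤ ι k → Lo x ⊎ Hi y) →
  ∃[ r ] (nonNeg r × nonNeg (fromℚ (ι k) - r) ×
    (∀ n → ∃[ x ] ∃[ y ] (Lo x × Hi y × 0ℚ ℚ.≤ x × y ℚ.≤ ι k ×
       nonNeg (r - fromℚ x) × nonNeg (fromℚ y - r) × ι n ℚ.* (y ℚ.- x) ℚ.≤ 1ℚ)))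
-- `Bisection` requires a positive width; the degenerate interval is its own limit point.
bisection Lo Hi zero    lo hi decide = 0ℝ , 0≤0 , 0≤0 , λ n →
  0ℚ , 0ℚ , lo , hi , ℚ.≤-refl , ℚ.≤-refl , 0≤0 , 0≤0 ,
  ≡.subst (ℚ._≤ 1ℚ) (≡.sym (ℚ.*-zeroʳ (ι n))) (ℚ.nonNegative⁻¹ 1ℚ)
  where
  0≤0 : nonNeg 0ℝ
  0≤0 ε 0<ε = always λ n → ℚ.≤-trans (ℚ.<⇒≤ 0<ε) (ℚ.≤-reflexive (≡.sym (ℚ.+-identityˡ ε)))
bisection Lo Hi (suc k) lo hi decide = Bisection.bisect Lo Hi (ι (suc k))
  (ℚ.+-mono-<-≤ (ℚ.positive⁻¹ 1ℚ) (0≤ι k)) lo hi decide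

ℝ-completeOrderedRing : CompleteOrderedRing
ℝ-completeOrderedRing = record
  { commutativeRing = ℝ-commutativeRing
  ; 0≤_ = nonNeg
  ; 0<_ = Pos
  ; 0≤-resp = λ {x} {y} → nonNeg-resp {x} {y}
  ; 0<-resp = λ {x} {y} → Pos-resp {x} {y}
  ; 0≤-+ = λ {x} {y} → nonNeg-+ {x} {y}
  ; 0≤-* = λ {x} {y} → nonNeg-* {x} {y}
  ; 0<-+ = λ {x} {y} → Pos-+ {x} {y}
  ; 0<-* = λ {x} {y} → Pos-* {x} {y}
  ; 0<⇒0≤ = λ {x} → Pos⇒nonNeg {x}
  ; 0<-split = λ {x} {y} → Pos-split {x} {y}
  ; 0<-irrefl = λ {x} → Pos-irrefl {x}
  ; 0≤-stable = λ {x} → nonNeg-stable {x}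
  ; 0≤-antisym = λ {x} → nonNeg-antisym {x}
  ; fromℚ = fromℚ
  ; fromℚ-+ = λ p q → pointwise {fromℚ (p ℚ.+ q)} {fromℚ p + fromℚ q} λ _ → refl
  ; fromℚ-* = λ p q → pointwise {fromℚ (p ℚ.* q)} {fromℚ p * fromℚ q} λ _ → refl
  ; fromℚ-- = λ p → pointwise {fromℚ (ℚ.- p)} {(- fromℚ p)} λ _ → refl
  ; fromℚ-0 = ≈-refl {0ℝ}
  ; fromℚ-1 = ≈-refl {fromℚ 1ℚ}
  ; fromℚ-0≤ = λ 0≤p ε 0<ε → always λ _ → 0≤-+ 0≤p (ℚ.<⇒≤ 0<ε)
  ; fromℚ-0< = λ {p} 0<p → p , 0<p , always λ _ → ⇒0+ε≤ ℚ.≤-refl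
  ; archimedean = λ x {y} → archimedean x {y}
  ; bisection = bisection
  }

open OrderedRingTheory ℝ-completeOrderedRing
  using (0≮0; IsPerronVector; shiftBy; shiftBy-+; shiftBy-<; IsComplexEigenvector; IsRadius; radius-inequality)

-- The matrices of the statement

sumℚ : ∀ {d} → (Fin d → ℚ) → ℚ
sumℚ = foldr ℚ._+_ 0ℚ

sumℚ-zero : ∀ {d} (f : Fin d → ℚ) → (∀ l → f l ≡ 0ℚ) → sumℚ f ≡ 0ℚ
sumℚ-zero {zero}  f f≡0 = refl
sumℚ-zero {suc d} f f≡0 = ≡.cong₂ ℚ._+_ (f≡0 zero) (sumℚ-zero (f ∘ suc) (f≡0 ∘ suc))

sumℚ-cong : ∀ {d} (f g : Fin d → ℚ) → (∀ l → f l ≡ g l) → sumℚ f ≡ sumℚ g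
sumℚ-cong {zero}  f g f≡g = refl
sumℚ-cong {suc d} f g f≡g = ≡.cong₂ ℚ._+_ (f≡g zero) (sumℚ-cong (f ∘ suc) (g ∘ suc) (f≡g ∘ suc))

-- Real weights act separately on real and imaginary parts. Working at a fixed index makes this an
-- equality of rationals instead of an equality up to `≈`.
re-· : ∀ {d} (g : Fin d → ℝ) (v : Vector ℂ d) n →
  seq (re (foldr _+ᶜ_ 0ℂ (λ l → fromℝ (g l) *ᶜ v l))) n ≡ sumℚ (λ l → seq (g l) n ℚ.* seq (re (v l)) n)
re-· {zero}  g v n = refl
re-· {suc d} g v n = ≡.cong₂ ℚ._+_
  (solve 3 (λ p x y → p :* x :- con 0ℚ :* y := p :* x) refl (seq (g zero) n) (seq (re (v zero)) n) (seq (im (v zero)) n))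
  (re-· (g ∘ suc) (v ∘ suc) n)

im-· : ∀ {d} (g : Fin d → ℝ) (v : Vector ℂ d) n →
  seq (im (foldr _+ᶜ_ 0ℂ (λ l → fromℝ (g l) *ᶜ v l))) n ≡ sumℚ (λ l → seq (g l) n ℚ.* seq (im (v l)) n)
im-· {zero}  g v n = refl
im-· {suc d} g v n = ≡.cong₂ ℚ._+_
  (solve 3 (λ p x y → p :* y :+ con 0ℚ :* x := p :* y) refl (seq (g zero) n) (seq (re (v zero)) n) (seq (im (v zero)) n))
  (im-· (g ∘ suc) (v ∘ suc) n)

extend : ∀ {A : Set} → A → ∀ {d} → (Fin d → A) → ℕ → A
extend e {zero}  f k       = e
extend e {suc d} f zero    = f zero
extend e {suc d} f (suc k) = extend e (f ∘ suc) k

extend-toℕ : ∀ {A : Set} (e : A) {d} (f : Fin d → A) k → extend e f (toℕ k) ≡ f k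
extend-toℕ e f zero    = refl
extend-toℕ e f (suc k) = extend-toℕ e (f ∘ suc) k

extend-≥ : ∀ {A : Set} (e : A) {d} (f : Fin d → A) {k} → d ℕ.≤ k → extend e f k ≡ e
extend-≥ e {zero}  f d≤k           = refl
extend-≥ e {suc d} f (ℕ.s≤s d≤k) = extend-≥ e (f ∘ suc) d≤k

extend-map : ∀ {A B : Set} (h : A → B) (e : A) {d} (f : Fin d → A) k → h (extend e f k) ≡ extend (h e) (h ∘ f) k
extend-map h e {zero}  f k       = refl
extend-map h e {suc d} f zero    = refl
extend-map h e {suc d} f (suc k) = extend-map h e (f ∘ suc) k

pathAdjacency-shift : ∀ a s k l → pathAdjacency a (s ℕ.+ k) (s ℕ.+ l) ≡ pathAdjacency (λ u → a (s ℕ.+ u)) k l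
pathAdjacency-shift a zero    k l = refl
pathAdjacency-shift a (suc s) k l = pathAdjacency-shift (a ∘ suc) s k l

module _ (n : ℕ) where

  -- Here `n` is a position in the Cauchy sequences. The first row has no left neighbour, hence the
  -- zero.
  previous : (ℕ → ℝ) → (ℕ → ℚ) → ℕ → ℚ
  previous c f zero    = 0ℚ
  previous c f (suc k) = seq (c k) n ℚ.* f k

  rowSum : (ℕ → ℝ) → ℕ → ∀ {d} → (Fin d → ℚ) → ℚ
  rowSum c k f = sumℚ (λ l → seq (pathAdjacency c k (toℕ l)) n ℚ.* f l)

  row₀-tail : ∀ c {d} (f : Fin d → ℚ) →
    sumℚ (λ l → seq (pathAdjacency c 0 (suc (toℕ l))) n ℚ.* f l) ≡ seq (c 0) n ℚ.* extend 0ℚ f 0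
  row₀-tail c {zero}  f = ≡.sym (ℚ.*-zeroʳ (seq (c 0) n))
  row₀-tail c {suc d} f = ≡.trans
    (≡.cong (seq (c 0) n ℚ.* f zero ℚ.+_)
      (sumℚ-zero (λ l → seq (pathAdjacency c 0 (suc (suc (toℕ l)))) n ℚ.* f (suc l)) (λ l → ℚ.*-zeroˡ (f (suc l)))))
    (ℚ.+-identityʳ _)

  rowSum-≡ : ∀ c k {d} (f : Fin d → ℚ) →
    rowSum c k f ≡ previous c (extend 0ℚ f) k ℚ.+ seq (c k) n ℚ.* extend 0ℚ f (suc k)
  rowSum-≡ c zero    {zero}  f = solve 1 (λ p → con 0ℚ := con 0ℚ :+ p :* con 0ℚ) refl (seq (c 0) n)
  rowSum-≡ c (suc k) {zero}  f =
    solve 2 (λ p q → con 0ℚ := p :* con 0ℚ :+ q :* con 0ℚ) refl (seq (c k) n) (seq (c (suc k)) n)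
  rowSum-≡ c zero    {suc d} f = ≡.cong₂ ℚ._+_ (ℚ.*-zeroˡ (f zero)) (row₀-tail c (f ∘ suc))
  rowSum-≡ c (suc zero) {suc d} f = ≡.cong (seq (c 0) n ℚ.* f zero ℚ.+_)
    (≡.trans (rowSum-≡ (c ∘ suc) 0 (f ∘ suc)) (ℚ.+-identityˡ _))
  rowSum-≡ c (suc (suc k)) {suc d} f = ≡.trans (≡.cong₂ ℚ._+_ (ℚ.*-zeroˡ (f zero)) (rowSum-≡ (c ∘ suc) (suc k) (f ∘ suc)))
    (ℚ.+-identityˡ _)

-- Interval matrices as path operators on zero-extended vectors.

module PathInterval (a : ℕ → ℝ) (i m : ℕ) where

  A : Matrix (suc m)
  A k l = pathAdjacency a (suc i ℕ.+ toℕ k) (suc i ℕ.+ toℕ l)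

  global : (Fin (suc m) → ℝ) → ℕ → ℝ
  global f = shiftBy (suc i) (extend 0ℝ f)

  global-+ : ∀ f k → global f (suc i ℕ.+ k) ≡ extend 0ℝ f k
  global-+ f = shiftBy-+ (suc i) (extend 0ℝ f)

  global-below : ∀ f x → x ℕ.< suc i → global f x ≡ 0ℝ
  global-below f x = shiftBy-< (suc i) (extend 0ℝ f)

  global-above : ∀ f x → suc i ℕ.+ m ℕ.< x → global f x ≡ 0ℝ
  global-above f x i+m<x with ℕ.m≤n⇒∃[o]m+o≡n (ℕ.≤-trans (ℕ.s≤s (ℕ.m≤m+n i m)) (ℕ.<⇒≤ i+m<x))
  ... | k , refl = ≡.trans (global-+ f k) (extend-≥ 0ℝ f (ℕ.+-cancelˡ-< (suc i) m k i+m<x))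

  neighbourSum : (ℕ → ℝ) → ℕ → ℝ
  neighbourSum f x = a x * f x + a (suc x) * f (suc (suc x))

  row : ∀ (f : Fin (suc m) → ℝ) (k : Fin (suc m)) n →
    sumℚ (λ l → seq (A k l) n ℚ.* seq (f l) n) ≡
    seq (neighbourSum (global f) (i ℕ.+ toℕ k)) n
  row f k n = ≡.trans
    (sumℚ-cong (λ l → seq (A k l) n ℚ.* F l) (λ l → seq (pathAdjacency c (toℕ k) (toℕ l)) n ℚ.* F l)
      λ l → ≡.cong (λ r → seq r n ℚ.* F l) (pathAdjacency-shift a (suc i) (toℕ k) (toℕ l)))
    (≡.trans (rowSum-≡ n c (toℕ k) F) (≡.cong₂ ℚ._+_ (prev (toℕ k)) (≡.cong (seq (c (toℕ k)) n ℚ.*_) (next (toℕ k)))))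
    where
    c : ℕ → ℝ
    c u = a (suc i ℕ.+ u)
    F : Fin (suc m) → ℚ
    F l = seq (f l) n

    F-global : ∀ k → extend 0ℚ F k ≡ seq (global f (suc i ℕ.+ k)) n
    F-global k = ≡.trans (≡.sym (extend-map (λ x → seq x n) 0ℝ f k)) (≡.cong (λ x → seq x n) (≡.sym (global-+ f k)))

    next : ∀ k → extend 0ℚ F (suc k) ≡ seq (global f (suc (suc (i ℕ.+ k)))) n
    next k = ≡.trans (F-global (suc k)) (≡.cong (λ x → seq (global f (suc x)) n) (ℕ.+-suc i k))

    prev : ∀ k → previous n c (extend 0ℚ F) k ≡ seq (a (i ℕ.+ k) * global f (i ℕ.+ k)) n
    prev zero    = ≡.sym (≡.trans (≡.cong (λ x → seq (a (i ℕ.+ 0)) n ℚ.* seq x n)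
      (global-below f (i ℕ.+ 0) (ℕ.s≤s (ℕ.≤-reflexive (ℕ.+-identityʳ i))))) (ℚ.*-zeroʳ (seq (a (i ℕ.+ 0)) n)))
    prev (suc k) = ≡.trans (≡.cong (seq (c k) n ℚ.*_) (F-global k))
      (≡.cong (λ x → seq (a x) n ℚ.* seq (global f x) n) (≡.sym (ℕ.+-suc i k)))

  re-row : ∀ (v : Vector ℂ (suc m)) k → neighbourSum (global (re ∘ v)) (i ℕ.+ toℕ k) ≈ re ((A · v) k)
  re-row v k = pointwise {neighbourSum (global (re ∘ v)) (i ℕ.+ toℕ k)} { re ((A · v) k)} λ n → ≡.sym (≡.trans (re-· (A k) v n) (row (re ∘ v) k n))

  im-row : ∀ (v : Vector ℂ (suc m)) k → neighbourSum (global (im ∘ v)) (i ℕ.+ toℕ k) ≈ im ((A · v) k)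
  im-row v k = pointwise {neighbourSum (global (im ∘ v)) (i ℕ.+ toℕ k)} { im ((A · v) k)} λ n → ≡.sym (≡.trans (im-· (A k) v n) (row (im ∘ v) k n))

  global-toℕ : ∀ f (k : Fin (suc m)) → global f (suc (i ℕ.+ toℕ k)) ≡ f k
  global-toℕ f k = ≡.trans (global-+ f (toℕ k)) (extend-toℕ 0ℝ f k)

  vertex : ∀ {x} → suc i ℕ.≤ suc x → suc x ℕ.≤ suc i ℕ.+ m → ∃[ k ] i ℕ.+ toℕ {suc m} k ≡ x
  vertex {x} (ℕ.s≤s i≤x) (ℕ.s≤s x≤) with ℕ.m≤n⇒∃[o]m+o≡n i≤x
  ... | k , refl = fromℕ< (ℕ.s≤s (ℕ.+-cancelˡ-≤ i k m x≤)) , ≡.cong (i ℕ.+_) (Fin.toℕ-fromℕ< _)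

  ≡⇒≈ : ∀ {x y} → x ≡ y → x ≈ y
  ≡⇒≈ {x} refl = ≈-refl {x}

  complexEigenvector : ∀ {z v} → ¬ (∀ k → v k ≈ᶜ 0ℂ) → (∀ k → (A · v) k ≈ᶜ z *ᶜ v k) →
    IsComplexEigenvector a (suc i) (suc i ℕ.+ m) (re z) (im z) (global (re ∘ v)) (global (im ∘ v))
  complexEigenvector {z} {v} v≉0 Av≈zv = record
    { X-below = λ x x< → ≡⇒≈ (global-below (re ∘ v) x x<)
    ; X-above = λ x x> → ≡⇒≈ (global-above (re ∘ v) x x>)
    ; Y-below = λ x x< → ≡⇒≈ (global-below (im ∘ v) x x<)
    ; Y-above = λ x x> → ≡⇒≈ (global-above (im ∘ v) x x>)
    ; X-eigen = X-eigen
    ; Y-eigen = Y-eigen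
    ; nonzero = λ XY≈0 → v≉0 λ k →
        ≡.subst (_≈ 0ℝ) (global-toℕ (re ∘ v) k) (proj₁ (XY≈0 (suc (i ℕ.+ toℕ k)))) ,
        ≡.subst (_≈ 0ℝ) (global-toℕ (im ∘ v) k) (proj₂ (XY≈0 (suc (i ℕ.+ toℕ k))))
    }
    where
    X = global (re ∘ v)
    Y = global (im ∘ v)
    X-eigen : ∀ x → suc i ℕ.≤ suc x → suc x ℕ.≤ suc i ℕ.+ m →
      neighbourSum X x ≈ re z * X (suc x) - im z * Y (suc x)
    X-eigen x i≤ x≤ with vertex i≤ x≤
    ... | k , refl rewrite global-toℕ (re ∘ v) k | global-toℕ (im ∘ v) k =
      ≈-trans {neighbourSum X (i ℕ.+ toℕ k)}
        {re ((A · v) k)} {re (z *ᶜ v k)} (re-row v k) (proj₁ (Av≈zv k))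
    Y-eigen : ∀ x → suc i ℕ.≤ suc x → suc x ℕ.≤ suc i ℕ.+ m →
      neighbourSum Y x ≈ re z * Y (suc x) + im z * X (suc x)
    Y-eigen x i≤ x≤ with vertex i≤ x≤
    ... | k , refl rewrite global-toℕ (re ∘ v) k | global-toℕ (im ∘ v) k =
      ≈-trans {neighbourSum Y (i ℕ.+ toℕ k)}
        {im ((A · v) k)} {im (z *ᶜ v k)} (im-row v k) (proj₂ (Av≈zv k))

  module _ {L : ℝ} {w : ℕ → ℝ} (W : IsPerronVector a (suc i) (suc i ℕ.+ m) L w) where
    open IsPerronVector W

    perronComplex : Vector ℂ (suc m)
    perronComplex k = fromℝ (w (suc i ℕ.+ toℕ k))

    global-perron : ∀ x → global (re ∘ perronComplex) x ≈ w x
    global-perron x with x ℕ.≤? i | x ℕ.≤? suc i ℕ.+ m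
    ... | yes x≤i | _      = ≡.subst (_≈ w x) (≡.sym (global-below (re ∘ perronComplex) x (ℕ.s≤s x≤i)))
      (≈-sym {w x} {0ℝ} (below x (ℕ.s≤s x≤i)))
    ... | no  _   | no x≰j = ≡.subst (_≈ w x) (≡.sym (global-above (re ∘ perronComplex) x (ℕ.≰⇒> x≰j)))
      (≈-sym {w x} {0ℝ} (above x (ℕ.≰⇒> x≰j)))
    ... | no  x≰i | yes x≤j with x | ℕ.≰⇒> x≰i
    ...   | suc x′ | i<x with vertex i<x x≤j
    ...     | k , refl = ≡⇒≈ (global-toℕ (re ∘ perronComplex) k)

    perron-row : ∀ k → re ((A · perronComplex) k) ≈ L * w (suc (i ℕ.+ toℕ k))
    perron-row k = ≈-trans {re ((A · perronComplex) k)} {neighbourSum X x} {L * w (suc x)}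
      (≈-sym {neighbourSum X x} {re ((A · perronComplex) k)} (re-row perronComplex k))
      (≈-trans {neighbourSum X x} {neighbourSum w x} {L * w (suc x)}
        (+-cong {a x * X x} {a x * w x} {a (suc x) * X (suc (suc x))} {a (suc x) * w (suc (suc x))}
          (*-cong {a x} {a x} {X x} {w x} (≈-refl {a x}) (global-perron x))
          (*-cong {a (suc x)} {a (suc x)} {X (suc (suc x))} {w (suc (suc x))}
            (≈-refl {a (suc x)}) (global-perron (suc (suc x)))))
        (≈-sym {L * w (suc x)} {neighbourSum w x}
          (eigen x (ℕ.s≤s (ℕ.m≤m+n i (toℕ k))) (ℕ.s≤s (ℕ.+-monoʳ-≤ i (Fin.toℕ≤pred[n] k))))))
      where
      x = i ℕ.+ toℕ k
      X = global (re ∘ perronComplex)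

    perron-eigenvalue : IsEigenvalue A (fromℝ L)
    perron-eigenvalue = perronComplex ,
      (λ v≈0 → 0≮0 {w (suc i ℕ.+ 0)} (proj₁ (v≈0 zero))
         (positive (suc i ℕ.+ 0) (ℕ.m≤m+n (suc i) 0) (ℕ.+-monoʳ-≤ (suc i) ℕ.z≤n))) ,
      λ k → ≈-trans {re ((A · perronComplex) k)} {L * w (suc (i ℕ.+ toℕ k))} {re (fromℝ L *ᶜ perronComplex k)}
          (perron-row k)
          (pointwise {L * w (suc (i ℕ.+ toℕ k))} {re (fromℝ L *ᶜ perronComplex k)} λ n →
            solve 2 (λ L x → L :* x := L :* x :- con 0ℚ :* con 0ℚ) refl (seq L n) (seq (w (suc (i ℕ.+ toℕ k))) n)) ,
        pointwise {im ((A · perronComplex) k)} {im (fromℝ L *ᶜ perronComplex k)} λ n →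
          ≡.trans (im-· (A k) perronComplex n)
            (≡.trans (sumℚ-zero (λ l → seq (A k l) n ℚ.* 0ℚ) (λ l → ℚ.*-zeroʳ (seq (A k l) n)))
              (solve 2 (λ L x → con 0ℚ := L :* con 0ℚ :+ con 0ℚ :* x) refl (seq L n) (seq (w (suc (i ℕ.+ toℕ k))) n)))

  isRadius : ∀ {ρ} → IsSpectralRadius A ρ → IsRadius a (suc i) (suc i ℕ.+ m) ρ
  isRadius {ρ} R = let z , (v , v≉0 , Av≈zv) , ∣z∣²≈ρ² = IsSpectralRadius.attained R in record
    { 0≤ρ      = IsSpectralRadius.nonNegative R
    ; attained = complexEigenvector {z} {v} v≉0 Av≈zv
    ; modulus  = ∣z∣²≈ρ²
    ; maximal  = λ {L} {w} W ε 0<ε → ev-map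
        (λ n h → by-ring
          (solve 3 (λ r l e → r :* r :+ e :- (l :* l :+ con 0ℚ :* con 0ℚ) := r :* r :- l :* l :+ e) refl (seq ρ n) (seq L n) ε)
          (diff h))
        (IsSpectralRadius.maximal R (fromℝ L) (perron-eigenvalue W) ε 0<ε)
    }

lemma7p2 :
    (n : ℕ) → 2 ℕ.≤ n →
    (a : ℕ → ℝ) → (∀ i → 1 ℕ.≤ i → i ℕ.≤ n → 0ℝ < a i) →
    (ρ : ℕ → ℕ → ℝ) →
    (∀ i j → 1 ℕ.≤ i → i ℕ.≤ j → j ℕ.≤ suc n → IsSpectralRadius (intervalMatrix a i j) (ρ i j)) →
    (∀ i → 1 ℕ.≤ i → i ℕ.≤ suc n → ρ i i ≈ 0ℝ) →
    ρ 2 n * ρ 1 (suc n) ≤ ρ 1 n * ρ 2 (suc n)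
lemma7p2 (suc (suc n)) (ℕ.s≤s (ℕ.s≤s ℕ.z≤n)) a 0<a ρ radius _ ε 0<ε = ev-map
  -- The ring order asserts that a difference is nonnegative, the order of the statement compares
  -- terms up to `ε`; they differ by regrouping rationals.
  (λ k h → undiff (by-ring
    (solve 3 (λ p q e → p :- q :+ e := p :+ e :- q) refl
      (seq (ρ 1 N * ρ 2 (suc N)) k) (seq (ρ 2 N * ρ 1 (suc N)) k) ε) h))
  (radius-inequality n a 0<a
    (isRadius a 1 n (radius 2 N 1≤2 2≤N N≤1+N))
    (isRadius a 0 (suc (suc n)) (radius 1 (suc N) ℕ.≤-refl (ℕ.s≤s ℕ.z≤n) ℕ.≤-refl))
    (isRadius a 0 (suc n) (radius 1 N ℕ.≤-refl (ℕ.s≤s ℕ.z≤n) N≤1+N))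
    (isRadius a 1 (suc n) (radius 2 (suc N) 1≤2 (ℕ.s≤s (ℕ.s≤s ℕ.z≤n)) ℕ.≤-refl))
    ε 0<ε)
  where
  open PathInterval using (isRadius)
  N = suc (suc n)
  1≤2 : 1 ℕ.≤ 2
  1≤2 = ℕ.n≤1+n 1
  2≤N : 2 ℕ.≤ N
  2≤N = ℕ.s≤s (ℕ.s≤s ℕ.z≤n)
  N≤1+N : N ℕ.≤ suc N
  N≤1+N = ℕ.n≤1+n N
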